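{- Let $\mathcal F=(\mathcal V,*,\mu_{ell})$ be an extended Farey symbol with group $\Gamma\subset\mathrm{PSL}_2(\mathbb Z)$ and gluing data $(\gamma_a)_{a\in\mathcal V}$. Let $E=(\mathcal V-\mathcal V_{ell})/*$ be a set of representatives of the quotient of $\mathcal V-\mathcal V_{ell}$ by the involution $*$, whose first element is assumed to be the path $(\infty,0)$, and let $\mathcal A=E\sqcup\mathcal V_{ell}$. Then the $\mathbb Z[\Gamma]$-module $\Delta_0=\mathbb Z[\mathbb P^1(\mathbb Q)]_0$ is the quotient of the free $\mathbb Z[\Gamma]$-module generated by the elements of $\mathcal A$ by the relations $$\sum_{a\in\mathcal A}\lambda_a a=0,\qquad \mu_a a=0\ \text{ for } a\in\mathcal V_{ell},$$ with (1) $\lambda_a=1-\gamma_a^{ -1}$ for $a\in E$ and $\lambda_a=1$ for $a\in\mathcal V_{ell}$; (2) $\mu_a=\sum_{s=0}^{\mu-1}\gamma_a^s$ for $a\in\mathcal V_{ell}$ with $\mu_{ell}(a)=\mu$.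
   Context: Notation. $\mathcal H$ is the Poincaré upper half-plane and $\mathcal H^*=\mathcal H\sqcup\mathbb P^1(\mathbb Q)$. For distinct $r,s\in\mathbb P^1(\mathbb Q)$, $a=(r,s)$ is the oriented geodesic arc (path) in $\mathcal H^*$ from $r$ to $s$, $\overline a=(s,r)$ is the opposite arc, and $A_a=\begin{pmatrix} x_a & y_a \\ z_a & t_a \end{pmatrix}\in M_2(\mathbb Z)$ is the matrix, unique up to sign, with $\det A_a>0$, $r=x_a/z_a$, $s=y_a/t_a$, $\gcd(x_a,z_a)=\gcd(y_a,t_a)=1$. Put $A_a^-=A_a\begin{pmatrix} 0 & -1 \\ 1 & 0 \end{pmatrix}$, which represents $\overline a$. Extended Farey symbol: a triple $(\mathcal V,*,\mu_{ell})$ consisting of: (F1) an oriented convex hyperbolic polygon whose vertices $r_1,\dots,r_n$ are in $\mathbb P^1(\mathbb Q)$; its boundary is the sequence $\mathcal V$ of consecutive arcs $a_1=(r_1,r_2),\ a_2=(r_2,r_3),\dots,a_n=(r_n,r_1)$, considered up to cyclic permutation, and one of the $a_i$ is assumed to be the arc $(\infty,0)$; (F2) an involution $a\mapsto a^*$ of $\mathcal V$; (F3) a map $\mu_{ell}:\mathcal V_{ell}\to\{2,3\}$, where $\mathcal V_{ell}$ is the set of fixed points of $*$; such that (F4) each of the following gluing matrices $\gamma_a$, $a\in\mathcal V$ (the gluing data), lies in $\mathrm{SL}_2(\mathbb Z)$: $\gamma_a=A_a(A_{a^*}^-)^{ -1}$ if $a\notin\mathcal V_{ell}$; $\gamma_a=A_a(A_a^-)^{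 -1}$ if $a\in\mathcal V_{ell}$ and $\mu_{ell}(a)=2$; $\gamma_a=A_a^-\begin{pmatrix} 0 & -1 \\ 1 & -1 \end{pmatrix}(A_a^-)^{ -1}$ if $a\in\mathcal V_{ell}$ and $\mu_{ell}(a)=3$. The group of the symbol is the subgroup $\Gamma\subset\mathrm{PSL}_2(\mathbb Z)$ generated by the $\gamma_a$, $a\in\mathcal V$. In $\mathbb Z[\Gamma]$, $\gamma_a$ denotes its image in $\Gamma$. $\mathbb Z[\mathbb P^1(\mathbb Q)]$ is the group of divisors on $\mathbb P^1(\mathbb Q)$, with basis elements written $\{c\}$, on which $\Gamma$ acts via its action on $\mathbb P^1(\mathbb Q)$; $\Delta_0$ is the subgroup of divisors of degree $0$. An arc $a=(r,s)$ is identified with the divisor $\{s\}-\{r\}\in\Delta_0$; this gives the map from the free module to $\Delta_0$. -}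

module Defs where

open import Algebra.Bundles.Raw using (RawRing)
open import Algebra.Module.Bundles.Raw using (RawLeftModule)
open import Data.Bool.Base using (if_then_else_)
open import Data.Fin.Base as Fin using (Fin; toℕ)
import Data.Fin.Properties as Fin
open import Data.Integer.Base as ℤ using (ℤ; +0; +[1+_]; -[1+_]; 0ℤ; 1ℤ; -1ℤ)
import Data.Integer.Properties as ℤ
open import Data.Integer.Tactic.RingSolver using (solve-∀)
open import Data.List.Base using (List; []; _∷_; _++_; map; applyUpTo; allFin; filter; head; length; lookup; cartesianProductWith)
open import Data.List.Membership.Propositional using (_∈_; _∉_)
open import Data.List.Relation.Unary.Unique.Propositional using (Unique)
open import Data.Maybe.Base using (just)
open import Data.Nat.Base as ℕ using (ℕ; zero; suc)
open import Data.Nat.DivMod using (_mod_)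
open import Data.Product.Base using (Σ; Σ-syntax; _×_; _,_; proj₁)
open import Data.Rational.Base as ℚ using (ℚ; 0ℚ; ↥_; ↧_)
import Data.Rational.Properties as ℚ
open import Data.Sum.Base using (_⊎_; inj₁; inj₂)
open import Data.Unit.Base using (⊤; tt)
open import Data.Vec.Functional using (Vector; foldr)
open import Level using (0ℓ)
open import Relation.Binary.Bundles using (DecSetoid)
open import Relation.Binary.Definitions using (DecidableEquality)
import Relation.Binary.Construct.On as On
open import Relation.Binary.PropositionalEquality using (_≡_; _≢_; refl; sym; trans; cong; cong₂)
import Relation.Binary.PropositionalEquality.Properties as ≡
open import Relation.Nullary.Decidable using (Dec; does; yes; no; map′; _×-dec_; _⊎-dec_)

record M₂ (A : Set) : Set where
  constructor mat
  field
    m₁₁ m₁₂ m₂₁ m₂₂ : A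

mapM : {A B : Set} → (A → B) → M₂ A → M₂ B
mapM f (mat a b c d) = mat (f a) (f b) (f c) (f d)

module MatrixOps (R : RawRing 0ℓ 0ℓ) where
  open RawRing R

  infixl 7 _⊗_
  _⊗_ : M₂ Carrier → M₂ Carrier → M₂ Carrier
  mat a b c d ⊗ mat a′ b′ c′ d′ =
    mat (a * a′ + b * c′) (a * b′ + b * d′)
        (c * a′ + d * c′) (c * b′ + d * d′)

  det : M₂ Carrier → Carrier
  det (mat a b c d) = a * d + - (b * c)

  adj : M₂ Carrier → M₂ Carrier
  adj (mat a b c d) = mat d (- b) (- c) a

  neg : M₂ Carrier → M₂ Carrier
  neg = mapM -_

module Mℤ = MatrixOps ℤ.+-*-rawRing
module Mℚ = MatrixOps ℚ.+-*-rawRing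

toM₂ℚ : M₂ ℤ → M₂ ℚ
toM₂ℚ = mapM (λ k → k ℚ./ 1)

-- Only used for arc matrices, whose determinant is positive; the value on
-- singular matrices is junk.
inverse : M₂ ℚ → M₂ ℚ
inverse M with Mℚ.det M ℚ.≟ 0ℚ
... | yes _   = mat 0ℚ 0ℚ 0ℚ 0ℚ
... | no  d≢0 = mapM (ℚ._* (ℚ.1/ Mℚ.det M) {{ℚ.≢-nonZero d≢0}}) (Mℚ.adj M)

_≟M_ : DecidableEquality (M₂ ℤ)
mat a b c d ≟M mat a′ b′ c′ d′ =
  map′ (λ { (refl , refl , refl , refl) → refl })
       (λ { refl → refl , refl , refl , refl })
       (a ℤ.≟ a′ ×-dec b ℤ.≟ b′ ×-dec c ℤ.≟ c′ ×-dec d ℤ.≟ d′)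

record SL₂ℤ : Set where
  constructor sl
  field
    matrix : M₂ ℤ
    det≡1  : Mℤ.det matrix ≡ 1ℤ
open SL₂ℤ public

det-⊗ : ∀ M N → Mℤ.det (M Mℤ.⊗ N) ≡ Mℤ.det M ℤ.* Mℤ.det N
det-⊗ (mat a b c d) (mat a′ b′ c′ d′) = identity a b c d a′ b′ c′ d′
  where
  identity : ∀ a b c d a′ b′ c′ d′ →
    (a ℤ.* a′ ℤ.+ b ℤ.* c′) ℤ.* (c ℤ.* b′ ℤ.+ d ℤ.* d′) ℤ.+
      ℤ.- ((a ℤ.* b′ ℤ.+ b ℤ.* d′) ℤ.* (c ℤ.* a′ ℤ.+ d ℤ.* c′))
    ≡ (a ℤ.* d ℤ.+ ℤ.- (b ℤ.* c)) ℤ.* (a′ ℤ.* d′ ℤ.+ ℤ.- (b′ ℤ.* c′))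
  identity = solve-∀

det-adj : ∀ M → Mℤ.det (Mℤ.adj M) ≡ Mℤ.det M
det-adj (mat a b c d) = identity a b c d
  where
  identity : ∀ a b c d → d ℤ.* a ℤ.+ ℤ.- (ℤ.- b ℤ.* ℤ.- c) ≡ a ℤ.* d ℤ.+ ℤ.- (b ℤ.* c)
  identity = solve-∀

infixl 7 _∙_
_∙_ : SL₂ℤ → SL₂ℤ → SL₂ℤ
sl M p ∙ sl N q = sl (M Mℤ.⊗ N) (trans (det-⊗ M N) (cong₂ ℤ._*_ p q))

ε : SL₂ℤ
ε = sl (mat 1ℤ 0ℤ 0ℤ 1ℤ) refl

infix 8 _⁻¹
_⁻¹ : SL₂ℤ → SL₂ℤ
sl M p ⁻¹ = sl (Mℤ.adj M) (trans (det-adj M) p)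

infix 4 _≈±_
_≈±_ : SL₂ℤ → SL₂ℤ → Set
g ≈± h = matrix g ≡ matrix h ⊎ matrix g ≡ Mℤ.neg (matrix h)

neg-involutive : ∀ M → Mℤ.neg (Mℤ.neg M) ≡ M
neg-involutive (mat a b c d)
  rewrite ℤ.neg-involutive a | ℤ.neg-involutive b
        | ℤ.neg-involutive c | ℤ.neg-involutive d = refl

≈±-sym : ∀ {g h} → g ≈± h → h ≈± g
≈±-sym         (inj₁ p) = inj₁ (sym p)
≈±-sym {h = h} (inj₂ p) = inj₂ (trans (sym (neg-involutive (matrix h))) (cong Mℤ.neg (sym p)))

≈±-trans : ∀ {g h k} → g ≈± h → h ≈± k → g ≈± k
≈±-trans         (inj₁ p) (inj₁ q) = inj₁ (trans p q)
≈±-trans         (inj₁ p) (inj₂ q) = inj₂ (trans p q)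
≈±-trans         (inj₂ p) (inj₁ q) = inj₂ (trans p (cong Mℤ.neg q))
≈±-trans {k = k} (inj₂ p) (inj₂ q) =
  inj₁ (trans p (trans (cong Mℤ.neg q) (neg-involutive (matrix k))))

PSL₂ℤ : DecSetoid 0ℓ 0ℓ
PSL₂ℤ = record
  { Carrier = SL₂ℤ
  ; _≈_     = _≈±_
  ; isDecEquivalence = record
    { isEquivalence = record
      { refl  = inj₁ refl
      ; sym   = λ {g} {h} → ≈±-sym {g} {h}
      ; trans = λ {g} {h} {k} → ≈±-trans {g} {h} {k}
      }
    ; _≟_ = λ g h → (matrix g ≟M matrix h) ⊎-dec (matrix g ≟M Mℤ.neg (matrix h))
    }
  }

-- The subgroup of PSL₂(ℤ) generated by a family, as a subset of SL₂(ℤ)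
-- closed under ≈±.
data Generated {I : Set} (γ : I → SL₂ℤ) : SL₂ℤ → Set where
  gen  : ∀ i → Generated γ (γ i)
  one  : Generated γ ε
  mul  : ∀ {g h} → Generated γ g → Generated γ h → Generated γ (g ∙ h)
  inv  : ∀ {g} → Generated γ g → Generated γ (g ⁻¹)
  resp : ∀ {g h} → g ≈± h → Generated γ g → Generated γ h

data ℙ¹ : Set where
  ∞   : ℙ¹
  fin : ℚ → ℙ¹

_≟ℙ_ : DecidableEquality ℙ¹
∞     ≟ℙ ∞     = yes refl
∞     ≟ℙ fin _ = no λ ()
fin _ ≟ℙ ∞     = no λ ()
fin p ≟ℙ fin q = map′ (cong fin) (λ { refl → refl }) (p ℚ.≟ q)

-- Coprime homogeneous coordinates; ↥ q and ↧ q are coprime since ℚ is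
-- normalised.
num den : ℙ¹ → ℤ
num ∞       = 1ℤ
num (fin q) = ↥ q
den ∞       = 0ℤ
den (fin q) = ↧ q

-- The point [x : z] (to be used for (x , z) ≠ (0 , 0) only).
ratio : ℤ → ℤ → ℙ¹
ratio x +0       = ∞
ratio x +[1+ n ] = fin (x ℚ./ suc n)
ratio x -[1+ n ] = fin (ℤ.- x ℚ./ suc n)

infixr 7 _•_
_•_ : SL₂ℤ → ℙ¹ → ℙ¹
sl (mat a b c d) _ • r =
  ratio (a ℤ.* num r ℤ.+ b ℤ.* den r) (c ℤ.* num r ℤ.+ d ℤ.* den r)

infix 4 _<ℙ_
data _<ℙ_ : ℙ¹ → ℙ¹ → Set where
  fin<fin : ∀ {p q} → p ℚ.< q → fin p <ℙ fin q
  fin<∞   : ∀ {p} → fin p <ℙ ∞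

-- r, s, t are distinct and met in this order when running through the
-- boundary ℝ ∪ {∞} of the upper half-plane counterclockwise, i.e. along ℝ
-- in increasing order.
Counterclockwise : ℙ¹ → ℙ¹ → ℙ¹ → Set
Counterclockwise r s t =
  (r <ℙ s × s <ℙ t) ⊎ (s <ℙ t × t <ℙ r) ⊎ (t <ℙ r × r <ℙ s)

-- The matrix A_a of the arc a = (r , s): its columns are coprime coordinates
-- of r and s, the sign of the second one being chosen so that det A_a > 0.
arcMatrix : ℙ¹ → ℙ¹ → M₂ ℤ
arcMatrix r s =
  if does (0ℤ ℤ.<? Mℤ.det A) then A
  else mat (num r) (ℤ.- num s) (den r) (ℤ.- den s)
  where
  A : M₂ ℤ
  A = mat (num r) (num s) (den r) (den s)

arcMatrix⁻ : ℙ¹ → ℙ¹ → M₂ ℤ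
arcMatrix⁻ r s = arcMatrix r s Mℤ.⊗ mat 0ℤ -1ℤ 1ℤ 0ℤ

data EllipticOrder : Set where
  two three : EllipticOrder

orderℕ : EllipticOrder → ℕ
orderℕ two   = 2
orderℕ three = 3

-- The triple (𝒱, *, μ_ell) without the integrality condition on the gluing
-- matrices. 𝒱 is indexed by Fin n, the i-th arc being (vertex i , vertex (next i)); the
-- base arc is (∞ , 0). A polygon has at least three vertices: for n = 2 and
-- the two arcs paired, the group would be trivial.
record SidePairing : Set where
  field
    n-3 : ℕ

  n : ℕ
  n = 3 ℕ.+ n-3

  next : Fin n → Fin n
  next i = suc (toℕ i) mod n

  field
    vertex : Fin n → ℙ¹
    -- The polygon is convex, with boundary oriented counterclockwise.
    convex : ∀ {i j k} → i Fin.< j → j Fin.< k →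
             Counterclockwise (vertex i) (vertex j) (vertex k)

    base       : Fin n
    base-start : vertex base ≡ ∞
    base-end   : vertex (next base) ≡ fin 0ℚ

    _* : Fin n → Fin n
    *-involutive : ∀ i → (i *) * ≡ i

  Elliptic : Fin n → Set
  Elliptic i = i * ≡ i

  elliptic? : ∀ i → Dec (Elliptic i)
  elliptic? i = (i *) Fin.≟ i

  field
    μ-ell : ∀ i → Elliptic i → EllipticOrder

  A A⁻ : Fin n → M₂ ℤ
  A  i = arcMatrix  (vertex i) (vertex (next i))
  A⁻ i = arcMatrix⁻ (vertex i) (vertex (next i))

  ellipticGluing : Fin n → EllipticOrder → M₂ ℚ
  ellipticGluing i two   = toM₂ℚ (A i) Mℚ.⊗ inverse (toM₂ℚ (A⁻ i))
  ellipticGluing i three =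
    toM₂ℚ (A⁻ i) Mℚ.⊗ toM₂ℚ (mat 0ℤ -1ℤ 1ℤ -1ℤ) Mℚ.⊗ inverse (toM₂ℚ (A⁻ i))

  gluingMatrix : Fin n → M₂ ℚ
  gluingMatrix i with elliptic? i
  ... | yes e = ellipticGluing i (μ-ell i e)
  ... | no  _ = toM₂ℚ (A i) Mℚ.⊗ inverse (toM₂ℚ (A⁻ (i *)))

record ExtendedFareySymbol : Set where
  field
    sidePairing : SidePairing

  open SidePairing sidePairing public

  field
    γ          : Fin n → SL₂ℤ
    γ-isGluing : ∀ i → toM₂ℚ (matrix (γ i)) ≡ gluingMatrix i

  -- Elements of Γ are compared up to sign only (see Γ-decSetoid).
  Γ : Set
  Γ = Σ SL₂ℤ (Generated γ)

  element : Γ → SL₂ℤ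
  element = proj₁

  Γ-decSetoid : DecSetoid 0ℓ 0ℓ
  Γ-decSetoid = On.decSetoid PSL₂ℤ element

  infixl 7 _∙Γ_
  _∙Γ_ : Γ → Γ → Γ
  (g , p) ∙Γ (h , q) = g ∙ h , mul p q

  εΓ : Γ
  εΓ = ε , one

  infix 8 _⁻¹Γ
  _⁻¹Γ : Γ → Γ
  (g , p) ⁻¹Γ = g ⁻¹ , inv p

  infixr 8 _^Γ_
  _^Γ_ : Γ → ℕ → Γ
  g ^Γ zero  = εΓ
  g ^Γ suc k = g ∙Γ (g ^Γ k)

  γΓ : Fin n → Γ
  γΓ i = γ i , gen i

-- A list E of representatives of (𝒱 − 𝒱_ell)/*, with first element (∞ , 0).
record Representatives (F : ExtendedFareySymbol) : Set where
  open ExtendedFareySymbol F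
  field
    E             : List (Fin n)
    E-unique      : Unique E
    E-nonElliptic : ∀ {i} → i ∈ E → i * ≢ i
    E-covers      : ∀ i → i * ≢ i → i ∈ E ⊎ i * ∈ E
    E-separates   : ∀ {i} → i ∈ E → i * ∉ E
    E-first       : head E ≡ just base

  -- 𝒜 = E ⊔ 𝒱_ell
  𝒜 : List (Fin n)
  𝒜 = E ++ filter elliptic? (allFin n)

Formal : Set → Set
Formal X = List (ℤ × X)

degree : {X : Set} → Formal X → ℤ
degree []            = 0ℤ
degree ((k , _) ∷ D) = k ℤ.+ degree D

negate : {X : Set} → Formal X → Formal X
negate = map (λ { (k , x) → ℤ.- k , x })

bilinear : {X Y Z : Set} → (X → Y → Z) → Formal X → Formal Y → Formal Z
bilinear f = cartesianProductWith (λ { (k , x) (l , y) → k ℤ.* l , f x y })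

module FormalEquality (S : DecSetoid 0ℓ 0ℓ) where
  open DecSetoid S using (Carrier; _≟_)

  coeff : Formal Carrier → Carrier → ℤ
  coeff []            x = 0ℤ
  coeff ((k , y) ∷ D) x = (if does (y ≟ x) then k else 0ℤ) ℤ.+ coeff D x

  infix 4 _≋_
  _≋_ : Formal Carrier → Formal Carrier → Set
  D ≋ D′ = ∀ x → coeff D x ≡ coeff D′ x

degree-++ : {X : Set} (D D′ : Formal X) → degree (D ++ D′) ≡ degree D ℤ.+ degree D′
degree-++ []            D′ = sym (ℤ.+-identityˡ _)
degree-++ ((k , _) ∷ D) D′ =
  trans (cong (ℤ._+_ k) (degree-++ D D′)) (sym (ℤ.+-assoc k (degree D) (degree D′)))

degree-negate : {X : Set} (D : Formal X) → degree (negate D) ≡ ℤ.- degree D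
degree-negate []            = refl
degree-negate ((k , _) ∷ D) =
  trans (cong (ℤ._+_ (ℤ.- k)) (degree-negate D)) (sym (ℤ.neg-distrib-+ k (degree D)))

degree-bilinear : {X Y Z : Set} (f : X → Y → Z) (c : Formal X) (D : Formal Y) →
                  degree (bilinear f c D) ≡ degree c ℤ.* degree D
degree-bilinear f []            D = refl
degree-bilinear f ((k , x) ∷ c) D =
  trans (degree-++ (row D) (bilinear f c D))
    (trans (cong₂ ℤ._+_ (degree-row D) (degree-bilinear f c D))
           (sym (ℤ.*-distribʳ-+ (degree D) k (degree c))))
  where
  row = map (λ { (l , y) → k ℤ.* l , f x y })
  degree-row : ∀ D → degree (row D) ≡ k ℤ.* degree D
  degree-row []            = sym (ℤ.*-zeroʳ k)
  degree-row ((l , _) ∷ D) =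
    trans (cong (ℤ._+_ (k ℤ.* l)) (degree-row D)) (sym (ℤ.*-distribˡ-+ k l (degree D)))

Divisor : Set
Divisor = Formal ℙ¹

module Div = FormalEquality (≡.decSetoid _≟ℙ_)

record Divisor₀ : Set where
  constructor _,₀_
  field
    divisor  : Divisor
    degree≡0 : degree divisor ≡ 0ℤ
open Divisor₀ public

infixl 6 _+₀_
_+₀_ : Divisor₀ → Divisor₀ → Divisor₀
(D ,₀ p) +₀ (D′ ,₀ p′) = (D ++ D′) ,₀ trans (degree-++ D D′) (cong₂ ℤ._+_ p p′)

-₀_ : Divisor₀ → Divisor₀
-₀ (D ,₀ p) = negate D ,₀ trans (degree-negate D) (cong ℤ.-_ p)

0₀ : Divisor₀
0₀ = [] ,₀ refl

arcDivisor : ℙ¹ → ℙ¹ → Divisor₀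
arcDivisor r s = ((1ℤ , s) ∷ (-1ℤ , r) ∷ []) ,₀ refl

module GroupRing (F : ExtendedFareySymbol) where
  open ExtendedFareySymbol F

  ℤ[Γ] : Set
  ℤ[Γ] = Formal Γ

  open FormalEquality Γ-decSetoid public using () renaming (_≋_ to _≋Γ_; coeff to coeffΓ)

  infixl 7 _*Γ_
  _*Γ_ : ℤ[Γ] → ℤ[Γ] → ℤ[Γ]
  _*Γ_ = bilinear _∙Γ_

  1Γ : ℤ[Γ]
  1Γ = (1ℤ , εΓ) ∷ []

  infixr 7 _•₀_
  _•₀_ : ℤ[Γ] → Divisor₀ → Divisor₀
  c •₀ (D ,₀ p) = bilinear act c D ,₀
    trans (degree-bilinear act c D) (trans (cong (degree c ℤ.*_) p) (ℤ.*-zeroʳ (degree c)))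
    where
    act : Γ → ℙ¹ → ℙ¹
    act g r = element g • r

  Δ₀ : RawLeftModule ℤ[Γ] 0ℓ 0ℓ
  Δ₀ = record
    { Carrierᴹ = Divisor₀
    ; _≈ᴹ_     = λ D D′ → divisor D Div.≋ divisor D′
    ; _+ᴹ_     = _+₀_
    ; _*ₗ_     = _•₀_
    ; 0ᴹ       = 0₀
    ; -ᴹ_      = -₀_
    }

  FreeModule : ℕ → RawLeftModule ℤ[Γ] 0ℓ 0ℓ
  FreeModule m = record
    { Carrierᴹ = Vector ℤ[Γ] m
    ; _≈ᴹ_     = λ u v → ∀ j → u j ≋Γ v j
    ; _+ᴹ_     = λ u v j → u j ++ v j
    ; _*ₗ_     = λ c v j → c *Γ v j
    ; 0ᴹ       = λ _ → []
    ; -ᴹ_      = λ v j → negate (v j)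
    }

module _ {R : Set} (M : RawLeftModule R 0ℓ 0ℓ) {I : Set} (x : I → RawLeftModule.Carrierᴹ M) where
  open RawLeftModule M

  data Span : Carrierᴹ → Set where
    span-gen  : ∀ i → Span (x i)
    span-0    : Span 0ᴹ
    span-+    : ∀ {u v} → Span u → Span v → Span (u +ᴹ v)
    span-*    : ∀ c {v} → Span v → Span (c *ₗ v)
    span-resp : ∀ {u v} → u ≈ᴹ v → Span u → Span v

  Quotient : RawLeftModule R 0ℓ 0ℓ
  Quotient = record
    { Carrierᴹ = Carrierᴹ
    ; _≈ᴹ_     = λ u v → Span (u +ᴹ (-ᴹ v))
    ; _+ᴹ_     = _+ᴹ_
    ; _*ₗ_     = _*ₗ_
    ; 0ᴹ       = 0ᴹ
    ; -ᴹ_      = -ᴹ_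
    }

module Presentation (F : ExtendedFareySymbol) (reps : Representatives F) where
  open ExtendedFareySymbol F
  open Representatives reps
  open GroupRing F public

  rank : ℕ
  rank = length 𝒜

  arc : Fin rank → Fin n
  arc = lookup 𝒜

  free : RawLeftModule ℤ[Γ] 0ℓ 0ℓ
  free = FreeModule rank

  λ-coeff : Fin n → ℤ[Γ]
  λ-coeff i with elliptic? i
  ... | yes _ = 1Γ
  ... | no  _ = 1Γ ++ negate ((1ℤ , γΓ i ⁻¹Γ) ∷ [])

  μ-coeff : ∀ i → Elliptic i → ℤ[Γ]
  μ-coeff i e = applyUpTo (λ s → 1ℤ , γΓ i ^Γ s) (orderℕ (μ-ell i e))

  single : Fin rank → ℤ[Γ] → Vector ℤ[Γ] rank
  single j c j′ = if does (j Fin.≟ j′) then c else []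

  RelationIndex : Set
  RelationIndex = ⊤ ⊎ (Σ[ j ∈ Fin rank ] Elliptic (arc j))

  relation : RelationIndex → Vector ℤ[Γ] rank
  relation (inj₁ tt)      = λ j → λ-coeff (arc j)
  relation (inj₂ (j , e)) = single j (μ-coeff (arc j) e)

  presented : RawLeftModule ℤ[Γ] 0ℓ 0ℓ
  presented = Quotient free relation

  toΔ₀ : Vector ℤ[Γ] rank → Divisor₀
  toΔ₀ v = foldr _+₀_ 0₀ (λ j → v j •₀ arcDivisor (vertex (arc j)) (vertex (next (arc j))))

{-# OPTIONS --safe #-}
module Submission where

-- Call a point of ℙ¹(ℚ) behind a side of the polygon if the side separates it
-- from the polygon; every point is a vertex or behind exactly one side i, and
-- crossing that side (replacing q by γ i ⁻¹ • q) brings it nearer to the polygon.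
-- Nearness is measured by ∣ω r q∣ ∣ω s q∣ / ∣ω r s∣ for the side (r , s) that q is
-- behind, where ω is the determinant of coprime coordinates: this is invariant
-- under SL₂(ℤ), has bounded denominators, and drops strictly at each crossing by
-- the Plücker relation. Hence every point is reached from a vertex, which makes
-- toΔ₀ surjective.
--
-- For injectivity, let M be the presented module. Summing the classes of the
-- sides along the boundary gives a value ψ in M at every vertex (the first
-- relation says that the sum closes up), and ψ is extended over the crossings by
-- ψ (γ i • q) = γ i ψ (q) + cᵢ, with cᵢ determined by the end points of side i.
-- The remaining relations make this hold for all i and q, so that
-- ψ (g • s) − ψ (g • r) = g [a] for every g ∈ Γ and side a = (r , s). Integrating
-- ψ against divisors is therefore a left inverse of toΔ₀.

open import Defs
open import Algebra.Bundles using (AbelianGroup; Ring)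
open import Algebra.Module.Bundles using (LeftModule)
open import Algebra.Module.Bundles.Raw using (RawLeftModule)
import Algebra.Module.Construct.TensorUnit as TensorUnit
open import Algebra.Module.Morphism.Structures using (module LeftModuleMorphisms)
import Algebra.Properties.AbelianGroup as AbelianGroupProperties
import Algebra.Properties.CommutativeSemigroup as CommutativeSemigroupProperties
open import Algebra.Structures using (IsAbelianGroup; IsRing)
open import Axiom.UniquenessOfIdentityProofs.WithK using (uip)
open import Data.Bool.Base using (true; false; if_then_else_)
open import Data.Empty using (⊥-elim)
open import Data.Fin.Base as Fin using (Fin; zero; suc; toℕ; fromℕ; inject₁)
import Data.Fin.Induction as Fin
import Data.Fin.Properties as Fin
open import Data.Fin.Relation.Unary.Top using (view; ‵fromℕ; ‵inject₁)
open import Data.Integer.Base as ℤ using (ℤ; +_; +0; +[1+_]; -[1+_]; 0ℤ; 1ℤ; -1ℤ; ∣_∣; +<+)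
import Data.Integer.Divisibility.Signed as ℤ
import Data.Integer.GCD as ℤ
import Data.Integer.Properties as ℤ
open import Data.Integer.Tactic.RingSolver using (solve-∀)
open import Data.List.Base using (List; []; _∷_; _++_; foldr; map; tabulate; allFin; filter; length; lookup; applyUpTo)
open import Data.List.Membership.Propositional using (_∈_)
open import Data.List.Membership.Propositional.Properties using (∈-++⁺ˡ; ∈-++⁺ʳ; ∈-++⁻; ∈-map⁺; ∈-map⁻; ∈-filter⁺; ∈-filter⁻; ∈-allFin; ∈-lookup)
open import Data.List.Membership.Propositional.Properties.WithK using (unique∧set⇒bag)
open import Data.List.Properties using (map-tabulate; map-++; map-∘)
open import Data.List.Relation.Binary.BagAndSetEquality using (∼bag⇒↭)
open import Data.List.Relation.Binary.Permutation.Propositional as ↭ using (_↭_)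
import Data.List.Relation.Binary.Permutation.Propositional.Properties as ↭
import Data.List.Relation.Unary.All as All
import Data.List.Relation.Unary.All.Properties as All
open import Data.List.Relation.Unary.AllPairs using (_∷_)
open import Data.List.Relation.Unary.Any using (here; there; index)
open import Data.List.Relation.Unary.Any.Properties using (lookup-index)
open import Data.List.Relation.Unary.Unique.Propositional using (Unique)
import Data.List.Relation.Unary.Unique.Propositional.Properties as Unique
open import Data.Nat.Base as ℕ using (ℕ; zero; suc; z≤n; s≤s)
import Data.Nat.Coprimality as ℕ
import Data.Nat.Divisibility as ℕ
import Data.Nat.DivMod as ℕ
import Data.Nat.ListAction as ℕ
import Data.Nat.ListAction.Properties as ℕ
import Data.Nat.Properties as ℕ
import Data.Nat.Tactic.RingSolver as ℕ
open import Data.Product.Base using (Σ-syntax; ∃; _×_; _,_; proj₁; proj₂)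
open import Data.Rational.Base as ℚ using (ℚ; mkℚ; 0ℚ; ↥_; ↧_; *<*)
import Data.Rational.Properties as ℚ
open import Data.Rational.Unnormalised.Base as ℚᵘ using (mkℚᵘ; *≡*)
import Data.Rational.Unnormalised.Properties as ℚᵘ
open import Data.Sum.Base using (_⊎_; inj₁; inj₂; [_,_]′)
open import Data.Unit.Base using (tt)
open import Data.Vec.Functional as Vector using (Vector)
open import Function.Base using (_∘_)
open import Function.Bundles using (mk⇔)
open import Level using (0ℓ)
open import Relation.Binary.Bundles using (DecSetoid)
open import Relation.Binary.Definitions using (tri<; tri≈; tri>)
open import Relation.Binary.PropositionalEquality as ≡ using (_≡_; _≢_; refl; sym; trans; cong; cong₂; subst; subst₂; ≢-sym; module ≡-Reasoning)
import Relation.Binary.PropositionalEquality.Properties as ≡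
open import Relation.Nullary.Decidable using (Dec; does; yes; no; toSum; dec⇒maybe; dec-true; dec-false)
open import Relation.Nullary.Negation using (¬_; contradiction)
import Tactic.RingSolver as RingSolver
open import Tactic.RingSolver.Core.AlmostCommutativeRing using (AlmostCommutativeRing; fromCommutativeRing)

-- The cyclic order on ℙ¹(ℚ)

-- Transporting values of ψ along words in the `γ i` would demand consistency with every relation of
-- Γ. Instead ψ q is computed along one path only, the descent from q to a vertex, in which each
-- step is forced by the position of q; equivariance is then verified for one generator at a time,
-- and comparing the descents of q and `γ i • q` takes at most the first step of each. All geometry
-- is expressed on the boundary, through the cyclic order of ℙ¹(ℚ) and the integers `ω r s`. Two
-- features of extended Farey symbols shape the argument. Sides need not have determinant 1, so
-- weights behind different sides become comparable only after division by `∣ω r s∣`. And a side of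
-- order 3 is not reversed by its gluing matrix: an ideal triangle is erected on it, whose vertices
-- are rotated, so the region behind such a side has two sectors, entered by `γ i` and by its
-- inverse. In the module, the affine map attached to `γ i` must then be shown to have order 3 as
-- well.

<ℙ-trans : ∀ {r s t} → r <ℙ s → s <ℙ t → r <ℙ t
<ℙ-trans (fin<fin p<q) (fin<fin q<r) = fin<fin (ℚ.<-trans p<q q<r)
<ℙ-trans (fin<fin _)   fin<∞         = fin<∞

<ℙ-irrefl : ∀ {r} → ¬ (r <ℙ r)
<ℙ-irrefl (fin<fin p<p) = ℚ.<-irrefl refl p<p

<ℙ-asym : ∀ {r s} → r <ℙ s → ¬ (s <ℙ r)
<ℙ-asym r<s s<r = <ℙ-irrefl (<ℙ-trans r<s s<r)

<ℙ-connex : ∀ r s → r ≢ s → r <ℙ s ⊎ s <ℙ r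
<ℙ-connex ∞       ∞       r≢s = contradiction refl r≢s
<ℙ-connex ∞       (fin _) _   = inj₂ fin<∞
<ℙ-connex (fin _) ∞       _   = inj₁ fin<∞
<ℙ-connex (fin p) (fin q) r≢s with ℚ.<-cmp p q
... | tri< p<q _ _ = inj₁ (fin<fin p<q)
... | tri≈ _ p≡q _ = contradiction (cong fin p≡q) r≢s
... | tri> _ _ q<p = inj₂ (fin<fin q<p)

CCW-rotate : ∀ {r s t} → Counterclockwise r s t → Counterclockwise s t r
CCW-rotate (inj₁ x)        = inj₂ (inj₂ x)
CCW-rotate (inj₂ (inj₁ x)) = inj₁ x
CCW-rotate (inj₂ (inj₂ x)) = inj₂ (inj₁ x)

CCW-rotate⁻¹ : ∀ {r s t} → Counterclockwise r s t → Counterclockwise t r s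
CCW-rotate⁻¹ c = CCW-rotate (CCW-rotate c)

-- Cutting the circle at r makes `Counterclockwise r` a strict order on the remaining points; this
-- is its transitivity.
CCW-trans : ∀ {r s t u} → Counterclockwise r s t → Counterclockwise r t u → Counterclockwise r s u
CCW-trans (inj₁ (r<s , s<t))        (inj₁ (_ , t<u))          = inj₁ (r<s , <ℙ-trans s<t t<u)
CCW-trans (inj₁ (r<s , s<t))        (inj₂ (inj₁ (t<u , u<r))) = ⊥-elim (<ℙ-asym (<ℙ-trans r<s s<t) (<ℙ-trans t<u u<r))
CCW-trans (inj₁ (r<s , _))          (inj₂ (inj₂ (u<r , _)))   = inj₂ (inj₂ (u<r , r<s))
CCW-trans (inj₂ (inj₁ (_ , t<r)))   (inj₁ (r<t , _))          = ⊥-elim (<ℙ-asym t<r r<t)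
CCW-trans (inj₂ (inj₁ (s<t , _)))   (inj₂ (inj₁ (t<u , u<r))) = inj₂ (inj₁ (<ℙ-trans s<t t<u , u<r))
CCW-trans (inj₂ (inj₁ (_ , t<r)))   (inj₂ (inj₂ (_ , r<t)))   = ⊥-elim (<ℙ-asym t<r r<t)
CCW-trans (inj₂ (inj₂ (t<r , _)))   (inj₁ (r<t , _))          = ⊥-elim (<ℙ-asym t<r r<t)
CCW-trans (inj₂ (inj₂ (_ , r<s)))   (inj₂ (inj₁ (_ , u<r)))   = inj₂ (inj₂ (u<r , r<s))
CCW-trans (inj₂ (inj₂ (t<r , _)))   (inj₂ (inj₂ (_ , r<t)))   = ⊥-elim (<ℙ-asym t<r r<t)

CCW-transʳ : ∀ {r s t u} → Counterclockwise r s t → Counterclockwise r t u → Counterclockwise s t u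
CCW-transʳ rst rtu = CCW-rotate⁻¹ (CCW-trans (CCW-rotate rtu) (CCW-rotate⁻¹ rst))

CCW-distinct : ∀ {r s t} → Counterclockwise r s t → r ≢ s
CCW-distinct (inj₁ (r<s , _))          refl = <ℙ-irrefl r<s
CCW-distinct (inj₂ (inj₁ (s<t , t<r))) refl = <ℙ-asym s<t t<r
CCW-distinct (inj₂ (inj₂ (_ , r<s)))   refl = <ℙ-irrefl r<s

CCW-asym : ∀ {r s t} → Counterclockwise r s t → ¬ Counterclockwise r t s
CCW-asym rst rts = CCW-distinct (CCW-rotate (CCW-trans rst rts)) refl

CCW-connex : ∀ {r s t} → r ≢ s → s ≢ t → t ≢ r → Counterclockwise r s t ⊎ Counterclockwise r t s
CCW-connex {r} {s} {t} r≢s s≢t t≢r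
  with <ℙ-connex r s r≢s | <ℙ-connex s t s≢t | <ℙ-connex t r t≢r
... | inj₁ r<s | inj₁ s<t | _        = inj₁ (inj₁ (r<s , s<t))
... | inj₁ r<s | inj₂ t<s | inj₁ t<r = inj₁ (inj₂ (inj₂ (t<r , r<s)))
... | inj₁ r<s | inj₂ t<s | inj₂ r<t = inj₂ (inj₁ (r<t , t<s))
... | inj₂ s<r | inj₁ s<t | inj₁ t<r = inj₁ (inj₂ (inj₁ (s<t , t<r)))
... | inj₂ s<r | inj₁ s<t | inj₂ r<t = inj₂ (inj₂ (inj₂ (s<r , r<t)))
... | inj₂ s<r | inj₂ t<s | _        = inj₂ (inj₂ (inj₁ (t<s , s<r)))

-- The symplectic form in coprime coordinates

ω : ℙ¹ → ℙ¹ → ℤ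
ω r s = num r ℤ.* den s ℤ.+ ℤ.- (num s ℤ.* den r)

-- Positive exactly on counterclockwise triples; each point enters twice, so
-- the signs of its coordinates do not matter.
orientation : ℙ¹ → ℙ¹ → ℙ¹ → ℤ
orientation r s t = ω r s ℤ.* ω s t ℤ.* ω t r

ω-antisym : ∀ r s → ω s r ≡ ℤ.- ω r s
ω-antisym r s = identity (num r) (den r) (num s) (den s)
  where
  identity : ∀ x z y t → y ℤ.* z ℤ.+ ℤ.- (x ℤ.* t) ≡ ℤ.- (x ℤ.* t ℤ.+ ℤ.- (y ℤ.* z))
  identity = solve-∀

∣ω∣-comm : ∀ r s → ∣ ω r s ∣ ≡ ∣ ω s r ∣
∣ω∣-comm r s = trans (cong ∣_∣ (ω-antisym s r)) (ℤ.∣-i∣≡∣i∣ (ω s r))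

ω-refl : ∀ r → ω r r ≡ 0ℤ
ω-refl r = ℤ.+-inverseʳ (num r ℤ.* den r)

<ℙ⇒0<ω : ∀ {r s} → r <ℙ s → 0ℤ ℤ.< ω s r
<ℙ⇒0<ω (fin<fin {p} {q} (*<* lt)) =
  subst (ℤ._< (↥ q ℤ.* ↧ p ℤ.+ ℤ.- (↥ p ℤ.* ↧ q))) (ℤ.+-inverseʳ (↥ p ℤ.* ↧ q)) (ℤ.+-monoˡ-< (ℤ.- (↥ p ℤ.* ↧ q)) lt)
<ℙ⇒0<ω (fin<∞ {mkℚ n d _}) =
  subst (0ℤ ℤ.<_) (sym (trans (cong₂ ℤ._+_ (ℤ.*-identityˡ +[1+ d ]) (cong ℤ.-_ (ℤ.*-zeroʳ n))) (ℤ.+-identityʳ +[1+ d ])))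
        (+<+ ℕ.z<s)

<ℙ⇒ω<0 : ∀ {r s} → r <ℙ s → ω r s ℤ.< 0ℤ
<ℙ⇒ω<0 {r} {s} r<s = subst (ℤ._< 0ℤ) (sym (ω-antisym s r)) (ℤ.neg-mono-< (<ℙ⇒0<ω r<s))

-- Distinct points are comparable for `<ℙ`, and comparability gives ω a strict sign.
ω≡0⇒≡ : ∀ {r s} → ω r s ≡ 0ℤ → r ≡ s
ω≡0⇒≡ {r} {s} ω≡0 with r ≟ℙ s
... | yes r≡s = r≡s
... | no  r≢s with <ℙ-connex r s r≢s
...   | inj₁ r<s = ⊥-elim (ℤ.<-irrefl ω≡0 (<ℙ⇒ω<0 r<s))
...   | inj₂ s<r = ⊥-elim (ℤ.<-irrefl (sym ω≡0) (<ℙ⇒0<ω s<r))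

neg*neg>0 : ∀ {i j} → i ℤ.< 0ℤ → j ℤ.< 0ℤ → 0ℤ ℤ.< i ℤ.* j
neg*neg>0 { -[1+ _ ]} { -[1+ _ ]} _ _ = +<+ ℕ.z<s
neg*neg>0 {+ _} (+<+ ()) _
neg*neg>0 { -[1+ _ ]} {+ _} _ (+<+ ())

pos*pos>0 : ∀ {i j} → 0ℤ ℤ.< i → 0ℤ ℤ.< j → 0ℤ ℤ.< i ℤ.* j
pos*pos>0 {+[1+ _ ]} {+[1+ _ ]} _ _ = +<+ ℕ.z<s
pos*pos>0 {+0} (+<+ ()) _
pos*pos>0 {+[1+ _ ]} {+0} _ (+<+ ())

orientation-rotate : ∀ r s t → orientation s t r ≡ orientation r s t
orientation-rotate r s t = identity (ω r s) (ω s t) (ω t r)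
  where
  identity : ∀ a b c → b ℤ.* c ℤ.* a ≡ a ℤ.* b ℤ.* c
  identity = solve-∀

orientation-swap : ∀ r s t → orientation r t s ≡ ℤ.- orientation r s t
orientation-swap r s t
  rewrite ω-antisym r s | ω-antisym s t | ω-antisym t r = identity (ω r s) (ω s t) (ω t r)
  where
  identity : ∀ a b c → ℤ.- c ℤ.* ℤ.- b ℤ.* ℤ.- a ≡ ℤ.- (a ℤ.* b ℤ.* c)
  identity = solve-∀

CCW⇒orientation>0 : ∀ {r s t} → Counterclockwise r s t → 0ℤ ℤ.< orientation r s t
CCW⇒orientation>0 {r} {s} {t} = λ where
    (inj₁ (r<s , s<t))        → increasing r<s s<t
    (inj₂ (inj₁ (s<t , t<r))) → subst (0ℤ ℤ.<_) (orientation-rotate r s t) (increasing s<t t<r)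
    (inj₂ (inj₂ (t<r , r<s))) → subst (0ℤ ℤ.<_) (sym (orientation-rotate t r s)) (increasing t<r r<s)
  where
  increasing : ∀ {r s t} → r <ℙ s → s <ℙ t → 0ℤ ℤ.< orientation r s t
  increasing r<s s<t =
    pos*pos>0 (neg*neg>0 (<ℙ⇒ω<0 r<s) (<ℙ⇒ω<0 s<t)) (<ℙ⇒0<ω (<ℙ-trans r<s s<t))

-- Coinciding points would make a factor vanish, and the reversed order would make the product
-- negative. This converse turns the polynomial identity `orientation-•` into invariance of the
-- cyclic order.
orientation>0⇒CCW : ∀ {r s t} → 0ℤ ℤ.< orientation r s t → Counterclockwise r s t
orientation>0⇒CCW {r} {s} {t} 0<o = [ (λ c → c) , (λ c → contradiction (CCW⇒orientation>0 c) reversed) ]′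
    (CCW-connex r≢s s≢t t≢r)
  where
  reversed : ¬ (0ℤ ℤ.< orientation r t s)
  reversed 0<o′ = ℤ.<-asym 0<o
    (subst (ℤ._< 0ℤ) (ℤ.neg-involutive _) (ℤ.neg-mono-< (subst (0ℤ ℤ.<_) (orientation-swap r s t) 0<o′)))
  r≢s : r ≢ s
  r≢s refl rewrite ω-refl r = ℤ.<-irrefl refl 0<o
  s≢t : s ≢ t
  s≢t refl rewrite ω-refl s | ℤ.*-zeroʳ (ω r s) = ℤ.<-irrefl refl 0<o
  t≢r : t ≢ r
  t≢r refl rewrite ω-refl t | ℤ.*-zeroʳ (ω t s ℤ.* ω s t) = ℤ.<-irrefl refl 0<o

-- The action of SL₂(ℤ)

coprime-num-den : ∀ r → ℕ.Coprime ∣ num r ∣ ∣ den r ∣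
coprime-num-den ∞                     = ℕ.1-coprimeTo 0
coprime-num-den (fin (mkℚ _ _ coprime)) = ℕ.recompute coprime

-- Applying the adjugate to the new pair recovers the old one, so a common divisor of the new
-- coordinates divides the old ones.
coprime-matrix : ∀ (g : SL₂ℤ) {x z} → ℕ.Coprime ∣ x ∣ ∣ z ∣ → let mat a b c d = matrix g in
                 ℕ.Coprime ∣ a ℤ.* x ℤ.+ b ℤ.* z ∣ ∣ c ℤ.* x ℤ.+ d ℤ.* z ∣
coprime-matrix (sl (mat a b c d) det≡1) {x} {z} coprime {k} (k∣x′ , k∣z′) =
  coprime (divides-by d (ℤ.- b) (identity₁ a b c d x z) , divides-by (ℤ.- c) a (identity₂ a b c d x z))
  where
  x′ = a ℤ.* x ℤ.+ b ℤ.* z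
  z′ = c ℤ.* x ℤ.+ d ℤ.* z
  identity₁ : ∀ a b c d x z →
    d ℤ.* (a ℤ.* x ℤ.+ b ℤ.* z) ℤ.+ ℤ.- b ℤ.* (c ℤ.* x ℤ.+ d ℤ.* z) ≡ (a ℤ.* d ℤ.+ ℤ.- (b ℤ.* c)) ℤ.* x
  identity₁ = solve-∀
  identity₂ : ∀ a b c d x z →
    ℤ.- c ℤ.* (a ℤ.* x ℤ.+ b ℤ.* z) ℤ.+ a ℤ.* (c ℤ.* x ℤ.+ d ℤ.* z) ≡ (a ℤ.* d ℤ.+ ℤ.- (b ℤ.* c)) ℤ.* z
  identity₂ = solve-∀
  divides-by : ∀ {y} p q → p ℤ.* x′ ℤ.+ q ℤ.* z′ ≡ (a ℤ.* d ℤ.+ ℤ.- (b ℤ.* c)) ℤ.* y → k ℕ.∣ ∣ y ∣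
  divides-by {y} p q eq =
    ℤ.∣⇒∣ᵤ (subst (+ k ℤ.∣_) (trans eq (trans (cong (ℤ._* y) det≡1) (ℤ.*-identityˡ y)))
      (ℤ.∣m∣n⇒∣m+n (ℤ.∣n⇒∣m*n p (ℤ.∣ᵤ⇒∣ k∣x′)) (ℤ.∣n⇒∣m*n q (ℤ.∣ᵤ⇒∣ k∣z′))))

IsSign : ℤ → Set
IsSign σ = σ ℤ.* σ ≡ 1ℤ

∣i∣≡1⇒isSign : ∀ i → ∣ i ∣ ≡ 1 → IsSign i
∣i∣≡1⇒isSign (+ 1)      refl = refl
∣i∣≡1⇒isSign -[1+ 0 ]   refl = refl

-- `ratio` makes the denominator nonnegative, so a coprime pair is recovered only up to a common
-- sign σ. These signs accompany every formula for the action.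
ratio-coordinates : ∀ x z → ℕ.Coprime ∣ x ∣ ∣ z ∣ →
  Σ[ σ ∈ ℤ ] IsSign σ × num (ratio x z) ≡ σ ℤ.* x × den (ratio x z) ≡ σ ℤ.* z
-- The point is ∞, with coordinates (1 , 0); being coprime to 0, x is ±1 and serves as its own sign.
ratio-coordinates x +0 coprime = x , x*x≡1 , sym x*x≡1 , sym (ℤ.*-zeroʳ x)
  where
  x*x≡1 : x ℤ.* x ≡ 1ℤ
  x*x≡1 = ∣i∣≡1⇒isSign x (coprime (ℕ.∣-refl , _ ℕ.∣0))
ratio-coordinates x +[1+ n ] coprime = 1ℤ , refl
  , trans (trans (by-gcd _) (ℚ.↥-/ x (suc n))) (sym (ℤ.*-identityˡ x))
  , trans (trans (by-gcd _) (ℚ.↧-/ x (suc n))) (sym (ℤ.*-identityˡ +[1+ n ]))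
  where
  by-gcd : ∀ k → k ≡ k ℤ.* ℤ.gcd x (+ suc n)
  by-gcd k = sym (trans (cong (λ m → k ℤ.* (+ m)) (ℕ.coprime⇒gcd≡1 coprime)) (ℤ.*-identityʳ k))
ratio-coordinates x -[1+ n ] coprime = -1ℤ , refl
  , trans (trans (by-gcd _) (ℚ.↥-/ (ℤ.- x) (suc n))) (sym (ℤ.-1*i≡-i x))
  , trans (trans (by-gcd _) (ℚ.↧-/ (ℤ.- x) (suc n))) (sym (ℤ.-1*i≡-i -[1+ n ]))
  where
  by-gcd : ∀ k → k ≡ k ℤ.* ℤ.gcd (ℤ.- x) (+ suc n)
  by-gcd k = sym (trans
    (cong (λ m → k ℤ.* (+ m)) (ℕ.coprime⇒gcd≡1 (subst (λ m → ℕ.Coprime m (suc n)) (sym (ℤ.∣-i∣≡∣i∣ x)) coprime)))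
    (ℤ.*-identityʳ k))

action-coordinates : ∀ g r → let mat a b c d = matrix g in
  Σ[ σ ∈ ℤ ] IsSign σ × num (g • r) ≡ σ ℤ.* (a ℤ.* num r ℤ.+ b ℤ.* den r)
                      × den (g • r) ≡ σ ℤ.* (c ℤ.* num r ℤ.+ d ℤ.* den r)
action-coordinates g@(sl (mat a b c d) _) r =
  ratio-coordinates (a ℤ.* num r ℤ.+ b ℤ.* den r) (c ℤ.* num r ℤ.+ d ℤ.* den r)
    (coprime-matrix g (coprime-num-den r))

action-sign : SL₂ℤ → ℙ¹ → ℤ
action-sign g r = proj₁ (action-coordinates g r)

action-sign-isSign : ∀ g r → IsSign (action-sign g r)
action-sign-isSign g r = proj₁ (proj₂ (action-coordinates g r))

num-• : ∀ g r → let mat a b c d = matrix g in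
        num (g • r) ≡ action-sign g r ℤ.* (a ℤ.* num r ℤ.+ b ℤ.* den r)
num-• g r = proj₁ (proj₂ (proj₂ (action-coordinates g r)))

den-• : ∀ g r → let mat a b c d = matrix g in
        den (g • r) ≡ action-sign g r ℤ.* (c ℤ.* num r ℤ.+ d ℤ.* den r)
den-• g r = proj₂ (proj₂ (proj₂ (action-coordinates g r)))

ω-• : ∀ g r s → ω (g • r) (g • s) ≡ action-sign g r ℤ.* action-sign g s ℤ.* ω r s
ω-• g@(sl (mat a b c d) det≡1) r s
  rewrite num-• g r | den-• g r | num-• g s | den-• g s =
  trans (identity (action-sign g r) (action-sign g s) a b c d (num r) (den r) (num s) (den s))
        (cong (action-sign g r ℤ.* action-sign g s ℤ.*_)
              (trans (cong (ℤ._* ω r s) det≡1) (ℤ.*-identityˡ (ω r s))))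
  where
  identity : ∀ σ τ a b c d x z y t →
    σ ℤ.* (a ℤ.* x ℤ.+ b ℤ.* z) ℤ.* (τ ℤ.* (c ℤ.* y ℤ.+ d ℤ.* t)) ℤ.+
      ℤ.- (τ ℤ.* (a ℤ.* y ℤ.+ b ℤ.* t) ℤ.* (σ ℤ.* (c ℤ.* x ℤ.+ d ℤ.* z)))
    ≡ σ ℤ.* τ ℤ.* ((a ℤ.* d ℤ.+ ℤ.- (b ℤ.* c)) ℤ.* (x ℤ.* t ℤ.+ ℤ.- (y ℤ.* z)))
  identity = solve-∀

∣sign∣≡1 : ∀ σ → IsSign σ → ∣ σ ∣ ≡ 1
∣sign∣≡1 σ σσ≡1 = ℕ.m*n≡1⇒m≡1 ∣ σ ∣ ∣ σ ∣ (trans (sym (ℤ.abs-* σ σ)) (cong ∣_∣ σσ≡1))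

∣ω∣-• : ∀ g r s → ∣ ω (g • r) (g • s) ∣ ≡ ∣ ω r s ∣
∣ω∣-• g r s = begin
  ∣ ω (g • r) (g • s) ∣                 ≡⟨ cong ∣_∣ (ω-• g r s) ⟩
  ∣ σ ℤ.* τ ℤ.* ω r s ∣                 ≡⟨ ℤ.abs-* (σ ℤ.* τ) (ω r s) ⟩
  ∣ σ ℤ.* τ ∣ ℕ.* ∣ ω r s ∣             ≡⟨ cong (ℕ._* ∣ ω r s ∣) (ℤ.abs-* σ τ) ⟩
  ∣ σ ∣ ℕ.* ∣ τ ∣ ℕ.* ∣ ω r s ∣         ≡⟨ cong₂ (λ m n → m ℕ.* n ℕ.* ∣ ω r s ∣) (∣sign∣≡1 σ (action-sign-isSign g r))
                                                                                  (∣sign∣≡1 τ (action-sign-isSign g s)) ⟩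
  1 ℕ.* ∣ ω r s ∣                       ≡⟨ ℕ.*-identityˡ ∣ ω r s ∣ ⟩
  ∣ ω r s ∣ ∎
  where
  open ≡-Reasoning
  σ = action-sign g r
  τ = action-sign g s

orientation-• : ∀ g r s t → orientation (g • r) (g • s) (g • t) ≡ orientation r s t
orientation-• g r s t rewrite ω-• g r s | ω-• g s t | ω-• g t r =
  trans (identity (action-sign g r) (action-sign g s) (action-sign g t) (ω r s) (ω s t) (ω t r))
    (trans (cong₂ (λ i j → i ℤ.* j ℤ.* (action-sign g t ℤ.* action-sign g t) ℤ.* orientation r s t)
                  (action-sign-isSign g r) (action-sign-isSign g s))
      (trans (cong (λ i → 1ℤ ℤ.* 1ℤ ℤ.* i ℤ.* orientation r s t) (action-sign-isSign g t))
             (ℤ.*-identityˡ _)))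
  where
  identity : ∀ ρ σ τ x y z →
    ρ ℤ.* σ ℤ.* x ℤ.* (σ ℤ.* τ ℤ.* y) ℤ.* (τ ℤ.* ρ ℤ.* z)
    ≡ ρ ℤ.* ρ ℤ.* (σ ℤ.* σ) ℤ.* (τ ℤ.* τ) ℤ.* (x ℤ.* y ℤ.* z)
  identity = solve-∀

CCW-• : ∀ g {r s t} → Counterclockwise r s t → Counterclockwise (g • r) (g • s) (g • t)
CCW-• g {r} {s} {t} c =
  orientation>0⇒CCW (subst (0ℤ ℤ.<_) (sym (orientation-• g r s t)) (CCW⇒orientation>0 c))

-- Both coordinate pairs are multiples of one vector, hence ω vanishes. Leaving α and β arbitrary
-- absorbs all signs of the action.
≡-coordinates : ∀ {r s} α β x z →
  num r ≡ α ℤ.* x → den r ≡ α ℤ.* z → num s ≡ β ℤ.* x → den s ≡ β ℤ.* z → r ≡ s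
≡-coordinates {r} {s} α β x z nr dr ns ds = ω≡0⇒≡ ω≡0
  where
  identity : ∀ α β x z → α ℤ.* x ℤ.* (β ℤ.* z) ℤ.+ ℤ.- (β ℤ.* x ℤ.* (α ℤ.* z)) ≡ 0ℤ
  identity = solve-∀
  ω≡0 : ω r s ≡ 0ℤ
  ω≡0 rewrite nr | dr | ns | ds = identity α β x z

∙-• : ∀ g h r → (g ∙ h) • r ≡ g • h • r
∙-• g@(sl (mat a b c d) _) h@(sl (mat a′ b′ c′ d′) _) r =
  ≡-coordinates (action-sign (g ∙ h) r) (action-sign g (h • r) ℤ.* action-sign h r) _ _
    (num-• (g ∙ h) r) (den-• (g ∙ h) r)
    (trans (num-• g (h • r)) (composite a b))
    (trans (den-• g (h • r)) (composite c d))
  where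
  identity : ∀ σ τ a b a′ b′ c′ d′ x z →
    σ ℤ.* (a ℤ.* (τ ℤ.* (a′ ℤ.* x ℤ.+ b′ ℤ.* z)) ℤ.+ b ℤ.* (τ ℤ.* (c′ ℤ.* x ℤ.+ d′ ℤ.* z)))
    ≡ σ ℤ.* τ ℤ.* ((a ℤ.* a′ ℤ.+ b ℤ.* c′) ℤ.* x ℤ.+ (a ℤ.* b′ ℤ.+ b ℤ.* d′) ℤ.* z)
  identity = solve-∀
  composite : ∀ a b →
    action-sign g (h • r) ℤ.* (a ℤ.* num (h • r) ℤ.+ b ℤ.* den (h • r))
    ≡ action-sign g (h • r) ℤ.* action-sign h r ℤ.*
      ((a ℤ.* a′ ℤ.+ b ℤ.* c′) ℤ.* num r ℤ.+ (a ℤ.* b′ ℤ.+ b ℤ.* d′) ℤ.* den r)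
  composite a b = trans
    (cong₂ (λ x z → action-sign g (h • r) ℤ.* (a ℤ.* x ℤ.+ b ℤ.* z)) (num-• h r) (den-• h r))
    (identity (action-sign g (h • r)) (action-sign h r) a b a′ b′ c′ d′ (num r) (den r))

ε-• : ∀ r → ε • r ≡ r
ε-• r = ≡-coordinates (action-sign ε r) 1ℤ (1ℤ ℤ.* num r ℤ.+ 0ℤ ℤ.* den r) (0ℤ ℤ.* num r ℤ.+ 1ℤ ℤ.* den r)
  (num-• ε r) (den-• ε r) (identity₁ (num r) (den r)) (identity₂ (num r) (den r))
  where
  identity₁ : ∀ x z → x ≡ 1ℤ ℤ.* (1ℤ ℤ.* x ℤ.+ 0ℤ ℤ.* z)
  identity₁ = solve-∀
  identity₂ : ∀ x z → z ≡ 1ℤ ℤ.* (0ℤ ℤ.* x ℤ.+ 1ℤ ℤ.* z)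
  identity₂ = solve-∀

•-cong : ∀ {g h} → g ≈± h → ∀ r → g • r ≡ h • r
•-cong {g@(sl (mat a b c d) _)} {h@(sl _ _)} (inj₁ refl) r =
  ≡-coordinates (action-sign g r) (action-sign h r) _ _ (num-• g r) (den-• g r) (num-• h r) (den-• h r)
•-cong {g@(sl _ _)} {h@(sl (mat a b c d) _)} (inj₂ refl) r =
  ≡-coordinates (ℤ.- action-sign g r) (action-sign h r) _ _
    (trans (num-• g r) (identity (action-sign g r) a b (num r) (den r)))
    (trans (den-• g r) (identity (action-sign g r) c d (num r) (den r)))
    (num-• h r) (den-• h r)
  where
  identity : ∀ σ a b x z → σ ℤ.* (ℤ.- a ℤ.* x ℤ.+ ℤ.- b ℤ.* z) ≡ ℤ.- σ ℤ.* (a ℤ.* x ℤ.+ b ℤ.* z)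
  identity = solve-∀

∙-inverseˡ : ∀ g → g ⁻¹ ∙ g ≈± ε
∙-inverseˡ (sl (mat a b c d) det≡1) = inj₁ (begin
    mat (d ℤ.* a ℤ.+ ℤ.- b ℤ.* c) (d ℤ.* b ℤ.+ ℤ.- b ℤ.* d)
        (ℤ.- c ℤ.* a ℤ.+ a ℤ.* c) (ℤ.- c ℤ.* b ℤ.+ a ℤ.* d)
      ≡⟨ cong₂ (λ x y → mat x y (ℤ.- c ℤ.* a ℤ.+ a ℤ.* c) (ℤ.- c ℤ.* b ℤ.+ a ℤ.* d))
               (trans (identity₁ a b c d) det≡1) (identity₂ b d) ⟩
    mat 1ℤ 0ℤ (ℤ.- c ℤ.* a ℤ.+ a ℤ.* c) (ℤ.- c ℤ.* b ℤ.+ a ℤ.* d)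
      ≡⟨ cong₂ (mat 1ℤ 0ℤ) (identity₃ a c) (trans (identity₄ a b c d) det≡1) ⟩
    mat 1ℤ 0ℤ 0ℤ 1ℤ ∎)
  where
  open ≡-Reasoning
  identity₁ : ∀ a b c d → d ℤ.* a ℤ.+ ℤ.- b ℤ.* c ≡ a ℤ.* d ℤ.+ ℤ.- (b ℤ.* c)
  identity₁ = solve-∀
  identity₂ : ∀ b d → d ℤ.* b ℤ.+ ℤ.- b ℤ.* d ≡ 0ℤ
  identity₂ = solve-∀
  identity₃ : ∀ a c → ℤ.- c ℤ.* a ℤ.+ a ℤ.* c ≡ 0ℤ
  identity₃ = solve-∀
  identity₄ : ∀ a b c d → ℤ.- c ℤ.* b ℤ.+ a ℤ.* d ≡ a ℤ.* d ℤ.+ ℤ.- (b ℤ.* c)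
  identity₄ = solve-∀

adj-involutive : ∀ M → Mℤ.adj (Mℤ.adj M) ≡ M
adj-involutive (mat a b c d) = cong₂ (λ x y → mat a x y d) (ℤ.neg-involutive b) (ℤ.neg-involutive c)

∙-inverseʳ : ∀ g → g ∙ g ⁻¹ ≈± ε
∙-inverseʳ g@(sl (mat a b c d) _) =
  subst (λ M → M Mℤ.⊗ matrix (g ⁻¹) ≡ matrix ε ⊎ M Mℤ.⊗ matrix (g ⁻¹) ≡ Mℤ.neg (matrix ε))
        (adj-involutive (matrix g)) (∙-inverseˡ (g ⁻¹))

•-⁻¹⁻¹ : ∀ g r → (g ⁻¹) ⁻¹ • r ≡ g • r
•-⁻¹⁻¹ g r = •-cong {(g ⁻¹) ⁻¹} {g} (inj₁ (adj-involutive (matrix g))) r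

⁻¹-•-• : ∀ g r → g ⁻¹ • g • r ≡ r
⁻¹-•-• g r = trans (sym (∙-• (g ⁻¹) g r)) (trans (•-cong {g ⁻¹ ∙ g} {ε} (∙-inverseˡ g) r) (ε-• r))

•-⁻¹-• : ∀ g r → g • g ⁻¹ • r ≡ r
•-⁻¹-• g r = trans (sym (∙-• g (g ⁻¹) r)) (trans (•-cong {g ∙ g ⁻¹} {ε} (∙-inverseʳ g) r) (ε-• r))

⁻¹-•-≡ : ∀ g {r s} → g • r ≡ s → g ⁻¹ • s ≡ r
⁻¹-•-≡ g {r} refl = ⁻¹-•-• g r

-- Nested arcs

-- With q moved to ∞, `ω a b` divided by `ω a q` and `ω b q` becomes a difference of affine
-- coordinates. The identity says that the length from u to w is the sum of those from u to s, s to
-- r and r to w, cleared of denominators.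
plücker : ∀ q u w s r →
  ω r q ℤ.* ω s q ℤ.* ω u w
  ≡ ω u q ℤ.* ω w q ℤ.* ω s r ℤ.+ (ω r q ℤ.* ω w q ℤ.* ω u s ℤ.+ ω s q ℤ.* ω u q ℤ.* ω r w)
plücker q u w s r =
  identity (num q) (den q) (num u) (den u) (num w) (den w) (num s) (den s) (num r) (den r)
  where
  identity : ∀ q₁ q₂ u₁ u₂ w₁ w₂ s₁ s₂ r₁ r₂ →
    (r₁ ℤ.* q₂ ℤ.+ ℤ.- (q₁ ℤ.* r₂)) ℤ.* (s₁ ℤ.* q₂ ℤ.+ ℤ.- (q₁ ℤ.* s₂)) ℤ.* (u₁ ℤ.* w₂ ℤ.+ ℤ.- (w₁ ℤ.* u₂))
    ≡ (u₁ ℤ.* q₂ ℤ.+ ℤ.- (q₁ ℤ.* u₂)) ℤ.* (w₁ ℤ.* q₂ ℤ.+ ℤ.- (q₁ ℤ.* w₂)) ℤ.* (s₁ ℤ.* r₂ ℤ.+ ℤ.- (r₁ ℤ.* s₂))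
      ℤ.+ ((r₁ ℤ.* q₂ ℤ.+ ℤ.- (q₁ ℤ.* r₂)) ℤ.* (w₁ ℤ.* q₂ ℤ.+ ℤ.- (q₁ ℤ.* w₂)) ℤ.* (u₁ ℤ.* s₂ ℤ.+ ℤ.- (s₁ ℤ.* u₂))
      ℤ.+ (s₁ ℤ.* q₂ ℤ.+ ℤ.- (q₁ ℤ.* s₂)) ℤ.* (u₁ ℤ.* q₂ ℤ.+ ℤ.- (q₁ ℤ.* u₂)) ℤ.* (r₁ ℤ.* w₂ ℤ.+ ℤ.- (w₁ ℤ.* r₂)))
  identity = solve-∀

orientation-q : ∀ x q y → orientation x q y ≡ ω x q ℤ.* ω y q ℤ.* ω x y
orientation-q x q y rewrite ω-antisym y q | ω-antisym x y = identity (ω x q) (ω y q) (ω x y)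
  where
  identity : ∀ a b c → a ℤ.* ℤ.- b ℤ.* ℤ.- c ≡ a ℤ.* b ℤ.* c
  identity = solve-∀

-- The distance from the arc (x , y) to a horoball at q is, up to an additive
-- constant, the logarithm of weight q x y / ∣ω x y∣.
weight : ℙ¹ → ℙ¹ → ℙ¹ → ℕ
weight q x y = ∣ ω x q ∣ ℕ.* ∣ ω y q ∣

weight-comm : ∀ q x y → weight q x y ≡ weight q y x
weight-comm q x y = ℕ.*-comm ∣ ω x q ∣ ∣ ω y q ∣

weight-• : ∀ g q x y → weight (g • q) (g • x) (g • y) ≡ weight q x y
weight-• g q x y = cong₂ ℕ._*_ (∣ω∣-• g x q) (∣ω∣-• g y q)

≢⇒∣ω∣>0 : ∀ {r s} → r ≢ s → 0 ℕ.< ∣ ω r s ∣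
≢⇒∣ω∣>0 r≢s = ℕ.n≢0⇒n>0 λ ∣ω∣≡0 → r≢s (ω≡0⇒≡ (ℤ.∣i∣≡0⇒i≡0 ∣ω∣≡0))

square : ∀ i → i ℤ.* i ≡ + (∣ i ∣ ℕ.* ∣ i ∣)
square (+ n)    = sym (ℤ.pos-* n n)
square -[1+ n ] = refl

∣orientation∣ : ∀ x q y → ∣ orientation x q y ∣ ≡ weight q x y ℕ.* ∣ ω x y ∣
∣orientation∣ x q y = trans (cong ∣_∣ (orientation-q x q y))
  (trans (ℤ.abs-* (ω x q ℤ.* ω y q) (ω x y)) (cong (ℕ._* ∣ ω x y ∣) (ℤ.abs-* (ω x q) (ω y q))))

CCW-weight : ∀ {x q y} → Counterclockwise x q y → orientation x q y ≡ + (weight q x y ℕ.* ∣ ω x y ∣)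
CCW-weight {x} {q} {y} c = trans (sym (ℤ.0≤i⇒+∣i∣≡i (ℤ.<⇒≤ (CCW⇒orientation>0 c)))) (cong +_ (∣orientation∣ x q y))

-- The degenerate case, where both sides are 0, allows nested arcs to share an end point.
weak-orientation≥0 : ∀ {x q y} → x ≡ y ⊎ Counterclockwise x q y → orientation x q y ≡ + (weight q x y ℕ.* ∣ ω x y ∣)
weak-orientation≥0 (inj₂ c) = CCW-weight c
weak-orientation≥0 {x} {q} (inj₁ refl) rewrite ω-refl x | ℤ.*-zeroʳ (ω x q ℤ.* ω q x) | ℕ.*-zeroʳ (weight q x x) = refl

-- Here (u , w) separates (s , r) from q.
nested-weight : ∀ {u w s r q} → Counterclockwise u q w → Counterclockwise s q r →
  u ≡ s ⊎ Counterclockwise u q s → r ≡ w ⊎ Counterclockwise r q w → u ≢ s ⊎ r ≢ w →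
  weight q u w ℕ.* ∣ ω s r ∣ ℕ.< weight q s r ℕ.* ∣ ω u w ∣
nested-weight {u} {w} {s} {r} {q} uqw sqr uqs rqw proper =
  -- With q at ∞ the claim compares the lengths of (s , r) and (u , w). Multiplication by both
  -- weights turns `∣ω s r∣` and `∣ω u w∣` into orientations with q, whose signs are known.
  ℕ.*-cancelʳ-< (weight q u w ℕ.* weight q s r) _ _ (subst₂ ℕ._<_ (left (weight q u w) (weight q s r) ∣ ω s r ∣) (sym total) (ℕ.m<m+n _ excess>0))
  where
  hu = ∣ ω u q ∣ ; hw = ∣ ω w q ∣ ; hs = ∣ ω s q ∣ ; hr = ∣ ω r q ∣
  -- The contribution of the gaps (u , s) and (r , w); `proper` makes one of them nondegenerate.
  excess : ℕ
  excess = (hr ℕ.* hw) ℕ.* (hr ℕ.* hw) ℕ.* (weight q u s ℕ.* ∣ ω u s ∣)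
           ℕ.+ (hs ℕ.* hu) ℕ.* (hs ℕ.* hu) ℕ.* (weight q r w ℕ.* ∣ ω r w ∣)

  left : ∀ a b c → a ℕ.* a ℕ.* (b ℕ.* c) ≡ a ℕ.* c ℕ.* (a ℕ.* b)
  left = ℕ.solve-∀
  right : ∀ a b c → a ℕ.* c ℕ.* (b ℕ.* a) ≡ a ℕ.* a ℕ.* (b ℕ.* c)
  right = ℕ.solve-∀

  -- Multiplying by hs hr hu hw completes each product in the Plücker relation to a square times an
  -- orientation.
  scaled : ∀ hu hw hs hr U S A B →
    hr ℤ.* hs ℤ.* U ≡ hu ℤ.* hw ℤ.* S ℤ.+ (hr ℤ.* hw ℤ.* A ℤ.+ hs ℤ.* hu ℤ.* B) →
    (hs ℤ.* hr) ℤ.* (hs ℤ.* hr) ℤ.* (hu ℤ.* hw ℤ.* U)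
    ≡ (hu ℤ.* hw) ℤ.* (hu ℤ.* hw) ℤ.* (hs ℤ.* hr ℤ.* S)
      ℤ.+ ((hr ℤ.* hw) ℤ.* (hr ℤ.* hw) ℤ.* (hu ℤ.* hs ℤ.* A) ℤ.+ (hs ℤ.* hu) ℤ.* (hs ℤ.* hu) ℤ.* (hr ℤ.* hw ℤ.* B))
  scaled hu hw hs hr U S A B eq =
    trans (i₁ hu hw hs hr U) (trans (cong (hs ℤ.* hr ℤ.* (hu ℤ.* hw) ℤ.*_) eq) (i₂ hu hw hs hr S A B))
    where
    i₁ : ∀ hu hw hs hr U → (hs ℤ.* hr) ℤ.* (hs ℤ.* hr) ℤ.* (hu ℤ.* hw ℤ.* U) ≡ hs ℤ.* hr ℤ.* (hu ℤ.* hw) ℤ.* (hr ℤ.* hs ℤ.* U)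
    i₁ = solve-∀
    i₂ : ∀ hu hw hs hr S A B →
      hs ℤ.* hr ℤ.* (hu ℤ.* hw) ℤ.* (hu ℤ.* hw ℤ.* S ℤ.+ (hr ℤ.* hw ℤ.* A ℤ.+ hs ℤ.* hu ℤ.* B))
      ≡ (hu ℤ.* hw) ℤ.* (hu ℤ.* hw) ℤ.* (hs ℤ.* hr ℤ.* S)
        ℤ.+ ((hr ℤ.* hw) ℤ.* (hr ℤ.* hw) ℤ.* (hu ℤ.* hs ℤ.* A) ℤ.+ (hs ℤ.* hu) ℤ.* (hs ℤ.* hu) ℤ.* (hr ℤ.* hw ℤ.* B))
    i₂ = solve-∀

  term : ∀ {a b x y} → x ≡ y ⊎ Counterclockwise x q y →
    (ω a q ℤ.* ω b q) ℤ.* (ω a q ℤ.* ω b q) ℤ.* (ω x q ℤ.* ω y q ℤ.* ω x y)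
    ≡ + ((∣ ω a q ∣ ℕ.* ∣ ω b q ∣) ℕ.* (∣ ω a q ∣ ℕ.* ∣ ω b q ∣) ℕ.* (weight q x y ℕ.* ∣ ω x y ∣))
  term {a} {b} {x} {y} xqy = trans
    (cong₂ ℤ._*_
      (trans (square (ω a q ℤ.* ω b q)) (cong (λ m → + (m ℕ.* m)) (ℤ.abs-* (ω a q) (ω b q))))
      (trans (sym (orientation-q x q y)) (weak-orientation≥0 xqy)))
    (sym (ℤ.pos-* ((∣ ω a q ∣ ℕ.* ∣ ω b q ∣) ℕ.* (∣ ω a q ∣ ℕ.* ∣ ω b q ∣)) (weight q x y ℕ.* ∣ ω x y ∣)))

  total : weight q s r ℕ.* ∣ ω u w ∣ ℕ.* (weight q u w ℕ.* weight q s r)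
          ≡ weight q u w ℕ.* weight q u w ℕ.* (weight q s r ℕ.* ∣ ω s r ∣) ℕ.+ excess
  total = trans (right (weight q s r) (weight q u w) ∣ ω u w ∣) (ℤ.+-injective (begin
      + (weight q s r ℕ.* weight q s r ℕ.* (weight q u w ℕ.* ∣ ω u w ∣))
        ≡⟨ term {s} {r} (inj₂ uqw) ⟨
      (ω s q ℤ.* ω r q) ℤ.* (ω s q ℤ.* ω r q) ℤ.* (ω u q ℤ.* ω w q ℤ.* ω u w)
        ≡⟨ scaled (ω u q) (ω w q) (ω s q) (ω r q) (ω u w) (ω s r) (ω u s) (ω r w) (plücker q u w s r) ⟩
      _ ≡⟨ cong₂ ℤ._+_ (term {u} {w} (inj₂ sqr)) (cong₂ ℤ._+_ (term {r} {w} uqs) (term {s} {u} rqw)) ⟩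
      + (weight q u w ℕ.* weight q u w ℕ.* (weight q s r ℕ.* ∣ ω s r ∣) ℕ.+ excess) ∎))
    where open ≡-Reasoning

  u>0 : 0 ℕ.< hu
  u>0 = ≢⇒∣ω∣>0 (CCW-distinct uqw)
  w>0 : 0 ℕ.< hw
  w>0 = ≢⇒∣ω∣>0 (λ w≡q → CCW-distinct (CCW-rotate uqw) (sym w≡q))
  s>0 : 0 ℕ.< hs
  s>0 = ≢⇒∣ω∣>0 (CCW-distinct sqr)
  r>0 : 0 ℕ.< hr
  r>0 = ≢⇒∣ω∣>0 (λ r≡q → CCW-distinct (CCW-rotate sqr) (sym r≡q))
  infixl 7 _*>0_
  _*>0_ : ∀ {m n} → 0 ℕ.< m → 0 ℕ.< n → 0 ℕ.< m ℕ.* n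
  _*>0_ = ℕ.*-mono-<

  excess>0 : 0 ℕ.< excess
  excess>0 = [ (λ u≢s → ℕ.<-≤-trans ((r>0 *>0 w>0) *>0 (r>0 *>0 w>0) *>0 (u>0 *>0 s>0 *>0 ≢⇒∣ω∣>0 u≢s)) (ℕ.m≤m+n _ _))
             , (λ r≢w → ℕ.<-≤-trans ((s>0 *>0 u>0) *>0 (s>0 *>0 u>0) *>0 (r>0 *>0 w>0 *>0 ≢⇒∣ω∣>0 r≢w)) (ℕ.m≤n+m _ _)) ]′ proper

-- From rational to integral matrices

toℚᵘ-/1 : ∀ k → ℚ.toℚᵘ (k ℚ./ 1) ℚᵘ.≃ mkℚᵘ k 0
toℚᵘ-/1 k = ℚ.toℚᵘ-fromℚᵘ (mkℚᵘ k 0)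

/1-+ : ∀ i j → (i ℤ.+ j) ℚ./ 1 ≡ i ℚ./ 1 ℚ.+ j ℚ./ 1
/1-+ i j = ℚ.toℚᵘ-injective (begin
  ℚ.toℚᵘ ((i ℤ.+ j) ℚ./ 1)                ≈⟨ toℚᵘ-/1 (i ℤ.+ j) ⟩
  mkℚᵘ (i ℤ.+ j) 0                        ≡⟨ cong (λ k → mkℚᵘ k 0) (sym (cong₂ ℤ._+_ (ℤ.*-identityʳ i) (ℤ.*-identityʳ j))) ⟩
  mkℚᵘ i 0 ℚᵘ.+ mkℚᵘ j 0                  ≈⟨ ℚᵘ.+-cong (toℚᵘ-/1 i) (toℚᵘ-/1 j) ⟨
  ℚ.toℚᵘ (i ℚ./ 1) ℚᵘ.+ ℚ.toℚᵘ (j ℚ./ 1)  ≈⟨ ℚ.toℚᵘ-homo-+ (i ℚ./ 1) (j ℚ./ 1) ⟨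
  ℚ.toℚᵘ (i ℚ./ 1 ℚ.+ j ℚ./ 1) ∎)
  where open import Relation.Binary.Reasoning.Setoid ℚᵘ.≃-setoid

/1-* : ∀ i j → (i ℤ.* j) ℚ./ 1 ≡ i ℚ./ 1 ℚ.* (j ℚ./ 1)
/1-* i j = ℚ.toℚᵘ-injective (begin
  ℚ.toℚᵘ ((i ℤ.* j) ℚ./ 1)                ≈⟨ toℚᵘ-/1 (i ℤ.* j) ⟩
  mkℚᵘ i 0 ℚᵘ.* mkℚᵘ j 0                  ≈⟨ ℚᵘ.*-cong (toℚᵘ-/1 i) (toℚᵘ-/1 j) ⟨
  ℚ.toℚᵘ (i ℚ./ 1) ℚᵘ.* ℚ.toℚᵘ (j ℚ./ 1)  ≈⟨ ℚ.toℚᵘ-homo-* (i ℚ./ 1) (j ℚ./ 1) ⟨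
  ℚ.toℚᵘ (i ℚ./ 1 ℚ.* (j ℚ./ 1)) ∎)
  where open import Relation.Binary.Reasoning.Setoid ℚᵘ.≃-setoid

/1-neg : ∀ i → (ℤ.- i) ℚ./ 1 ≡ ℚ.- (i ℚ./ 1)
/1-neg i = ℚ.toℚᵘ-injective (begin
  ℚ.toℚᵘ ((ℤ.- i) ℚ./ 1)    ≈⟨ toℚᵘ-/1 (ℤ.- i) ⟩
  ℚᵘ.- mkℚᵘ i 0             ≈⟨ ℚᵘ.-‿cong (toℚᵘ-/1 i) ⟨
  ℚᵘ.- ℚ.toℚᵘ (i ℚ./ 1)     ≈⟨ ℚ.toℚᵘ-homo‿- (i ℚ./ 1) ⟨
  ℚ.toℚᵘ (ℚ.- (i ℚ./ 1)) ∎)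
  where open import Relation.Binary.Reasoning.Setoid ℚᵘ.≃-setoid

/1-injective : ∀ {i j} → i ℚ./ 1 ≡ j ℚ./ 1 → i ≡ j
/1-injective {i} {j} eq with ℚ.fromℚᵘ-injective {mkℚᵘ i 0} {mkℚᵘ j 0} eq
... | *≡* i*1≡j*1 = trans (sym (ℤ.*-identityʳ i)) (trans i*1≡j*1 (ℤ.*-identityʳ j))

mat-≡ : {A : Set} {a b c d a′ b′ c′ d′ : A} → a ≡ a′ → b ≡ b′ → c ≡ c′ → d ≡ d′ → mat a b c d ≡ mat a′ b′ c′ d′
mat-≡ refl refl refl refl = refl

toM₂ℚ-injective : ∀ {M N} → toM₂ℚ M ≡ toM₂ℚ N → M ≡ N
toM₂ℚ-injective eq = mat-≡ (/1-injective (cong M₂.m₁₁ eq)) (/1-injective (cong M₂.m₁₂ eq))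
                           (/1-injective (cong M₂.m₂₁ eq)) (/1-injective (cong M₂.m₂₂ eq))

toM₂ℚ-⊗ : ∀ M N → toM₂ℚ (M Mℤ.⊗ N) ≡ toM₂ℚ M Mℚ.⊗ toM₂ℚ N
toM₂ℚ-⊗ (mat a b c d) (mat a′ b′ c′ d′) = mat-≡ (entry a a′ b c′) (entry a b′ b d′) (entry c a′ d c′) (entry c b′ d d′)
  where
  entry : ∀ i j k l → (i ℤ.* j ℤ.+ k ℤ.* l) ℚ./ 1 ≡ i ℚ./ 1 ℚ.* (j ℚ./ 1) ℚ.+ k ℚ./ 1 ℚ.* (l ℚ./ 1)
  entry i j k l = trans (/1-+ (i ℤ.* j) (k ℤ.* l)) (cong₂ ℚ._+_ (/1-* i j) (/1-* k l))

det-toM₂ℚ : ∀ M → Mℚ.det (toM₂ℚ M) ≡ Mℤ.det M ℚ./ 1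
det-toM₂ℚ (mat a b c d) = sym (trans (/1-+ (a ℤ.* d) (ℤ.- (b ℤ.* c)))
  (cong₂ ℚ._+_ (/1-* a d) (trans (/1-neg (b ℤ.* c)) (cong ℚ.-_ (/1-* b c)))))

ℚ-ring : AlmostCommutativeRing 0ℓ 0ℓ
ℚ-ring = fromCommutativeRing ℚ.+-*-commutativeRing (λ x → dec⇒maybe (0ℚ ℚ.≟ x))

⊗-inverse-⊗ : ∀ M N → Mℚ.det N ≢ 0ℚ → M Mℚ.⊗ inverse N Mℚ.⊗ N ≡ M
⊗-inverse-⊗ (mat a b c d) N@(mat a′ b′ c′ d′) det≢0 with Mℚ.det N ℚ.≟ 0ℚ
... | yes det≡0 = contradiction det≡0 det≢0
... | no  _     = mat-≡ (trans (identity₁ a b a′ b′ c′ d′ δ) (cancel a)) (trans (identity₂ a b a′ b′ c′ d′ δ) (cancel b))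
                        (trans (identity₁ c d a′ b′ c′ d′ δ) (cancel c)) (trans (identity₂ c d a′ b′ c′ d′ δ) (cancel d))
  where
  instance det-nonZero = ℚ.≢-nonZero det≢0
  δ : ℚ
  δ = ℚ.1/ Mℚ.det N
  cancel : ∀ x → x ℚ.* ((a′ ℚ.* d′ ℚ.+ ℚ.- (b′ ℚ.* c′)) ℚ.* δ) ≡ x
  cancel x = trans (cong (x ℚ.*_) (ℚ.*-inverseʳ (Mℚ.det N))) (ℚ.*-identityʳ x)
  identity₁ : ∀ x y a b c d δ →
    (x ℚ.* (d ℚ.* δ) ℚ.+ y ℚ.* (ℚ.- c ℚ.* δ)) ℚ.* a ℚ.+ (x ℚ.* (ℚ.- b ℚ.* δ) ℚ.+ y ℚ.* (a ℚ.* δ)) ℚ.* c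
    ≡ x ℚ.* ((a ℚ.* d ℚ.+ ℚ.- (b ℚ.* c)) ℚ.* δ)
  identity₁ = RingSolver.solve-∀ ℚ-ring
  identity₂ : ∀ x y a b c d δ →
    (x ℚ.* (d ℚ.* δ) ℚ.+ y ℚ.* (ℚ.- c ℚ.* δ)) ℚ.* b ℚ.+ (x ℚ.* (ℚ.- b ℚ.* δ) ℚ.+ y ℚ.* (a ℚ.* δ)) ℚ.* d
    ≡ y ℚ.* ((a ℚ.* d ℚ.+ ℚ.- (b ℚ.* c)) ℚ.* δ)
  identity₂ = RingSolver.solve-∀ ℚ-ring

-- Gluing matrices are specified as rational quotients; clearing the inverse once moves all later
-- computations to integral matrices.
integral-quotient : ∀ G A B → Mℤ.det B ≢ 0ℤ →
  toM₂ℚ G ≡ toM₂ℚ A Mℚ.⊗ inverse (toM₂ℚ B) → G Mℤ.⊗ B ≡ A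
integral-quotient G A B det≢0 eq = toM₂ℚ-injective (begin
  toM₂ℚ (G Mℤ.⊗ B)                                 ≡⟨ toM₂ℚ-⊗ G B ⟩
  toM₂ℚ G Mℚ.⊗ toM₂ℚ B                             ≡⟨ cong (Mℚ._⊗ toM₂ℚ B) eq ⟩
  toM₂ℚ A Mℚ.⊗ inverse (toM₂ℚ B) Mℚ.⊗ toM₂ℚ B      ≡⟨ ⊗-inverse-⊗ (toM₂ℚ A) (toM₂ℚ B) det≢0′ ⟩
  toM₂ℚ A ∎)
  where
  open ≡-Reasoning
  det≢0′ : Mℚ.det (toM₂ℚ B) ≢ 0ℚ
  det≢0′ det≡0 = det≢0 (/1-injective (trans (sym (det-toM₂ℚ B)) det≡0))

⊗-assoc : ∀ L M N → (L Mℤ.⊗ M) Mℤ.⊗ N ≡ L Mℤ.⊗ (M Mℤ.⊗ N)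
⊗-assoc (mat a b c d) (mat a′ b′ c′ d′) (mat a″ b″ c″ d″) =
  mat-≡ (identity a b a′ b′ c′ d′ a″ c″) (identity a b a′ b′ c′ d′ b″ d″)
        (identity c d a′ b′ c′ d′ a″ c″) (identity c d a′ b′ c′ d′ b″ d″)
  where
  identity : ∀ x y a b c d z t →
    (x ℤ.* a ℤ.+ y ℤ.* c) ℤ.* z ℤ.+ (x ℤ.* b ℤ.+ y ℤ.* d) ℤ.* t
    ≡ x ℤ.* (a ℤ.* z ℤ.+ b ℤ.* t) ℤ.+ y ℤ.* (c ℤ.* z ℤ.+ d ℤ.* t)
  identity = solve-∀

⊗-cancelʳ : ∀ {M N} L → Mℤ.det L ≢ 0ℤ → M Mℤ.⊗ L ≡ N Mℤ.⊗ L → M ≡ N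
⊗-cancelʳ {mat a b c d} {mat a′ b′ c′ d′} L@(mat x y z t) det≢0 eq =
  mat-≡ (cancel₁ a b a′ b′ (cong M₂.m₁₁ eq) (cong M₂.m₁₂ eq)) (cancel₂ a b a′ b′ (cong M₂.m₁₁ eq) (cong M₂.m₁₂ eq))
        (cancel₁ c d c′ d′ (cong M₂.m₂₁ eq) (cong M₂.m₂₂ eq)) (cancel₂ c d c′ d′ (cong M₂.m₂₁ eq) (cong M₂.m₂₂ eq))
  where
  instance det-nonZero = ℤ.≢-nonZero det≢0
  identity₁ : ∀ a b x y z t → a ℤ.* (x ℤ.* t ℤ.+ ℤ.- (y ℤ.* z)) ≡ (a ℤ.* x ℤ.+ b ℤ.* z) ℤ.* t ℤ.+ ℤ.- ((a ℤ.* y ℤ.+ b ℤ.* t) ℤ.* z)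
  identity₁ = solve-∀
  identity₂ : ∀ a b x y z t → b ℤ.* (x ℤ.* t ℤ.+ ℤ.- (y ℤ.* z)) ≡ (a ℤ.* y ℤ.+ b ℤ.* t) ℤ.* x ℤ.+ ℤ.- ((a ℤ.* x ℤ.+ b ℤ.* z) ℤ.* y)
  identity₂ = solve-∀
  cancel₁ : ∀ a b a′ b′ → a ℤ.* x ℤ.+ b ℤ.* z ≡ a′ ℤ.* x ℤ.+ b′ ℤ.* z → a ℤ.* y ℤ.+ b ℤ.* t ≡ a′ ℤ.* y ℤ.+ b′ ℤ.* t → a ≡ a′
  cancel₁ a b a′ b′ eq₁ eq₂ = ℤ.*-cancelʳ-≡ a a′ (Mℤ.det L)
    (trans (identity₁ a b x y z t) (trans (cong₂ (λ i j → i ℤ.* t ℤ.+ ℤ.- (j ℤ.* z)) eq₁ eq₂) (sym (identity₁ a′ b′ x y z t))))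
  cancel₂ : ∀ a b a′ b′ → a ℤ.* x ℤ.+ b ℤ.* z ≡ a′ ℤ.* x ℤ.+ b′ ℤ.* z → a ℤ.* y ℤ.+ b ℤ.* t ≡ a′ ℤ.* y ℤ.+ b′ ℤ.* t → b ≡ b′
  cancel₂ a b a′ b′ eq₁ eq₂ = ℤ.*-cancelʳ-≡ b b′ (Mℤ.det L)
    (trans (identity₂ a b x y z t) (trans (cong₂ (λ i j → j ℤ.* x ℤ.+ ℤ.- (i ℤ.* y)) eq₁ eq₂) (sym (identity₂ a′ b′ x y z t))))

-- The gluing matrices

-- σ records the branch taken by `arcMatrix`, that is, the sign of `ω r s`. Carrying it as a
-- variable reduces both branches to the same polynomial identities.
arcMatrix-columns : ∀ {r s} → r ≢ s → Σ[ σ ∈ ℤ ] IsSign σ × 0ℤ ℤ.< σ ℤ.* ω r s ×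
  arcMatrix r s ≡ mat (num r) (σ ℤ.* num s) (den r) (σ ℤ.* den s)
arcMatrix-columns {r} {s} r≢s with 0ℤ ℤ.<? Mℤ.det (mat (num r) (num s) (den r) (den s))
... | yes 0<ω = 1ℤ , refl
  , subst (0ℤ ℤ.<_) (sym (ℤ.*-identityˡ (ω r s))) 0<ω
  , mat-≡ refl (sym (ℤ.*-identityˡ (num s))) refl (sym (ℤ.*-identityˡ (den s)))
... | no  0≮ω = -1ℤ , refl
  , subst (0ℤ ℤ.<_) (sym (ℤ.-1*i≡-i (ω r s))) (ℤ.neg-mono-< (ℤ.≤∧≢⇒< (ℤ.≮⇒≥ 0≮ω) (λ ω≡0 → r≢s (ω≡0⇒≡ ω≡0))))
  , mat-≡ refl (sym (ℤ.-1*i≡-i (num s))) refl (sym (ℤ.-1*i≡-i (den s)))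

J R₃ : M₂ ℤ
J  = mat 0ℤ -1ℤ 1ℤ 0ℤ
R₃ = mat 0ℤ -1ℤ 1ℤ -1ℤ

det-arcMatrix⁻ : ∀ {r s} → r ≢ s → Mℤ.det (arcMatrix⁻ r s) ≢ 0ℤ
det-arcMatrix⁻ {r} {s} r≢s det≡0 with arcMatrix-columns r≢s
... | σ , _ , 0<σω , eq = ℤ.<-irrefl refl (subst (0ℤ ℤ.<_) (begin
    σ ℤ.* ω r s                                                       ≡⟨ identity σ (num r) (den r) (num s) (den s) ⟩
    Mℤ.det (mat (num r) (σ ℤ.* num s) (den r) (σ ℤ.* den s)) ℤ.* 1ℤ   ≡⟨ cong (λ M → Mℤ.det M ℤ.* 1ℤ) (sym eq) ⟩
    Mℤ.det (arcMatrix r s) ℤ.* Mℤ.det J                               ≡⟨ sym (det-⊗ (arcMatrix r s) J) ⟩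
    Mℤ.det (arcMatrix⁻ r s)                                           ≡⟨ det≡0 ⟩
    0ℤ                                                                ∎) 0<σω)
  where
  open ≡-Reasoning
  identity : ∀ σ x z y t → σ ℤ.* (x ℤ.* t ℤ.+ ℤ.- (y ℤ.* z)) ≡ (x ℤ.* (σ ℤ.* t) ℤ.+ ℤ.- (σ ℤ.* y ℤ.* z)) ℤ.* 1ℤ
  identity = solve-∀

sign-flip : ∀ σ {x y} → IsSign σ → σ ℤ.* x ≡ y → x ≡ σ ℤ.* y
sign-flip σ {x} {y} σσ≡1 eq = begin
  x               ≡⟨ ℤ.*-identityˡ x ⟨
  1ℤ ℤ.* x        ≡⟨ cong (ℤ._* x) σσ≡1 ⟨
  σ ℤ.* σ ℤ.* x   ≡⟨ ℤ.*-assoc σ σ x ⟩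
  σ ℤ.* (σ ℤ.* x) ≡⟨ cong (σ ℤ.*_) eq ⟩
  σ ℤ.* y ∎
  where open ≡-Reasoning

-- The columns of `arcMatrix⁻ u w` are ±w and -u, so comparing columns in `glue` shows where g sends
-- the two end points: the arc is reversed.
module GluedArcs (g : SL₂ℤ) {r s u w : ℙ¹} (r≢s : r ≢ s) (u≢w : u ≢ w)
                 (glue : matrix g Mℤ.⊗ arcMatrix⁻ u w ≡ arcMatrix r s) where
  private
    a = M₂.m₁₁ (matrix g) ; b = M₂.m₁₂ (matrix g) ; c = M₂.m₂₁ (matrix g) ; d = M₂.m₂₂ (matrix g)
    σ = proj₁ (arcMatrix-columns u≢w)
    τ = proj₁ (arcMatrix-columns r≢s)
    τ-isSign = proj₁ (proj₂ (arcMatrix-columns r≢s))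

    columns : matrix g Mℤ.⊗ (mat (num u) (σ ℤ.* num w) (den u) (σ ℤ.* den w) Mℤ.⊗ J)
              ≡ mat (num r) (τ ℤ.* num s) (den r) (τ ℤ.* den s)
    columns = trans (cong (λ M → matrix g Mℤ.⊗ (M Mℤ.⊗ J)) (sym (proj₂ (proj₂ (proj₂ (arcMatrix-columns u≢w))))))
      (trans glue (proj₂ (proj₂ (proj₂ (arcMatrix-columns r≢s)))))

    identity₁ : ∀ σ a b u₁ u₂ w₁ w₂ →
      a ℤ.* (u₁ ℤ.* 0ℤ ℤ.+ σ ℤ.* w₁ ℤ.* 1ℤ) ℤ.+ b ℤ.* (u₂ ℤ.* 0ℤ ℤ.+ σ ℤ.* w₂ ℤ.* 1ℤ) ≡ σ ℤ.* (a ℤ.* w₁ ℤ.+ b ℤ.* w₂)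
    identity₁ = solve-∀
    identity₂ : ∀ σ a b u₁ u₂ w₁ w₂ →
      a ℤ.* (u₁ ℤ.* -1ℤ ℤ.+ σ ℤ.* w₁ ℤ.* 0ℤ) ℤ.+ b ℤ.* (u₂ ℤ.* -1ℤ ℤ.+ σ ℤ.* w₂ ℤ.* 0ℤ) ≡ ℤ.- (a ℤ.* u₁ ℤ.+ b ℤ.* u₂)
    identity₂ = solve-∀

  end-to-start : g • w ≡ r
  end-to-start = ≡-coordinates (action-sign g w) σ _ _ (num-• g w) (den-• g w)
    (trans (sym (cong M₂.m₁₁ columns)) (identity₁ σ a b (num u) (den u) (num w) (den w)))
    (trans (sym (cong M₂.m₂₁ columns)) (identity₁ σ c d (num u) (den u) (num w) (den w)))

  start-to-end : g • u ≡ s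
  start-to-end = ≡-coordinates (action-sign g u) (ℤ.- τ) _ _ (num-• g u) (den-• g u)
    (trans (sign-flip τ τ-isSign (trans (sym (cong M₂.m₁₂ columns)) (identity₂ σ a b (num u) (den u) (num w) (den w)))) (neg τ _))
    (trans (sign-flip τ τ-isSign (trans (sym (cong M₂.m₂₂ columns)) (identity₂ σ c d (num u) (den u) (num w) (den w)))) (neg τ _))
    where
    neg : ∀ τ x → τ ℤ.* ℤ.- x ≡ ℤ.- τ ℤ.* x
    neg τ x = trans (sym (ℤ.neg-distribʳ-* τ x)) (ℤ.neg-distribˡ-* τ x)

⊗-J-J : ∀ M → M Mℤ.⊗ J Mℤ.⊗ J ≡ Mℤ.neg M
⊗-J-J (mat a b c d) = mat-≡ (identity₁ a b) (identity₂ a b) (identity₁ c d) (identity₂ c d)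
  where
  identity₁ : ∀ a b → (a ℤ.* 0ℤ ℤ.+ b ℤ.* 1ℤ) ℤ.* 0ℤ ℤ.+ (a ℤ.* -1ℤ ℤ.+ b ℤ.* 0ℤ) ℤ.* 1ℤ ≡ ℤ.- a
  identity₁ = solve-∀
  identity₂ : ∀ a b → (a ℤ.* 0ℤ ℤ.+ b ℤ.* 1ℤ) ℤ.* -1ℤ ℤ.+ (a ℤ.* -1ℤ ℤ.+ b ℤ.* 0ℤ) ℤ.* 0ℤ ≡ ℤ.- b
  identity₂ = solve-∀

neg-⊗ˡ : ∀ M N → Mℤ.neg M Mℤ.⊗ N ≡ Mℤ.neg (M Mℤ.⊗ N)
neg-⊗ˡ (mat a b c d) (mat a′ b′ c′ d′) = mat-≡ (identity a b a′ c′) (identity a b b′ d′) (identity c d a′ c′) (identity c d b′ d′)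
  where
  identity : ∀ a b x z → ℤ.- a ℤ.* x ℤ.+ ℤ.- b ℤ.* z ≡ ℤ.- (a ℤ.* x ℤ.+ b ℤ.* z)
  identity = solve-∀

neg-⊗ʳ : ∀ M N → M Mℤ.⊗ Mℤ.neg N ≡ Mℤ.neg (M Mℤ.⊗ N)
neg-⊗ʳ (mat a b c d) (mat a′ b′ c′ d′) = mat-≡ (identity a b a′ c′) (identity a b b′ d′) (identity c d a′ c′) (identity c d b′ d′)
  where
  identity : ∀ a b x z → a ℤ.* ℤ.- x ℤ.+ b ℤ.* ℤ.- z ≡ ℤ.- (a ℤ.* x ℤ.+ b ℤ.* z)
  identity = solve-∀

⊗-identityˡ : ∀ M → matrix ε Mℤ.⊗ M ≡ M
⊗-identityˡ (mat a b c d) = mat-≡ (identity₁ a c) (identity₁ b d) (identity₂ a c) (identity₂ b d)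
  where
  identity₁ : ∀ a c → 1ℤ ℤ.* a ℤ.+ 0ℤ ℤ.* c ≡ a
  identity₁ = solve-∀
  identity₂ : ∀ a c → 0ℤ ℤ.* a ℤ.+ 1ℤ ℤ.* c ≡ c
  identity₂ = solve-∀

⊗-identityʳ : ∀ M → M Mℤ.⊗ matrix ε ≡ M
⊗-identityʳ (mat a b c d) = mat-≡ (identity₁ a b) (identity₂ a b) (identity₁ c d) (identity₂ c d)
  where
  identity₁ : ∀ a c → a ℤ.* 1ℤ ℤ.+ c ℤ.* 0ℤ ≡ a
  identity₁ = solve-∀
  identity₂ : ∀ a c → a ℤ.* 0ℤ ℤ.+ c ℤ.* 1ℤ ≡ c
  identity₂ = solve-∀

-- Since `J` squares to -1, gluing there and back multiplies an arc matrix by -1. The product is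
-- therefore trivial in PSL₂(ℤ) but not in SL₂(ℤ).
glued-inverse : ∀ g h {r s u w} → r ≢ s →
  matrix g Mℤ.⊗ arcMatrix⁻ u w ≡ arcMatrix r s → matrix h Mℤ.⊗ arcMatrix⁻ r s ≡ arcMatrix u w → g ∙ h ≈± ε
glued-inverse g h {r} {s} {u} {w} r≢s eq eq′ = inj₂ (⊗-cancelʳ (arcMatrix⁻ r s) (det-arcMatrix⁻ r≢s) (begin
    matrix g Mℤ.⊗ matrix h Mℤ.⊗ arcMatrix⁻ r s     ≡⟨ ⊗-assoc (matrix g) (matrix h) (arcMatrix⁻ r s) ⟩
    matrix g Mℤ.⊗ (matrix h Mℤ.⊗ arcMatrix⁻ r s)   ≡⟨ cong (matrix g Mℤ.⊗_) eq′ ⟩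
    matrix g Mℤ.⊗ A′                               ≡⟨ neg-involutive _ ⟨
    Mℤ.neg (Mℤ.neg (matrix g Mℤ.⊗ A′))             ≡⟨ cong Mℤ.neg (neg-⊗ʳ (matrix g) A′) ⟨
    Mℤ.neg (matrix g Mℤ.⊗ Mℤ.neg A′)               ≡⟨ cong (λ M → Mℤ.neg (matrix g Mℤ.⊗ M)) (⊗-J-J A′) ⟨
    Mℤ.neg (matrix g Mℤ.⊗ (A′ Mℤ.⊗ J Mℤ.⊗ J))      ≡⟨ cong Mℤ.neg (⊗-assoc (matrix g) (A′ Mℤ.⊗ J) J) ⟨
    Mℤ.neg (matrix g Mℤ.⊗ (A′ Mℤ.⊗ J) Mℤ.⊗ J)      ≡⟨ cong (λ M → Mℤ.neg (M Mℤ.⊗ J)) eq ⟩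
    Mℤ.neg (arcMatrix⁻ r s)                        ≡⟨ cong Mℤ.neg (⊗-identityˡ (arcMatrix⁻ r s)) ⟨
    Mℤ.neg (matrix ε Mℤ.⊗ arcMatrix⁻ r s)          ≡⟨ neg-⊗ˡ (matrix ε) (arcMatrix⁻ r s) ⟨
    Mℤ.neg (matrix ε) Mℤ.⊗ arcMatrix⁻ r s ∎))
  where
  open ≡-Reasoning
  A′ = arcMatrix u w

-- g is conjugate to `R₃`, whose cube is the identity matrix. It rotates the ideal triangle on the
-- arc, with s going to r, r to the apex and the apex to s.
module RotatedArc (g : SL₂ℤ) {r s : ℙ¹} (r≢s : r ≢ s)
                  (glue : matrix g Mℤ.⊗ arcMatrix⁻ r s ≡ arcMatrix⁻ r s Mℤ.⊗ R₃) where
  private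
    a = M₂.m₁₁ (matrix g) ; b = M₂.m₁₂ (matrix g) ; c = M₂.m₂₁ (matrix g) ; d = M₂.m₂₂ (matrix g)
    σ = proj₁ (arcMatrix-columns r≢s)
    B = arcMatrix⁻ r s
    G = matrix g
    A′ = mat (num r) (σ ℤ.* num s) (den r) (σ ℤ.* den s)

    columns : G Mℤ.⊗ (A′ Mℤ.⊗ J) ≡ A′ Mℤ.⊗ J Mℤ.⊗ R₃
    columns = subst (λ M → G Mℤ.⊗ (M Mℤ.⊗ J) ≡ M Mℤ.⊗ J Mℤ.⊗ R₃) (proj₂ (proj₂ (proj₂ (arcMatrix-columns r≢s)))) glue

  rotation³ : g ∙ (g ∙ g) ≈± ε
  rotation³ = inj₁ (⊗-cancelʳ B (det-arcMatrix⁻ r≢s) (begin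
    G Mℤ.⊗ (G Mℤ.⊗ G) Mℤ.⊗ B      ≡⟨ ⊗-assoc G (G Mℤ.⊗ G) B ⟩
    G Mℤ.⊗ (G Mℤ.⊗ G Mℤ.⊗ B)      ≡⟨ cong (G Mℤ.⊗_) (⊗-assoc G G B) ⟩
    G Mℤ.⊗ (G Mℤ.⊗ (G Mℤ.⊗ B))    ≡⟨ cong (λ M → G Mℤ.⊗ (G Mℤ.⊗ M)) glue ⟩
    G Mℤ.⊗ (G Mℤ.⊗ (B Mℤ.⊗ R₃))   ≡⟨ cong (G Mℤ.⊗_) (swap R₃) ⟩
    G Mℤ.⊗ (B Mℤ.⊗ (R₃ Mℤ.⊗ R₃))  ≡⟨ swap (R₃ Mℤ.⊗ R₃) ⟩
    B Mℤ.⊗ (R₃ Mℤ.⊗ (R₃ Mℤ.⊗ R₃)) ≡⟨ ⊗-identityʳ B ⟩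
    B                             ≡⟨ ⊗-identityˡ B ⟨
    matrix ε Mℤ.⊗ B ∎))
    where
    open ≡-Reasoning
    swap : ∀ M → G Mℤ.⊗ (B Mℤ.⊗ M) ≡ B Mℤ.⊗ (R₃ Mℤ.⊗ M)
    swap M = trans (sym (⊗-assoc G B M)) (trans (cong (Mℤ._⊗ M) glue) (⊗-assoc B R₃ M))

  end-to-start : g • s ≡ r
  end-to-start = ≡-coordinates (action-sign g s) (ℤ.- σ) _ _ (num-• g s) (den-• g s)
    (trans (sym (i₁ σ (num r) (num s))) (trans (cong ℤ.-_ (sym (cong M₂.m₁₁ columns))) (i₂ σ (num r) (num s) (den r) (den s) a b)))
    (trans (sym (i₁ σ (den r) (den s))) (trans (cong ℤ.-_ (sym (cong M₂.m₂₁ columns))) (i₂ σ (num r) (num s) (den r) (den s) c d)))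
    where
    i₁ : ∀ σ r₁ s₁ → ℤ.- ((r₁ ℤ.* 0ℤ ℤ.+ σ ℤ.* s₁ ℤ.* 1ℤ) ℤ.* 0ℤ ℤ.+ (r₁ ℤ.* -1ℤ ℤ.+ σ ℤ.* s₁ ℤ.* 0ℤ) ℤ.* 1ℤ) ≡ r₁
    i₁ = solve-∀
    i₂ : ∀ σ r₁ s₁ r₂ s₂ a b →
      ℤ.- (a ℤ.* (r₁ ℤ.* 0ℤ ℤ.+ σ ℤ.* s₁ ℤ.* 1ℤ) ℤ.+ b ℤ.* (r₂ ℤ.* 0ℤ ℤ.+ σ ℤ.* s₂ ℤ.* 1ℤ)) ≡ ℤ.- σ ℤ.* (a ℤ.* s₁ ℤ.+ b ℤ.* s₂)
    i₂ = solve-∀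

  apex : ℙ¹
  apex = g • r

  apex-to-end : g • apex ≡ s
  apex-to-end = begin
    g • g • r             ≡⟨ cong (λ p → g • g • p) end-to-start ⟨
    g • g • g • s         ≡⟨ cong (g •_) (∙-• g g s) ⟨
    g • (g ∙ g) • s       ≡⟨ ∙-• g (g ∙ g) s ⟨
    (g ∙ (g ∙ g)) • s     ≡⟨ •-cong {g ∙ (g ∙ g)} {ε} rotation³ s ⟩
    ε • s                 ≡⟨ ε-• s ⟩
    s ∎
    where open ≡-Reasoning

  -- Up to sign the apex has the coordinate vector σ s - r, read off the second column. The
  -- orientation then equals σ `ω r s` times the square of `ω r s`, and both factors are positive.
  apex-behind : Counterclockwise r apex s
  apex-behind = orientation>0⇒CCW (subst (0ℤ ℤ.<_) (sym o≡) (pos*pos>0 (proj₁ (proj₂ (proj₂ (arcMatrix-columns r≢s)))) (ω²>0)))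
    where
    τ = action-sign g r
    ω²>0 : 0ℤ ℤ.< ω r s ℤ.* ω r s
    ω²>0 with <ℙ-connex r s r≢s
    ... | inj₁ r<s = neg*neg>0 (<ℙ⇒ω<0 r<s) (<ℙ⇒ω<0 r<s)
    ... | inj₂ s<r = pos*pos>0 (<ℙ⇒0<ω s<r) (<ℙ⇒0<ω s<r)
    coordinate : ∀ σ r₁ s₁ r₂ s₂ x a b →
      a ℤ.* (r₁ ℤ.* -1ℤ ℤ.+ σ ℤ.* s₁ ℤ.* 0ℤ) ℤ.+ b ℤ.* (r₂ ℤ.* -1ℤ ℤ.+ σ ℤ.* s₂ ℤ.* 0ℤ) ≡ x →
      a ℤ.* r₁ ℤ.+ b ℤ.* r₂ ≡ ℤ.- x
    coordinate σ r₁ s₁ r₂ s₂ x a b eq = trans (i σ r₁ s₁ r₂ s₂ a b) (cong ℤ.-_ eq)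
      where
      i : ∀ σ r₁ s₁ r₂ s₂ a b → a ℤ.* r₁ ℤ.+ b ℤ.* r₂ ≡ ℤ.- (a ℤ.* (r₁ ℤ.* -1ℤ ℤ.+ σ ℤ.* s₁ ℤ.* 0ℤ) ℤ.+ b ℤ.* (r₂ ℤ.* -1ℤ ℤ.+ σ ℤ.* s₂ ℤ.* 0ℤ))
      i = solve-∀
    simplify : ∀ τ σ r₁ s₁ →
      τ ℤ.* ℤ.- ((r₁ ℤ.* 0ℤ ℤ.+ σ ℤ.* s₁ ℤ.* 1ℤ) ℤ.* -1ℤ ℤ.+ (r₁ ℤ.* -1ℤ ℤ.+ σ ℤ.* s₁ ℤ.* 0ℤ) ℤ.* -1ℤ) ≡ τ ℤ.* (σ ℤ.* s₁ ℤ.+ ℤ.- r₁)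
    simplify = solve-∀
    num-apex : num apex ≡ τ ℤ.* (σ ℤ.* num s ℤ.+ ℤ.- num r)
    num-apex = trans (num-• g r) (trans (cong (τ ℤ.*_) (coordinate σ (num r) (num s) (den r) (den s) _ a b (cong M₂.m₁₂ columns))) (simplify τ σ (num r) (num s)))
    den-apex : den apex ≡ τ ℤ.* (σ ℤ.* den s ℤ.+ ℤ.- den r)
    den-apex = trans (den-• g r) (trans (cong (τ ℤ.*_) (coordinate σ (num r) (num s) (den r) (den s) _ c d (cong M₂.m₂₂ columns))) (simplify τ σ (den r) (den s)))
    product : ∀ τ σ r₁ r₂ s₁ s₂ t₁ t₂ → t₁ ≡ τ ℤ.* (σ ℤ.* s₁ ℤ.+ ℤ.- r₁) → t₂ ≡ τ ℤ.* (σ ℤ.* s₂ ℤ.+ ℤ.- r₂) →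
      (r₁ ℤ.* t₂ ℤ.+ ℤ.- (t₁ ℤ.* r₂)) ℤ.* (t₁ ℤ.* s₂ ℤ.+ ℤ.- (s₁ ℤ.* t₂)) ℤ.* (s₁ ℤ.* r₂ ℤ.+ ℤ.- (r₁ ℤ.* s₂))
      ≡ τ ℤ.* τ ℤ.* (σ ℤ.* (r₁ ℤ.* s₂ ℤ.+ ℤ.- (s₁ ℤ.* r₂)) ℤ.* ((r₁ ℤ.* s₂ ℤ.+ ℤ.- (s₁ ℤ.* r₂)) ℤ.* (r₁ ℤ.* s₂ ℤ.+ ℤ.- (s₁ ℤ.* r₂))))
    product τ σ r₁ r₂ s₁ s₂ _ _ refl refl = i τ σ r₁ r₂ s₁ s₂
      where
      i : ∀ τ σ r₁ r₂ s₁ s₂ →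
        (r₁ ℤ.* (τ ℤ.* (σ ℤ.* s₂ ℤ.+ ℤ.- r₂)) ℤ.+ ℤ.- (τ ℤ.* (σ ℤ.* s₁ ℤ.+ ℤ.- r₁) ℤ.* r₂)) ℤ.* (τ ℤ.* (σ ℤ.* s₁ ℤ.+ ℤ.- r₁) ℤ.* s₂ ℤ.+ ℤ.- (s₁ ℤ.* (τ ℤ.* (σ ℤ.* s₂ ℤ.+ ℤ.- r₂)))) ℤ.* (s₁ ℤ.* r₂ ℤ.+ ℤ.- (r₁ ℤ.* s₂))
        ≡ τ ℤ.* τ ℤ.* (σ ℤ.* (r₁ ℤ.* s₂ ℤ.+ ℤ.- (s₁ ℤ.* r₂)) ℤ.* ((r₁ ℤ.* s₂ ℤ.+ ℤ.- (s₁ ℤ.* r₂)) ℤ.* (r₁ ℤ.* s₂ ℤ.+ ℤ.- (s₁ ℤ.* r₂))))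
      i = solve-∀
    o≡ : orientation r apex s ≡ σ ℤ.* ω r s ℤ.* (ω r s ℤ.* ω r s)
    o≡ = trans (product τ σ (num r) (den r) (num s) (den s) (num apex) (den apex) num-apex den-apex)
      (trans (cong (ℤ._* (σ ℤ.* ω r s ℤ.* (ω r s ℤ.* ω r s))) (action-sign-isSign g r)) (ℤ.*-identityˡ _))

-- The polygon and the regions behind its sides

module Polygon (P : SidePairing) where
  open SidePairing P

  private
    last : Fin n
    last = fromℕ (2 ℕ.+ n-3)

  next-inject₁ : (i : Fin (2 ℕ.+ n-3)) → next (inject₁ i) ≡ suc i
  next-inject₁ i = Fin.toℕ-injective (begin
    toℕ (next (inject₁ i))               ≡⟨ Fin.toℕ-fromℕ< _ ⟩
    suc (toℕ (inject₁ i)) ℕ.% n          ≡⟨ cong (λ m → suc m ℕ.% n) (Fin.toℕ-inject₁ i) ⟩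
    suc (toℕ i) ℕ.% n                    ≡⟨ ℕ.m<n⇒m%n≡m (s≤s (Fin.toℕ<n i)) ⟩
    suc (toℕ i) ∎)
    where open ≡-Reasoning

  next-last : next last ≡ zero
  next-last = Fin.toℕ-injective (begin
    toℕ (next last)            ≡⟨ Fin.toℕ-fromℕ< _ ⟩
    suc (toℕ last) ℕ.% n       ≡⟨ cong (λ m → suc m ℕ.% n) (Fin.toℕ-fromℕ (2 ℕ.+ n-3)) ⟩
    n ℕ.% n                    ≡⟨ ℕ.n%n≡0 n ⟩
    0 ∎)
    where open ≡-Reasoning

  toℕ-next : ∀ i → toℕ (next i) ≡ suc (toℕ i) ⊎ (suc (toℕ i) ≡ n × toℕ (next i) ≡ 0)
  toℕ-next i with suc (toℕ i) ℕ.<? n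
  ... | yes lt = inj₁ (trans (Fin.toℕ-fromℕ< _) (ℕ.m<n⇒m%n≡m lt))
  ... | no ¬lt = inj₂ (top , trans (Fin.toℕ-fromℕ< _) (trans (cong (ℕ._% n) top) (ℕ.n%n≡0 n)))
    where
    top : suc (toℕ i) ≡ n
    top = ℕ.≤-antisym (Fin.toℕ<n i) (ℕ.≮⇒≥ ¬lt)

  next≢ : ∀ i → next i ≢ i
  next≢ i eq with toℕ-next i
  ... | inj₁ up       = ℕ.1+n≢n (trans (sym up) (cong toℕ eq))
  ... | inj₂ (top , down) with () ← trans (cong suc (trans (sym down) (cong toℕ eq))) top

  -- This is where n ≥ 3 enters: in a 2-gon `next` would be an involution.
  next-next≢ : ∀ i → next (next i) ≢ i
  next-next≢ i eq with toℕ-next i | toℕ-next (next i)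
  ... | inj₁ up | inj₁ up′ = ℕ.m+1+n≢n 1 (trans (cong suc (sym up)) (trans (sym up′) (cong toℕ eq)))
  ... | inj₁ up | inj₂ (top , down) with () ← trans (cong suc (trans (cong suc (trans (sym down) (cong toℕ eq))) (sym up))) top
  ... | inj₂ (top , down) | inj₁ up′ with () ← trans (cong suc (trans (cong suc (sym down)) (trans (sym up′) (cong toℕ eq)))) top
  ... | inj₂ (top , down) | inj₂ (top′ , _) with () ← trans (cong suc (sym down)) top′

  -- `convex` speaks of increasing indices only. The closing side and the vertices preceding i are
  -- reached by rotating the triple.
  side-convex : ∀ {i k} → k ≢ i → k ≢ next i → Counterclockwise (vertex i) (vertex (next i)) (vertex k)
  side-convex {i} {k} k≢i k≢next with toℕ-next i
  ... | inj₂ (top , down) = CCW-rotate⁻¹ (convex 0<k k<i)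
    where
    0<k : toℕ (next i) ℕ.< toℕ k
    0<k = ℕ.≤∧≢⇒< (subst (ℕ._≤ toℕ k) (sym down) z≤n) (λ eq → k≢next (Fin.toℕ-injective (sym eq)))
    k<i : toℕ k ℕ.< toℕ i
    k<i = ℕ.≤∧≢⇒< (ℕ.≤-pred (subst (suc (toℕ k) ℕ.≤_) (sym top) (Fin.toℕ<n k))) (λ eq → k≢i (Fin.toℕ-injective eq))
  ... | inj₁ up with ℕ.<-cmp (toℕ k) (toℕ i)
  ...   | tri< k<i _ _ = CCW-rotate (convex k<i (ℕ.≤-reflexive (sym up)))
  ...   | tri≈ _ k≡i _ = contradiction (Fin.toℕ-injective k≡i) k≢i
  ...   | tri> _ _ i<k = convex (ℕ.≤-reflexive (sym up))
            (ℕ.≤∧≢⇒< (subst (ℕ._≤ toℕ k) (sym up) i<k) (λ eq → k≢next (Fin.toℕ-injective (sym eq))))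

  vertex-injective : ∀ {i j} → vertex i ≡ vertex j → i ≡ j
  vertex-injective {i} {j} eq with i Fin.≟ j
  ... | yes i≡j = i≡j
  ... | no  i≢j with j Fin.≟ next i
  ...   | no  j≢next = contradiction (sym eq) (CCW-distinct (CCW-rotate⁻¹ (side-convex (≢-sym i≢j) j≢next)))
  -- For neighbours, the vertex after j completes the triple that separates them.
  ...   | yes refl   = contradiction eq (CCW-distinct (side-convex (next-next≢ i) (next≢ (next i))))

  side-distinct : ∀ i → vertex i ≢ vertex (next i)
  side-distinct i eq = next≢ i (sym (vertex-injective eq))

  Behind : Fin n → ℙ¹ → Set
  Behind i q = Counterclockwise (vertex i) q (vertex (next i))

  -- Walking along the boundary from vertex 0 as long as q stays on the left.
  locate : ∀ q → (∃ λ k → vertex k ≡ q) ⊎ (∃ λ i → Behind i q)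
  locate q = [ (λ x → x) , (λ left → close left) ]′ (Fin.<-weakInduction Progress start walk last)
    where
    Progress : Fin n → Set
    Progress k = ((∃ λ k → vertex k ≡ q) ⊎ (∃ λ i → Behind i q))
                 ⊎ k ≡ zero ⊎ Counterclockwise q (vertex zero) (vertex k)

    start : Progress zero
    start = inj₂ (inj₁ refl)

    side : ∀ i → ((∃ λ k → vertex k ≡ q) ⊎ (∃ λ i → Behind i q)) ⊎ Counterclockwise q (vertex i) (vertex (next i))
    side i with vertex i ≟ℙ q | vertex (next i) ≟ℙ q
    ... | yes eq | _      = inj₁ (inj₁ (i , eq))
    ... | no _   | yes eq = inj₁ (inj₁ (next i , eq))
    ... | no ≢₁  | no ≢₂ with CCW-connex (≢-sym ≢₁) (side-distinct i) ≢₂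
    ...   | inj₁ left   = inj₂ left
    ...   | inj₂ behind = inj₁ (inj₂ (i , CCW-rotate⁻¹ behind))

    walk : ∀ i → Progress (inject₁ i) → Progress (suc i)
    walk i (inj₁ found) = inj₁ found
    walk i (inj₂ left) with side (inject₁ i)
    ... | inj₁ found = inj₁ found
    ... | inj₂ turn rewrite next-inject₁ i with left
    ...   | inj₁ eq rewrite eq = inj₂ (inj₂ turn)
    ...   | inj₂ left′ = inj₂ (inj₂ (CCW-trans left′ turn))

    close : last ≡ zero ⊎ Counterclockwise q (vertex zero) (vertex last) →
            (∃ λ k → vertex k ≡ q) ⊎ (∃ λ i → Behind i q)
    close (inj₂ left) with side last
    ... | inj₁ found = found
    -- Having q on the left of every side would give the triple formed by q, the first and the last
    -- vertex both orientations.
    ... | inj₂ turn  = ⊥-elim (CCW-asym left (subst (λ k → Counterclockwise q (vertex last) (vertex k)) next-last turn))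

  behind-start : ∀ {i k q} → k ≢ i → Behind i q → Counterclockwise (vertex i) q (vertex k)
  behind-start {i} {k} k≢i b with k Fin.≟ next i
  ... | yes refl   = b
  ... | no  k≢next = CCW-trans b (side-convex k≢i k≢next)

  behind-end : ∀ {i k q} → k ≢ next i → Behind i q → Counterclockwise (vertex k) q (vertex (next i))
  behind-end {i} {k} k≢next b with k Fin.≟ i
  ... | yes refl = b
  ... | no  k≢i  = CCW-rotate (CCW-trans (CCW-rotate (side-convex k≢i k≢next)) (CCW-rotate⁻¹ b))

  -- Behind side i, the point q comes between vertex i and every other vertex; two such sides would
  -- order the same three points in opposite ways.
  behind-unique : ∀ {i j q} → Behind i q → Behind j q → i ≡ j
  behind-unique {i} {j} bi bj with i Fin.≟ j
  ... | yes i≡j = i≡j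
  ... | no  i≢j = ⊥-elim (CCW-asym (CCW-rotate (behind-start (≢-sym i≢j) bi)) (CCW-rotate⁻¹ (CCW-rotate⁻¹ (behind-start i≢j bj))))

  vertex-not-behind : ∀ {i k} → ¬ Behind i (vertex k)
  vertex-not-behind {i} {k} b with k Fin.≟ i | k Fin.≟ next i
  ... | yes refl | _        = CCW-distinct b refl
  ... | no _     | yes refl = CCW-distinct (CCW-rotate b) refl
  ... | no k≢i   | no k≢next = CCW-asym b (side-convex k≢i k≢next)

  arcWeight : Fin n → ℙ¹ → ℕ
  arcWeight i q = weight q (vertex i) (vertex (next i))

  arcDet : Fin n → ℕ
  arcDet i = ∣ ω (vertex i) (vertex (next i)) ∣

  -- q lies on the polygon's side of arc k, and behind arc j.
  arcWeight-nested : ∀ {j k q} → Counterclockwise (vertex k) (vertex (next k)) q → Behind j q →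
                     arcWeight j q ℕ.* arcDet k ℕ.< arcWeight k q ℕ.* arcDet j
  arcWeight-nested {j} {k} {q} front behind =
    subst₂ (λ d w → arcWeight j q ℕ.* d ℕ.< w ℕ.* arcDet j)
      (∣ω∣-comm (vertex (next k)) (vertex k)) (weight-comm q (vertex (next k)) (vertex k))
      (nested-weight behind (CCW-rotate front) start end proper)
    where
    start : vertex j ≡ vertex (next k) ⊎ Counterclockwise (vertex j) q (vertex (next k))
    start with next k Fin.≟ j
    ... | yes eq = inj₁ (cong vertex (sym eq))
    ... | no  ≢j = inj₂ (behind-start ≢j behind)
    end : vertex k ≡ vertex (next j) ⊎ Counterclockwise (vertex k) q (vertex (next j))
    end with k Fin.≟ next j
    ... | yes eq = inj₁ (cong vertex eq)
    ... | no  ≢k = inj₂ (behind-end ≢k behind)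
    proper : vertex j ≢ vertex (next k) ⊎ vertex k ≢ vertex (next j)
    proper with j Fin.≟ next k
    -- Sharing both end points would make the arcs reverses of each other, as in a 2-gon.
    ... | yes refl = inj₂ (λ eq → next-next≢ k (sym (vertex-injective eq)))
    ... | no  ≢j   = inj₁ (λ eq → ≢j (vertex-injective eq))

  private
    -- A common denominator for the quotients by `arcDet`. It exists because there are finitely many
    -- sides, and it turns the descent into one in ℕ.
    D : ℕ
    D = ℕ.product (map arcDet (allFin n))

    arcDet∣D : ∀ i → arcDet i ℕ.∣ D
    arcDet∣D i = ℕ.∈⇒∣product (∈-map⁺ arcDet (∈-allFin i))

    cofactor : Fin n → ℕ
    cofactor i = ℕ.quotient (arcDet∣D i)

    D≡cofactor*arcDet : ∀ i → D ≡ cofactor i ℕ.* arcDet i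
    D≡cofactor*arcDet i = ℕ._∣_.equality (arcDet∣D i)

    instance
      D-nonZero : ℕ.NonZero D
      D-nonZero = ℕ.product≢0 (All.map⁺ (All.universal (λ i → ℕ.>-nonZero (≢⇒∣ω∣>0 (side-distinct i))) (allFin n)))

    cofactor-nonZero : ∀ i → ℕ.NonZero (cofactor i)
    cofactor-nonZero i = ℕ.m*n≢0⇒m≢0 (cofactor i) {{subst ℕ.NonZero (D≡cofactor*arcDet i) D-nonZero}}

  -- arcWeight i q / arcDet i, multiplied by a common denominator.
  depth : Fin n → ℙ¹ → ℕ
  depth i q = cofactor i ℕ.* arcWeight i q

  depth-< : ∀ {i j q q′} → arcWeight j q′ ℕ.* arcDet i ℕ.< arcWeight i q ℕ.* arcDet j → depth j q′ ℕ.< depth i q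
  depth-< {i} {j} {q} {q′} lt =
    ℕ.*-cancelʳ-< D _ _ (subst₂ ℕ._<_ left right (ℕ.*-monoʳ-< (cofactor i ℕ.* cofactor j) lt))
    where
    instance
      cofactors-nonZero : ℕ.NonZero (cofactor i ℕ.* cofactor j)
      cofactors-nonZero = ℕ.m*n≢0 _ _ {{cofactor-nonZero i}} {{cofactor-nonZero j}}
    identity₁ : ∀ a b c d → a ℕ.* b ℕ.* (c ℕ.* d) ≡ b ℕ.* c ℕ.* (a ℕ.* d)
    identity₁ = ℕ.solve-∀
    identity₂ : ∀ a b c d → a ℕ.* b ℕ.* (c ℕ.* d) ≡ a ℕ.* c ℕ.* (b ℕ.* d)
    identity₂ = ℕ.solve-∀
    left : cofactor i ℕ.* cofactor j ℕ.* (arcWeight j q′ ℕ.* arcDet i) ≡ depth j q′ ℕ.* D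
    left = trans (identity₁ (cofactor i) (cofactor j) (arcWeight j q′) (arcDet i))
                 (cong (depth j q′ ℕ.*_) (sym (D≡cofactor*arcDet i)))
    right : cofactor i ℕ.* cofactor j ℕ.* (arcWeight i q ℕ.* arcDet j) ≡ depth i q ℕ.* D
    right = trans (identity₂ (cofactor i) (cofactor j) (arcWeight i q) (arcDet j))
                  (cong (depth i q ℕ.*_) (sym (D≡cofactor*arcDet j)))

-- Crossing sides and descending to the polygon

module Tessellation (F : ExtendedFareySymbol) where
  open ExtendedFareySymbol F
  open Polygon sidePairing

  -- Only order 3 is singled out: a side of order 2 satisfies `i * ≡ i` and has the same gluing
  -- formula as a paired side, so it is treated as paired with itself.
  Rotation : Fin n → Set
  Rotation i = Σ[ e ∈ Elliptic i ] μ-ell i e ≡ three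

  rotation? : ∀ i → Dec (Rotation i)
  rotation? i with elliptic? i
  ... | no ¬e = no λ (e , _) → ¬e e
  ... | yes e with μ-ell i e in eq
  ...   | three = yes (e , eq)
  ...   | two   = no λ (e′ , eq′) → two≢three (trans (sym eq) (trans (cong (μ-ell i) (uip e e′)) eq′))
    where
    two≢three : two ≢ three
    two≢three ()

  *-¬rotation : ∀ {i} → ¬ Rotation i → ¬ Rotation (i *)
  *-¬rotation {i} ¬rot (e , eq) = ¬rot (subst Rotation (trans (sym e) (*-involutive i)) (e , eq))

  gluingMatrix-elliptic : ∀ {i} (e : Elliptic i) → gluingMatrix i ≡ ellipticGluing i (μ-ell i e)
  gluingMatrix-elliptic {i} e with elliptic? i
  ... | yes e′ = cong (λ e → ellipticGluing i (μ-ell i e)) (uip e′ e)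
  ... | no  ¬e = contradiction e ¬e

  gluingMatrix-nonElliptic : ∀ {i} → ¬ Elliptic i → gluingMatrix i ≡ toM₂ℚ (A i) Mℚ.⊗ inverse (toM₂ℚ (A⁻ (i *)))
  gluingMatrix-nonElliptic {i} ¬e with elliptic? i
  ... | yes e = contradiction e ¬e
  ... | no  _ = refl

  paired-gluing : ∀ {i} → ¬ Rotation i → matrix (γ i) Mℤ.⊗ A⁻ (i *) ≡ A i
  paired-gluing {i} ¬rot = integral-quotient (matrix (γ i)) (A i) (A⁻ (i *)) (det-arcMatrix⁻ (side-distinct (i *)))
    (trans (γ-isGluing i) (gluing (elliptic? i)))
    where
    order-two : ∀ {e} → μ-ell i e ≢ three → μ-ell i e ≡ two
    order-two {e} ≢three with μ-ell i e
    ... | two   = refl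
    ... | three = contradiction refl ≢three
    gluing : Dec (Elliptic i) → gluingMatrix i ≡ toM₂ℚ (A i) Mℚ.⊗ inverse (toM₂ℚ (A⁻ (i *)))
    gluing (no ¬e) = gluingMatrix-nonElliptic ¬e
    gluing (yes e) = trans (gluingMatrix-elliptic e)
      (trans (cong (ellipticGluing i) (order-two (λ eq → ¬rot (e , eq))))
             (cong (λ k → toM₂ℚ (A i) Mℚ.⊗ inverse (toM₂ℚ (A⁻ k))) (sym e)))

  rotation-gluing : ∀ {i} → Rotation i → matrix (γ i) Mℤ.⊗ A⁻ i ≡ A⁻ i Mℤ.⊗ R₃
  rotation-gluing {i} (e , eq) = integral-quotient (matrix (γ i)) (A⁻ i Mℤ.⊗ R₃) (A⁻ i) (det-arcMatrix⁻ (side-distinct i))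
    (trans (γ-isGluing i) (trans (gluingMatrix-elliptic e) (trans (cong (ellipticGluing i) eq)
      (cong (Mℚ._⊗ inverse (toM₂ℚ (A⁻ i))) (sym (toM₂ℚ-⊗ (A⁻ i) R₃))))))

  module Paired {i} (¬rot : ¬ Rotation i) =
    GluedArcs (γ i) (side-distinct i) (side-distinct (i *)) (paired-gluing ¬rot)

  module Rotated {i} (rot : Rotation i) =
    RotatedArc (γ i) (side-distinct i) (rotation-gluing rot)

  paired-inverse : ∀ {i} → ¬ Rotation i → γ i ∙ γ (i *) ≈± ε
  paired-inverse {i} ¬rot = glued-inverse (γ i) (γ (i *)) (side-distinct i) (paired-gluing ¬rot)
    (subst (λ k → matrix (γ (i *)) Mℤ.⊗ A⁻ k ≡ A (i *)) (*-involutive i) (paired-gluing (*-¬rotation ¬rot)))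

  -- The tile adjacent to the polygon across side i is γ i • polygon, except
  -- that a triangle with third vertex apex i sits in between if γ i has
  -- order 3.
  apex : Fin n → ℙ¹
  apex i = γ i • vertex i

  -- The apex is a vertex of both tiles beyond the triangle. Assigning it to the first sector keeps
  -- the letter of a crossing unique.
  data Crossing (q : ℙ¹) : Set where
    across : ∀ i → ¬ Rotation i → Behind i q → Crossing q
    turn   : ∀ i → Rotation i → q ≡ apex i ⊎ Counterclockwise (vertex i) q (apex i) → Crossing q
    turn⁻¹ : ∀ i → Rotation i → Counterclockwise (apex i) q (vertex (next i)) → Crossing q

  -- Which of γ i, (γ i)⁻¹ takes the polygon to the tile entered.
  data Letter : Set where
    forward backward : Fin n → Letter

  ⟦_⟧ : Letter → Γ
  ⟦ forward i ⟧  = γΓ i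
  ⟦ backward i ⟧ = γΓ i ⁻¹Γ

  letter : ∀ {q} → Crossing q → Letter
  letter (across i _ _) = forward i
  letter (turn i _ _)   = forward i
  letter (turn⁻¹ i _ _) = backward i

  pullback : Letter → ℙ¹ → ℙ¹
  pullback ℓ q = element ⟦ ℓ ⟧ ⁻¹ • q

  sectors-disjoint : ∀ {i q} → Rotation i → q ≡ apex i ⊎ Counterclockwise (vertex i) q (apex i) →
                     ¬ Counterclockwise (apex i) q (vertex (next i))
  sectors-disjoint rot (inj₁ refl)  second = CCW-distinct second refl
  sectors-disjoint rot (inj₂ first) second =
    CCW-asym (CCW-rotate⁻¹ first) (CCW-trans second (CCW-rotate (Rotated.apex-behind rot)))

  crossedSide : ∀ {q} → Crossing q → Fin n
  crossedSide (across i _ _) = i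
  crossedSide (turn i _ _)   = i
  crossedSide (turn⁻¹ i _ _) = i

  crossing-behind : ∀ {q} (c : Crossing q) → Behind (crossedSide c) q
  crossing-behind (across i _ b)        = b
  crossing-behind (turn i rot (inj₁ refl)) = Rotated.apex-behind rot
  crossing-behind (turn i rot (inj₂ b)) = CCW-trans b (Rotated.apex-behind rot)
  crossing-behind (turn⁻¹ i rot b)      = CCW-rotate (CCW-trans (CCW-rotate⁻¹ (Rotated.apex-behind rot)) (CCW-rotate⁻¹ b))

  crossing : ∀ {i q} → Behind i q → Crossing q
  crossing {i} {q} b = [ (λ rot → rotated rot (q ≟ℙ apex i)) , (λ ¬rot → across i ¬rot b) ]′ (toSum (rotation? i))
    where
    rotated : Rotation i → Dec (q ≡ apex i) → Crossing q
    rotated rot (yes q≡apex) = turn i rot (inj₁ q≡apex)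
    rotated rot (no  q≢apex) =
      [ (λ first → turn i rot (inj₂ first)) , (λ second → turn⁻¹ i rot (CCW-transʳ second b)) ]′
      (CCW-connex (CCW-distinct b) q≢apex (≢-sym (CCW-distinct (Rotated.apex-behind rot))))

  -- The descent path as an inductive type: functions on it recurse structurally, and the numerical
  -- termination argument is confined to `reach`.
  data Reach (q : ℙ¹) : Set where
    at-vertex : ∀ k → vertex k ≡ q → Reach q
    cross     : (c : Crossing q) → Reach (pullback (letter c) q) → Reach q

  -- The pullback takes the arc just in front of q to this side of the polygon, reversed, so that
  -- the new point lies in front of it.
  farSide : ∀ {q} → Crossing q → Fin n
  farSide (across i _ _) = i *
  farSide (turn i _ _)   = i
  farSide (turn⁻¹ i _ _) = i

  private
    -- Only a weak inequality. Strict decrease comes from `arcWeight-nested`, once the new point is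
    -- found to be behind some further side.
    Descent : Fin n → ℙ¹ → Fin n → ℙ¹ → Set
    Descent k q′ i q = Counterclockwise (vertex k) (vertex (next k)) q′
      × arcWeight k q′ ℕ.≤ arcWeight i q × arcDet k ≡ arcDet i

    descent : ∀ g {k i x y q} → g • x ≡ vertex (next k) → g • y ≡ vertex k → Counterclockwise x q y →
              weight q x y ℕ.≤ arcWeight i q → ∣ ω x y ∣ ≡ arcDet i → Descent k (g • q) i q
    descent g {k} {i} {x} {y} {q} gx gy xqy weight≤ det≡ =
        CCW-rotate⁻¹ (subst₂ (λ a b → Counterclockwise a (g • q) b) gx gy (CCW-• g xqy))
      , subst (ℕ._≤ arcWeight i q) (sym weight≡) weight≤
      , (begin
          ∣ ω (vertex k) (vertex (next k)) ∣   ≡⟨ ∣ω∣-comm (vertex k) (vertex (next k)) ⟩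
          ∣ ω (vertex (next k)) (vertex k) ∣   ≡⟨ cong₂ (λ a b → ∣ ω a b ∣) gx gy ⟨
          ∣ ω (g • x) (g • y) ∣                ≡⟨ ∣ω∣-• g x y ⟩
          ∣ ω x y ∣                            ≡⟨ det≡ ⟩
          arcDet i ∎)
      where
      open ≡-Reasoning
      weight≡ : arcWeight k (g • q) ≡ weight q x y
      weight≡ = begin
        weight (g • q) (vertex k) (vertex (next k))   ≡⟨ weight-comm (g • q) (vertex k) (vertex (next k)) ⟩
        weight (g • q) (vertex (next k)) (vertex k)   ≡⟨ cong₂ (weight (g • q)) gx gy ⟨
        weight (g • q) (g • x) (g • y)                ≡⟨ weight-• g q x y ⟩
        weight q x y ∎

    cancel-det : ∀ {i a b d} → d ≡ arcDet i → a ℕ.* arcDet i ℕ.< b ℕ.* d → a ℕ.≤ b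
    cancel-det {i} {a} {b} refl lt = ℕ.<⇒≤ (ℕ.*-cancelʳ-< (arcDet i) a b lt)

    ∣ω∣-apexˡ : ∀ {i} (rot : Rotation i) → ∣ ω (vertex i) (apex i) ∣ ≡ arcDet i
    ∣ω∣-apexˡ {i} rot = begin
      ∣ ω (vertex i) (apex i) ∣                   ≡⟨ cong (λ r → ∣ ω r (apex i) ∣) (Rotated.end-to-start rot) ⟨
      ∣ ω (γ i • vertex (next i)) (apex i) ∣      ≡⟨ ∣ω∣-• (γ i) (vertex (next i)) (vertex i) ⟩
      ∣ ω (vertex (next i)) (vertex i) ∣          ≡⟨ ∣ω∣-comm (vertex (next i)) (vertex i) ⟩
      arcDet i ∎
      where open ≡-Reasoning

    ∣ω∣-apexʳ : ∀ {i} (rot : Rotation i) → ∣ ω (apex i) (vertex (next i)) ∣ ≡ arcDet i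
    ∣ω∣-apexʳ {i} rot = begin
      ∣ ω (apex i) (vertex (next i)) ∣            ≡⟨ cong (λ s → ∣ ω (apex i) s ∣) (Rotated.apex-to-end rot) ⟨
      ∣ ω (apex i) (γ i • apex i) ∣               ≡⟨ ∣ω∣-• (γ i) (vertex i) (apex i) ⟩
      ∣ ω (vertex i) (apex i) ∣                   ≡⟨ ∣ω∣-apexˡ rot ⟩
      arcDet i ∎
      where open ≡-Reasoning

  -- Across a paired side the weight is merely transported. At a triangle, q is behind one of its
  -- two other edges; that edge separates q from side i and has the same determinant, since the
  -- rotation permutes the edges, so `nested-weight` lowers the weight.
  crossing-descent : ∀ {q} (c : Crossing q) →
    (∃ λ k → vertex k ≡ pullback (letter c) q) ⊎ Descent (farSide c) (pullback (letter c) q) (crossedSide c) q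
  crossing-descent {q} (across i ¬rot b) = inj₂
    (descent (γ i ⁻¹) (⁻¹-•-≡ (γ i) (Paired.end-to-start ¬rot)) (⁻¹-•-≡ (γ i) (Paired.start-to-end ¬rot)) b ℕ.≤-refl refl)
  crossing-descent (turn i rot (inj₁ refl)) = inj₁ (i , sym (⁻¹-•-• (γ i) (vertex i)))
  crossing-descent {q} (turn i rot (inj₂ b)) = inj₂
    (descent (γ i ⁻¹) (⁻¹-•-≡ (γ i) (Rotated.end-to-start rot)) (⁻¹-•-• (γ i) (vertex i)) b
      (cancel-det (∣ω∣-apexˡ rot)
        (nested-weight b (CCW-trans b behind) (inj₁ refl) (inj₂ (CCW-rotate⁻¹ (CCW-transʳ b behind)))
          (inj₂ (≢-sym (CCW-distinct (CCW-rotate behind))))))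
      (∣ω∣-apexˡ rot))
    where behind = Rotated.apex-behind rot
  crossing-descent {q} c@(turn⁻¹ i rot b) = inj₂ (subst (λ p → Descent i p i q) (sym (•-⁻¹⁻¹ (γ i) q))
    (descent (γ i) (Rotated.apex-to-end rot) (Rotated.end-to-start rot) b
      (cancel-det (∣ω∣-apexʳ rot)
        (nested-weight b (crossing-behind c) (inj₂ (CCW-trans b (CCW-rotate behind))) (inj₁ refl)
          (inj₁ (≢-sym (CCW-distinct behind)))))
      (∣ω∣-apexʳ rot)))
    where behind = Rotated.apex-behind rot

  private
    reach-behind : ∀ m {i q} → Behind i q → depth i q ℕ.< m → Reach q
    reach-behind (suc m) {i} {q} b (s≤s depth≤m) =
      cross c ([ (λ (k , eq) → at-vertex k eq) , descend (locate q′) ]′ (crossing-descent c))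
      where
      open ℕ.≤-Reasoning
      c : Crossing q
      c = crossing b
      q′ : ℙ¹
      q′ = pullback (letter c) q
      side≡ : crossedSide c ≡ i
      side≡ = behind-unique (crossing-behind c) b
      descend : (∃ λ k → vertex k ≡ q′) ⊎ (∃ λ j → Behind j q′) → Descent (farSide c) q′ (crossedSide c) q → Reach q′
      descend (inj₁ (k , eq)) _                        = at-vertex k eq
      descend (inj₂ (j , b′)) (front , weight≤ , det≡) = reach-behind m b′ (ℕ.<-≤-trans (depth-< lt) depth≤m)
        where
        lt : arcWeight j q′ ℕ.* arcDet i ℕ.< arcWeight i q ℕ.* arcDet j
        lt = begin-strict
          arcWeight j q′ ℕ.* arcDet i                ≡⟨ cong (arcWeight j q′ ℕ.*_) (trans (cong arcDet (sym side≡)) (sym det≡)) ⟩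
          arcWeight j q′ ℕ.* arcDet (farSide c)      <⟨ arcWeight-nested front b′ ⟩
          arcWeight (farSide c) q′ ℕ.* arcDet j      ≤⟨ ℕ.*-monoˡ-≤ (arcDet j) weight≤ ⟩
          arcWeight (crossedSide c) q ℕ.* arcDet j   ≡⟨ cong (λ k → arcWeight k q ℕ.* arcDet j) side≡ ⟩
          arcWeight i q ℕ.* arcDet j ∎

  reach : ∀ q → Reach q
  reach q = [ (λ (k , eq) → at-vertex k eq) , (λ (i , b) → reach-behind (suc (depth i q)) b ℕ.≤-refl) ]′ (locate q)

  -- The position of q fixes the side by `behind-unique` and the sector by `sectors-disjoint`. Any
  -- two descents from q therefore take the same steps.
  letter-unique : ∀ {q} (c c′ : Crossing q) → letter c ≡ letter c′
  letter-unique c c′ = same-side c c′ (behind-unique (crossing-behind c) (crossing-behind c′))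
    where
    same-side : ∀ {q} (c c′ : Crossing q) → crossedSide c ≡ crossedSide c′ → letter c ≡ letter c′
    same-side (across i _ _)    (across j _ _)    i≡j  = cong forward i≡j
    same-side (turn i _ _)      (turn j _ _)      i≡j  = cong forward i≡j
    same-side (turn⁻¹ i _ _)    (turn⁻¹ j _ _)    i≡j  = cong backward i≡j
    same-side (across i ¬rot _) (turn j rot _)    refl = contradiction rot ¬rot
    same-side (across i ¬rot _) (turn⁻¹ j rot _)  refl = contradiction rot ¬rot
    same-side (turn i rot _)    (across j ¬rot _) refl = contradiction rot ¬rot
    same-side (turn⁻¹ i rot _)  (across j ¬rot _) refl = contradiction rot ¬rot
    same-side (turn i rot x)    (turn⁻¹ j _ y)    refl = ⊥-elim (sectors-disjoint rot x y)
    same-side (turn⁻¹ i rot y)  (turn j _ x)      refl = ⊥-elim (sectors-disjoint rot x y)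

-- Formal sums

module FormalSums (S : DecSetoid 0ℓ 0ℓ) where
  open DecSetoid S using (Carrier; _≈_; _≟_) renaming (refl to ≈-refl; sym to ≈-sym; trans to ≈-trans)
  open FormalEquality S

  coeff-++ : ∀ D D′ x → coeff (D ++ D′) x ≡ coeff D x ℤ.+ coeff D′ x
  coeff-++ []            D′ x = sym (ℤ.+-identityˡ _)
  coeff-++ ((k , y) ∷ D) D′ x =
    trans (cong (ℤ._+_ k′) (coeff-++ D D′ x)) (sym (ℤ.+-assoc k′ (coeff D x) (coeff D′ x)))
    where k′ = if does (y ≟ x) then k else 0ℤ

  coeff-negate : ∀ D x → coeff (negate D) x ≡ ℤ.- coeff D x
  coeff-negate []            x = refl
  coeff-negate ((k , y) ∷ D) x = trans (cong₂ ℤ._+_ (head (does (y ≟ x))) (coeff-negate D x))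
                                       (sym (ℤ.neg-distrib-+ (if does (y ≟ x) then k else 0ℤ) (coeff D x)))
    where
    head : ∀ b → (if b then ℤ.- k else 0ℤ) ≡ ℤ.- (if b then k else 0ℤ)
    head true  = refl
    head false = refl

  does-cong : ∀ {x y x′ y′} → (x ≈ y → x′ ≈ y′) → (x′ ≈ y′ → x ≈ y) → does (x ≟ y) ≡ does (x′ ≟ y′)
  does-cong {x} {y} {x′} {y′} to from with x ≟ y
  ... | yes x≈y = sym (dec-true (x′ ≟ y′) (to x≈y))
  ... | no  x≉y = sym (dec-false (x′ ≟ y′) (λ x′≈y′ → x≉y (from x′≈y′)))

  coeff-cong : ∀ D {x y} → x ≈ y → coeff D x ≡ coeff D y
  coeff-cong []            x≈y = refl
  coeff-cong ((k , z) ∷ D) x≈y = cong₂ (λ b c → (if b then k else 0ℤ) ℤ.+ c)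
    (does-cong (λ z≈x → ≈-trans z≈x x≈y) (λ z≈y → ≈-trans z≈y (≈-sym x≈y))) (coeff-cong D x≈y)

  ++-negate-isAbelianGroup : IsAbelianGroup _≋_ _++_ [] negate
  ++-negate-isAbelianGroup = record
    { isGroup = record
      { isMonoid = record
        { isSemigroup = record
          { isMagma = record
            { isEquivalence = record
              { refl  = λ _ → refl
              ; sym   = λ p x → sym (p x)
              ; trans = λ p q x → trans (p x) (q x)
              }
            ; ∙-cong = λ {D} {D′} {E} {E′} p q x →
                trans (coeff-++ D E x) (trans (cong₂ ℤ._+_ (p x) (q x)) (sym (coeff-++ D′ E′ x)))
            }
          ; assoc = λ C D E x →
              trans (trans (coeff-++ (C ++ D) E x) (cong (ℤ._+ coeff E x) (coeff-++ C D x)))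
                (trans (ℤ.+-assoc (coeff C x) (coeff D x) (coeff E x))
                  (sym (trans (coeff-++ C (D ++ E) x) (cong (ℤ._+_ (coeff C x)) (coeff-++ D E x)))))
          }
        ; identity = (λ D x → refl) , (λ D x → trans (coeff-++ D [] x) (ℤ.+-identityʳ _))
        }
      ; inverse = (λ D x → trans (coeff-++ (negate D) D x)
                             (trans (cong (ℤ._+ coeff D x) (coeff-negate D x)) (ℤ.+-inverseˡ (coeff D x))))
                , (λ D x → trans (coeff-++ D (negate D) x)
                             (trans (cong (ℤ._+_ (coeff D x)) (coeff-negate D x)) (ℤ.+-inverseʳ (coeff D x))))
      ; ⁻¹-cong = λ {D} {D′} p x → trans (coeff-negate D x) (trans (cong ℤ.-_ (p x)) (sym (coeff-negate D′ x)))
      }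
    ; comm = λ D E x → trans (coeff-++ D E x) (trans (ℤ.+-comm (coeff D x) (coeff E x)) (sym (coeff-++ E D x)))
    }

module _ (S : DecSetoid 0ℓ 0ℓ) (N : AbelianGroup 0ℓ 0ℓ) where
  private
    module N = AbelianGroup N

  -- Only congruence and additivity in the integer are asked of `·`, so this covers both
  -- integer-valued coefficient functions and integration with values in a module.
  module LinearExtension
    (_·_ : ℤ → N.Carrier → N.Carrier)
    (·-congˡ : ∀ k {m m′} → m N.≈ m′ → (k · m) N.≈ (k · m′))
    (·-distribʳ : ∀ k l m → ((k ℤ.+ l) · m) N.≈ ((k · m) N.∙ (l · m)))
    (f : DecSetoid.Carrier S → N.Carrier)
    (f-cong : ∀ {x y} → DecSetoid._≈_ S x y → f x N.≈ f y)
    where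
    open DecSetoid S using (_≈_; _≟_) renaming (Carrier to X; refl to ≈-refl; sym to ≈-sym; trans to ≈-trans)
    open FormalEquality S
    open FormalSums S
    open AbelianGroupProperties N
    open CommutativeSemigroupProperties N.commutativeSemigroup using (x∙yz≈y∙xz)
    open import Relation.Binary.Reasoning.Setoid N.setoid

    extend : Formal X → N.Carrier
    extend []            = N.ε
    extend ((k , x) ∷ D) = (k · f x) N.∙ extend D

    0·m≈0 : ∀ m → (0ℤ · m) N.≈ N.ε
    0·m≈0 m = identityˡ-unique (0ℤ · m) (0ℤ · m) (N.sym (·-distribʳ 0ℤ 0ℤ m))

    -k·m≈-[k·m] : ∀ k m → ((ℤ.- k) · m) N.≈ ((k · m) N.⁻¹)
    -k·m≈-[k·m] k m = inverseˡ-unique ((ℤ.- k) · m) (k · m) (begin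
      ((ℤ.- k) · m) N.∙ (k · m)   ≈⟨ ·-distribʳ (ℤ.- k) k m ⟨
      (ℤ.- k ℤ.+ k) · m           ≡⟨ cong (_· m) (ℤ.+-inverseˡ k) ⟩
      0ℤ · m                      ≈⟨ 0·m≈0 m ⟩
      N.ε ∎)

    extend-++ : ∀ D E → extend (D ++ E) N.≈ (extend D N.∙ extend E)
    extend-++ []            E = N.sym (N.identityˡ (extend E))
    extend-++ ((k , x) ∷ D) E = N.trans (N.∙-congˡ (extend-++ D E)) (N.sym (N.assoc (k · f x) (extend D) (extend E)))

    extend-negate : ∀ D → extend (negate D) N.≈ (extend D N.⁻¹)
    extend-negate []            = N.sym ε⁻¹≈ε
    extend-negate ((k , x) ∷ D) = N.trans (N.∙-cong (-k·m≈-[k·m] k (f x)) (extend-negate D)) (⁻¹-∙-comm (k · f x) (extend D))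

    private
      remove : X → Formal X → Formal X
      remove x []            = []
      remove x ((k , y) ∷ D) = if does (y ≟ x) then remove x D else (k , y) ∷ remove x D

      length-remove : ∀ x D → length (remove x D) ℕ.≤ length D
      length-remove x []            = ℕ.z≤n
      length-remove x ((k , y) ∷ D) with does (y ≟ x)
      ... | true  = ℕ.m≤n⇒m≤1+n (length-remove x D)
      ... | false = s≤s (length-remove x D)

      coeff-remove-≈ : ∀ {x y} D → x ≈ y → coeff (remove x D) y ≡ 0ℤ
      coeff-remove-≈         []            x≈y = refl
      coeff-remove-≈ {x} {y} ((k , z) ∷ D) x≈y with z ≟ x
      ... | yes _   = coeff-remove-≈ D x≈y
      ... | no  z≉x = cong₂ ℤ._+_ (cong (if_then k else 0ℤ) (dec-false (z ≟ y) λ z≈y → z≉x (≈-trans z≈y (≈-sym x≈y))))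
                                  (coeff-remove-≈ D x≈y)

      coeff-remove-≉ : ∀ {x y} D → ¬ (x ≈ y) → coeff (remove x D) y ≡ coeff D y
      coeff-remove-≉         []            x≉y = refl
      coeff-remove-≉ {x} {y} ((k , z) ∷ D) x≉y with z ≟ x
      ... | no  _   = cong (ℤ._+_ (if does (z ≟ y) then k else 0ℤ)) (coeff-remove-≉ D x≉y)
      ... | yes z≈x = trans (coeff-remove-≉ D x≉y) (sym (trans
            (cong (λ b → (if b then k else 0ℤ) ℤ.+ coeff D y) (dec-false (z ≟ y) λ z≈y → x≉y (≈-trans (≈-sym z≈x) z≈y)))
            (ℤ.+-identityˡ (coeff D y))))

      extend-remove : ∀ x D → extend D N.≈ ((coeff D x · f x) N.∙ extend (remove x D))
      extend-remove x []            = N.sym (N.trans (N.identityʳ _) (0·m≈0 (f x)))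
      extend-remove x ((k , y) ∷ D) with y ≟ x
      ... | yes y≈x = begin
        (k · f y) N.∙ extend D                                            ≈⟨ N.∙-cong (·-congˡ k (f-cong y≈x)) (extend-remove x D) ⟩
        (k · f x) N.∙ ((coeff D x · f x) N.∙ extend (remove x D))         ≈⟨ N.assoc _ _ _ ⟨
        ((k · f x) N.∙ (coeff D x · f x)) N.∙ extend (remove x D)         ≈⟨ N.∙-congʳ (·-distribʳ k (coeff D x) (f x)) ⟨
        ((k ℤ.+ coeff D x) · f x) N.∙ extend (remove x D) ∎
      ... | no  _   = begin
        (k · f y) N.∙ extend D                                            ≈⟨ N.∙-congˡ (extend-remove x D) ⟩
        (k · f y) N.∙ ((coeff D x · f x) N.∙ extend (remove x D))         ≈⟨ x∙yz≈y∙xz _ _ _ ⟩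
        (coeff D x · f x) N.∙ ((k · f y) N.∙ extend (remove x D))         ≡⟨ cong (λ l → (l · f x) N.∙ ((k · f y) N.∙ extend (remove x D))) (ℤ.+-identityˡ (coeff D x)) ⟨
        ((0ℤ ℤ.+ coeff D x) · f x) N.∙ ((k · f y) N.∙ extend (remove x D)) ∎

      -- All terms at the first point are gathered into one, whose coefficient is 0, and the rest is
      -- a shorter list. The bound m drives the recursion, since `remove x D′` is not a sublist that
      -- the termination checker sees.
      extend-zero : ∀ m D → length D ℕ.≤ m → D ≋ [] → extend D N.≈ N.ε
      extend-zero m       []              _         D≋0 = N.refl
      extend-zero (suc m) D@((k , x) ∷ D′) (s≤s len≤) D≋0 = begin
        extend D                                        ≈⟨ extend-remove x D ⟩
        (coeff D x · f x) N.∙ extend (remove x D)       ≡⟨ cong₂ (λ l E → (l · f x) N.∙ extend E) (D≋0 x) remove≡ ⟩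
        (0ℤ · f x) N.∙ extend (remove x D′)             ≈⟨ N.∙-cong (0·m≈0 (f x)) (extend-zero m (remove x D′) (ℕ.≤-trans (length-remove x D′) len≤) remove≋0) ⟩
        N.ε N.∙ N.ε                                     ≈⟨ N.identityˡ N.ε ⟩
        N.ε ∎
        where
        remove≡ : remove x D ≡ remove x D′
        remove≡ = cong (if_then remove x D′ else ((k , x) ∷ remove x D′)) (dec-true (x ≟ x) ≈-refl)
        remove≋0 : remove x D′ ≋ []
        remove≋0 y with x ≟ y
        ... | yes x≈y = coeff-remove-≈ D′ x≈y
        ... | no  x≉y = trans (cong (λ E → coeff E y) (sym remove≡)) (trans (coeff-remove-≉ D x≉y) (D≋0 y))

    extend-cong : ∀ {D E} → D ≋ E → extend D N.≈ extend E
    extend-cong {D} {E} D≋E = x∙y⁻¹≈ε⇒x≈y (extend D) (extend E) (begin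
      extend D N.∙ (extend E N.⁻¹)         ≈⟨ N.∙-congˡ (extend-negate E) ⟨
      extend D N.∙ extend (negate E)       ≈⟨ extend-++ D (negate E) ⟨
      extend (D ++ negate E)               ≈⟨ extend-zero _ (D ++ negate E) ℕ.≤-refl difference ⟩
      N.ε ∎)
      where
      difference : (D ++ negate E) ≋ []
      difference x = trans (coeff-++ D (negate E) x)
        (trans (cong₂ ℤ._+_ (D≋E x) (coeff-negate E x)) (ℤ.+-inverseʳ (coeff E x)))

-- Group laws in PSL₂(ℤ)

∙-cong : ∀ {g g′ h h′} → g ≈± g′ → h ≈± h′ → g ∙ h ≈± g′ ∙ h′
∙-cong {sl _ _} {sl _ _} {sl _ _} {sl _ _} (inj₁ refl) (inj₁ refl) = inj₁ refl
∙-cong {sl _ _} {sl M _} {sl _ _} {sl N _} (inj₁ refl) (inj₂ refl) = inj₂ (neg-⊗ʳ M N)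
∙-cong {sl _ _} {sl M _} {sl _ _} {sl N _} (inj₂ refl) (inj₁ refl) = inj₂ (neg-⊗ˡ M N)
∙-cong {sl _ _} {sl M _} {sl _ _} {sl N _} (inj₂ refl) (inj₂ refl) =
  inj₁ (trans (neg-⊗ˡ M (Mℤ.neg N)) (trans (cong Mℤ.neg (neg-⊗ʳ M N)) (neg-involutive (M Mℤ.⊗ N))))

∙-assoc : ∀ g h k → (g ∙ h) ∙ k ≈± g ∙ (h ∙ k)
∙-assoc (sl L _) (sl M _) (sl N _) = inj₁ (⊗-assoc L M N)

∙-identityˡ : ∀ g → ε ∙ g ≈± g
∙-identityˡ (sl M _) = inj₁ (⊗-identityˡ M)

∙-identityʳ : ∀ g → g ∙ ε ≈± g
∙-identityʳ (sl M _) = inj₁ (⊗-identityʳ M)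

⁻¹-cong : ∀ {g h} → g ≈± h → g ⁻¹ ≈± h ⁻¹
⁻¹-cong {sl _ _} {sl _ _} (inj₁ refl) = inj₁ refl
⁻¹-cong {sl _ _} {sl _ _} (inj₂ refl) = inj₂ refl

⁻¹-anti-homo-∙ : ∀ g h → (g ∙ h) ⁻¹ ≈± h ⁻¹ ∙ g ⁻¹
⁻¹-anti-homo-∙ (sl (mat a b c d) _) (sl (mat a′ b′ c′ d′) _) =
  inj₁ (mat-≡ (identity₁ c d b′ d′) (identity₂ a b b′ d′) (identity₃ c d a′ c′) (identity₄ a b a′ c′))
  where
  identity₁ : ∀ c d b′ d′ → c ℤ.* b′ ℤ.+ d ℤ.* d′ ≡ d′ ℤ.* d ℤ.+ ℤ.- b′ ℤ.* ℤ.- c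
  identity₁ = solve-∀
  identity₂ : ∀ a b b′ d′ → ℤ.- (a ℤ.* b′ ℤ.+ b ℤ.* d′) ≡ d′ ℤ.* ℤ.- b ℤ.+ ℤ.- b′ ℤ.* a
  identity₂ = solve-∀
  identity₃ : ∀ c d a′ c′ → ℤ.- (c ℤ.* a′ ℤ.+ d ℤ.* c′) ≡ ℤ.- c′ ℤ.* d ℤ.+ a′ ℤ.* ℤ.- c
  identity₃ = solve-∀
  identity₄ : ∀ a b a′ c′ → a ℤ.* a′ ℤ.+ b ℤ.* c′ ≡ ℤ.- c′ ℤ.* ℤ.- b ℤ.+ a′ ℤ.* a
  identity₄ = solve-∀

-- The group ring and its modules

module GroupRingProperties (F : ExtendedFareySymbol) where
  open ExtendedFareySymbol F
  open GroupRing F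

  module ΓS = DecSetoid Γ-decSetoid
  open FormalSums Γ-decSetoid using () renaming (++-negate-isAbelianGroup to ≋Γ-isAbelianGroup)

  infix 4 _≈Γ_
  _≈Γ_ : Γ → Γ → Set
  g ≈Γ h = element g ≈± element h

  module _ (X : DecSetoid 0ℓ 0ℓ) where
    private
      module X = DecSetoid X

    -- Used twice: for Γ acting on itself, which gives the group ring, and for Γ acting on ℙ¹(ℚ),
    -- which gives the module of divisors.
    module Permutation
      (act : Γ → X.Carrier → X.Carrier)
      (act-cong : ∀ {g h x y} → g ≈Γ h → x X.≈ y → act g x X.≈ act h y)
      (act-∙ : ∀ g h x → act (g ∙Γ h) x X.≈ act g (act h x))
      (act-ε : ∀ x → act εΓ x X.≈ x)
      where
      open FormalEquality X
      open FormalSums X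

      infixr 7 _⊛_
      _⊛_ : ℤ[Γ] → Formal X.Carrier → Formal X.Carrier
      _⊛_ = bilinear act

      act-≈ : ∀ {g h} x → g ≈Γ h → act g x X.≈ act h x
      act-≈ {g} {h} x g≈h = act-cong {g} {h} g≈h X.refl

      act-⁻¹ : ∀ g x → act (g ⁻¹Γ) (act g x) X.≈ x
      act-⁻¹ g x = X.trans (X.sym (act-∙ (g ⁻¹Γ) g x))
        (X.trans (act-≈ {g ⁻¹Γ ∙Γ g} {εΓ} x (∙-inverseˡ (element g))) (act-ε x))

      act-⁻¹ʳ : ∀ g x → act g (act (g ⁻¹Γ) x) X.≈ x
      act-⁻¹ʳ g x = X.trans (X.sym (act-∙ g (g ⁻¹Γ) x))
        (X.trans (act-≈ {g ∙Γ g ⁻¹Γ} {εΓ} x (∙-inverseʳ (element g))) (act-ε x))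

      private
        row : ℤ × Γ → Formal X.Carrier → Formal X.Carrier
        row (k , g) = map (λ { (l , y) → k ℤ.* l , act g y })

        coeff-row : ∀ k g D x → coeff (row (k , g) D) x ≡ k ℤ.* coeff D (act (g ⁻¹Γ) x)
        coeff-row k g []            x = sym (ℤ.*-zeroʳ k)
        coeff-row k g ((l , y) ∷ D) x = trans
          (cong₂ ℤ._+_ (trans (cong (if_then k ℤ.* l else 0ℤ) same) (head (does (y X.≟ act (g ⁻¹Γ) x)))) (coeff-row k g D x))
          (sym (ℤ.*-distribˡ-+ k _ (coeff D (act (g ⁻¹Γ) x))))
          where
          head : ∀ b → (if b then k ℤ.* l else 0ℤ) ≡ k ℤ.* (if b then l else 0ℤ)
          head true  = refl
          head false = sym (ℤ.*-zeroʳ k)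
          same : does (act g y X.≟ x) ≡ does (y X.≟ act (g ⁻¹Γ) x)
          same = does-cong
            (λ gy≈x → X.trans (X.sym (act-⁻¹ g y)) (act-cong {g ⁻¹Γ} {g ⁻¹Γ} (ΓS.refl {g ⁻¹Γ}) gy≈x))
            (λ y≈g⁻¹x → X.trans (act-cong {g} {g} (ΓS.refl {g}) y≈g⁻¹x) (act-⁻¹ʳ g x))

      -- The coefficient of `c ⊛ D` at x as a linear function of c, because g D has at x the
      -- coefficient of D at the preimage of x under g. Invariance under equality in the group ring
      -- is then an instance of `extend-cong`.
      module Evaluation (D : Formal X.Carrier) (x : X.Carrier) =
        LinearExtension Γ-decSetoid ℤ.+-0-abelianGroup ℤ._*_ (λ k → cong (k ℤ.*_)) (λ k l m → ℤ.*-distribʳ-+ m k l)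
          (λ g → coeff D (act (g ⁻¹Γ) x))
          (λ {g} {h} g≈h → coeff-cong D (act-≈ {g ⁻¹Γ} {h ⁻¹Γ} x (⁻¹-cong {element g} {element h} g≈h)))

      coeff-⊛ : ∀ c D x → coeff (c ⊛ D) x ≡ Evaluation.extend D x c
      coeff-⊛ []            D x = refl
      coeff-⊛ ((k , g) ∷ c) D x = trans (coeff-++ (row (k , g) D) (c ⊛ D) x)
        (cong₂ ℤ._+_ (coeff-row k g D x) (coeff-⊛ c D x))

      extend-pointwise : ∀ {D E} → D ≋ E → ∀ x c → Evaluation.extend D x c ≡ Evaluation.extend E x c
      extend-pointwise         D≋E x []            = refl
      extend-pointwise {D} {E} D≋E x ((k , g) ∷ c) =
        cong₂ (λ i j → k ℤ.* i ℤ.+ j) (D≋E (act (g ⁻¹Γ) x)) (extend-pointwise {D} {E} D≋E x c)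

      ⊛-cong : ∀ {c d D E} → c ≋Γ d → D ≋ E → c ⊛ D ≋ d ⊛ E
      ⊛-cong {c} {d} {D} {E} c≋d D≋E x = trans (coeff-⊛ c D x)
        (trans (Evaluation.extend-cong D x {c} {d} c≋d)
          (trans (extend-pointwise {D} {E} D≋E x d) (sym (coeff-⊛ d E x))))

      ⊛-distribʳ : ∀ D c d → (c ++ d) ⊛ D ≋ (c ⊛ D) ++ (d ⊛ D)
      ⊛-distribʳ D c d x = trans (coeff-⊛ (c ++ d) D x) (trans (Evaluation.extend-++ D x c d)
        (sym (trans (coeff-++ (c ⊛ D) (d ⊛ D) x) (cong₂ ℤ._+_ (coeff-⊛ c D x) (coeff-⊛ d D x)))))

      ⊛-distribˡ : ∀ c D E → c ⊛ (D ++ E) ≋ (c ⊛ D) ++ (c ⊛ E)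
      ⊛-distribˡ c D E x = trans (coeff-⊛ c (D ++ E) x) (trans (split c)
        (sym (trans (coeff-++ (c ⊛ D) (c ⊛ E) x) (cong₂ ℤ._+_ (coeff-⊛ c D x) (coeff-⊛ c E x)))))
        where
        identity : ∀ k a b u v → k ℤ.* (a ℤ.+ b) ℤ.+ (u ℤ.+ v) ≡ (k ℤ.* a ℤ.+ u) ℤ.+ (k ℤ.* b ℤ.+ v)
        identity = solve-∀
        split : ∀ c → Evaluation.extend (D ++ E) x c ≡ Evaluation.extend D x c ℤ.+ Evaluation.extend E x c
        split []            = refl
        split ((k , g) ∷ c) = trans (cong₂ (λ i j → k ℤ.* i ℤ.+ j) (coeff-++ D E _) (split c))
          (identity k (coeff D _) (coeff E _) (Evaluation.extend D x c) (Evaluation.extend E x c))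

      ⊛-zeroʳ : ∀ c → c ⊛ [] ≋ []
      ⊛-zeroʳ c x = trans (coeff-⊛ c [] x) (zeros c)
        where
        zeros : ∀ c → Evaluation.extend [] x c ≡ 0ℤ
        zeros []            = refl
        zeros ((k , g) ∷ c) = cong₂ ℤ._+_ (ℤ.*-zeroʳ k) (zeros c)

      ⊛-assoc : ∀ c d D → (c *Γ d) ⊛ D ≋ c ⊛ (d ⊛ D)
      ⊛-assoc []            d D x = refl
      ⊛-assoc ((k , g) ∷ c) d D x = begin
        coeff ((rowΓ d ++ (c *Γ d)) ⊛ D) x                              ≡⟨ ⊛-distribʳ D (rowΓ d) (c *Γ d) x ⟩
        coeff ((rowΓ d ⊛ D) ++ ((c *Γ d) ⊛ D)) x                        ≡⟨ coeff-++ (rowΓ d ⊛ D) ((c *Γ d) ⊛ D) x ⟩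
        coeff (rowΓ d ⊛ D) x ℤ.+ coeff ((c *Γ d) ⊛ D) x                 ≡⟨ cong₂ ℤ._+_ first (⊛-assoc c d D x) ⟩
        coeff (row (k , g) (d ⊛ D)) x ℤ.+ coeff (c ⊛ (d ⊛ D)) x         ≡⟨ coeff-++ (row (k , g) (d ⊛ D)) (c ⊛ (d ⊛ D)) x ⟨
        coeff (((k , g) ∷ c) ⊛ (d ⊛ D)) x ∎
        where
        open ≡-Reasoning
        rowΓ : ℤ[Γ] → ℤ[Γ]
        rowΓ = map (λ { (l , h) → k ℤ.* l , g ∙Γ h })
        shift : ∀ d → Evaluation.extend D x (rowΓ d) ≡ k ℤ.* Evaluation.extend D (act (g ⁻¹Γ) x) d
        shift []            = sym (ℤ.*-zeroʳ k)
        shift ((l , h) ∷ d) = trans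
          (cong₂ (λ i j → k ℤ.* l ℤ.* i ℤ.+ j)
            (coeff-cong D (X.trans (act-≈ {(g ∙Γ h) ⁻¹Γ} {h ⁻¹Γ ∙Γ g ⁻¹Γ} x (⁻¹-anti-homo-∙ (element g) (element h))) (act-∙ (h ⁻¹Γ) (g ⁻¹Γ) x)))
            (shift d))
          (identity k l (coeff D (act (h ⁻¹Γ) (act (g ⁻¹Γ) x))) (Evaluation.extend D (act (g ⁻¹Γ) x) d))
          where
          identity : ∀ k l i j → k ℤ.* l ℤ.* i ℤ.+ k ℤ.* j ≡ k ℤ.* (l ℤ.* i ℤ.+ j)
          identity = solve-∀
        first : coeff (rowΓ d ⊛ D) x ≡ coeff (row (k , g) (d ⊛ D)) x
        first = trans (coeff-⊛ (rowΓ d) D x) (trans (shift d)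
          (trans (cong (k ℤ.*_) (sym (coeff-⊛ d D (act (g ⁻¹Γ) x)))) (sym (coeff-row k g (d ⊛ D) x))))

      ⊛-identityˡ : ∀ D → 1Γ ⊛ D ≋ D
      ⊛-identityˡ D x = trans (coeff-⊛ 1Γ D x) (trans (ℤ.+-identityʳ _) (trans (ℤ.*-identityˡ _)
        (coeff-cong D (X.trans (act-≈ {εΓ ⁻¹Γ} {εΓ} x (inj₁ refl)) (act-ε x)))))

  private
    module Regular = Permutation Γ-decSetoid _∙Γ_
      (λ {g} {h} {x} {y} → ∙-cong {element g} {element h} {element x} {element y})
      (λ g h x → ∙-assoc (element g) (element h) (element x))
      (λ x → ∙-identityˡ (element x))

  *Γ-identityʳ : ∀ c → c *Γ 1Γ ≋Γ c
  *Γ-identityʳ []            x = refl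
  *Γ-identityʳ ((k , g) ∷ c) x = cong₂ ℤ._+_
    (cong₂ (λ b l → if b then l else 0ℤ)
      (does-cong {g ∙Γ εΓ} {x} {g} {x} (ΓS.trans {g} {g ∙Γ εΓ} {x} (ΓS.sym {g ∙Γ εΓ} {g} g∙ε≈g)) (ΓS.trans {g ∙Γ εΓ} {g} {x} g∙ε≈g))
      (ℤ.*-identityʳ k))
    (*Γ-identityʳ c x)
    where
    open FormalSums Γ-decSetoid using (does-cong)
    g∙ε≈g : g ∙Γ εΓ ≈Γ g
    g∙ε≈g = ∙-identityʳ (element g)

  isRing : IsRing _≋Γ_ _++_ _*Γ_ negate [] 1Γ
  isRing = record
    { +-isAbelianGroup = ≋Γ-isAbelianGroup
    ; *-cong           = λ {c} {d} {D} {E} → Regular.⊛-cong {c} {d} {D} {E}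
    ; *-assoc          = Regular.⊛-assoc
    ; *-identity       = Regular.⊛-identityˡ , *Γ-identityʳ
    ; distrib          = Regular.⊛-distribˡ , Regular.⊛-distribʳ
    }

  ring : Ring 0ℓ 0ℓ
  ring = record { isRing = isRing }

  divisorModule : LeftModule ring 0ℓ 0ℓ
  divisorModule = record
    { _≈ᴹ_ = Div._≋_ ; _+ᴹ_ = _++_ ; _*ₗ_ = _⊛_ ; 0ᴹ = [] ; -ᴹ_ = negate
    ; isLeftModule = record
      { isLeftSemimodule = record
        { +ᴹ-isCommutativeMonoid = IsAbelianGroup.isCommutativeMonoid ++-negate-isAbelianGroup
        ; isPreleftSemimodule = record
          { *ₗ-cong      = λ {c} {d} {D} {E} → ⊛-cong {c} {d} {D} {E}
          ; *ₗ-zeroˡ     = λ D x → refl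
          ; *ₗ-distribʳ  = ⊛-distribʳ
          ; *ₗ-identityˡ = ⊛-identityˡ
          ; *ₗ-assoc     = ⊛-assoc
          ; *ₗ-zeroʳ     = ⊛-zeroʳ
          ; *ₗ-distribˡ  = ⊛-distribˡ
          }
        }
      ; -ᴹ‿cong    = λ {D} {E} → IsAbelianGroup.⁻¹-cong ++-negate-isAbelianGroup {D} {E}
      ; -ᴹ‿inverse = IsAbelianGroup.inverse ++-negate-isAbelianGroup
      }
    }
    where
    open FormalSums (≡.decSetoid _≟ℙ_)
    open Permutation (≡.decSetoid _≟ℙ_) (λ g r → element g • r)
      (λ {g} {h} {r} g≈h r≡s → trans (•-cong {element g} {element h} g≈h r) (cong (element h •_) r≡s))
      (λ g h r → ∙-• (element g) (element h) r)
      ε-•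

  -- Equality in `Δ₀` ignores the degree proofs, so each law is the one for divisors.
  Δ₀-module : LeftModule ring 0ℓ 0ℓ
  Δ₀-module = record
    { _≈ᴹ_ = _≈ᴹ_ Δ₀ ; _+ᴹ_ = _+₀_ ; _*ₗ_ = _•₀_ ; 0ᴹ = 0₀ ; -ᴹ_ = -₀_
    ; isLeftModule = record
      { isLeftSemimodule = record
        { +ᴹ-isCommutativeMonoid = record
          { isMonoid = record
            { isSemigroup = record
              { isMagma = record
                { isEquivalence = record
                  { refl  = λ _ → refl
                  ; sym   = λ p x → sym (p x)
                  ; trans = λ p q x → trans (p x) (q x)
                  }
                ; ∙-cong = λ {D} {D′} {E} {E′} → M.+ᴹ-cong {divisor D} {divisor D′} {divisor E} {divisor E′}
                }
              ; assoc = λ C D E → M.+ᴹ-assoc (divisor C) (divisor D) (divisor E)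
              }
            ; identity = (λ D → M.+ᴹ-identityˡ (divisor D)) , (λ D → M.+ᴹ-identityʳ (divisor D))
            }
          ; comm = λ D E → M.+ᴹ-comm (divisor D) (divisor E)
          }
        ; isPreleftSemimodule = record
          { *ₗ-cong      = λ {c} {d} {D} {E} → M.*ₗ-cong {c} {d} {divisor D} {divisor E}
          ; *ₗ-zeroˡ     = λ D x → refl
          ; *ₗ-distribʳ  = λ D → M.*ₗ-distribʳ (divisor D)
          ; *ₗ-identityˡ = λ D → M.*ₗ-identityˡ (divisor D)
          ; *ₗ-assoc     = λ c d D → M.*ₗ-assoc c d (divisor D)
          ; *ₗ-zeroʳ     = M.*ₗ-zeroʳ
          ; *ₗ-distribˡ  = λ c D E → M.*ₗ-distribˡ c (divisor D) (divisor E)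
          }
        }
      ; -ᴹ‿cong    = λ {D} {E} → M.-ᴹ‿cong {divisor D} {divisor E}
      ; -ᴹ‿inverse = (λ D → M.-ᴹ‿inverseˡ (divisor D)) , (λ D → M.-ᴹ‿inverseʳ (divisor D))
      }
    }
    where
    open RawLeftModule using (_≈ᴹ_)
    module M = LeftModule divisorModule

  freeModule : ℕ → LeftModule ring 0ℓ 0ℓ
  freeModule m = record
    { _≈ᴹ_ = _≈ᴹ_ ; _+ᴹ_ = _+ᴹ_ ; _*ₗ_ = _*ₗ_ ; 0ᴹ = 0ᴹ ; -ᴹ_ = -ᴹ_
    ; isLeftModule = record
      { isLeftSemimodule = record
        { +ᴹ-isCommutativeMonoid = record
          { isMonoid = record
            { isSemigroup = record
              { isMagma = record
                { isEquivalence = record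
                  { refl  = λ j x → refl
                  ; sym   = λ p j x → sym (p j x)
                  ; trans = λ p q j x → trans (p j x) (q j x)
                  }
                ; ∙-cong = λ {t} {u} {v} {w} p q j → R.+-cong {t j} {u j} {v j} {w j} (p j) (q j)
                }
              ; assoc = λ u v w j → R.+-assoc (u j) (v j) (w j)
              }
            ; identity = (λ v j → R.+-identityˡ (v j)) , (λ v j → R.+-identityʳ (v j))
            }
          ; comm = λ u v j → R.+-comm (u j) (v j)
          }
        ; isPreleftSemimodule = record
          { *ₗ-cong      = λ {c} {d} {u} {v} p q j → R.*-cong {c} {d} {u j} {v j} p (q j)
          ; *ₗ-zeroˡ     = λ v j → R.zeroˡ (v j)
          ; *ₗ-distribʳ  = λ v c d j → R.distribʳ (v j) c d
          ; *ₗ-identityˡ = λ v j → R.*-identityˡ (v j)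
          ; *ₗ-assoc     = λ c d v j → R.*-assoc c d (v j)
          ; *ₗ-zeroʳ     = λ c j → R.zeroʳ c
          ; *ₗ-distribˡ  = λ c u v j → R.distribˡ c (u j) (v j)
          }
        }
      ; -ᴹ‿cong    = λ {u} {v} p j → R.-‿cong {u j} {v j} (p j)
      ; -ᴹ‿inverse = (λ v j → R.-‿inverseˡ (v j)) , (λ v j → R.-‿inverseʳ (v j))
      }
    }
    where
    open RawLeftModule (FreeModule m)
    module R = Ring ring

-- Calculation in modules, quotient modules and partial sums

module LeftModuleProperties {R : Ring 0ℓ 0ℓ} (N : LeftModule R 0ℓ 0ℓ) where
  open Ring R using (_≈_; -_; 1#; 0#; -‿inverseˡ) renaming (refl to ≈-refl)
  open LeftModule N
  open AbelianGroupProperties +ᴹ-abelianGroup public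
    renaming (⁻¹-∙-comm to -ᴹ-+ᴹ-comm; ⁻¹-involutive to -ᴹ-involutive; x∙y⁻¹≈ε⇒x≈y to x-y≈0⇒x≈y)
    using (inverseˡ-unique; inverseʳ-unique)
  open CommutativeSemigroupProperties (AbelianGroup.commutativeSemigroup +ᴹ-abelianGroup) public
    using (interchange; x∙yz≈y∙xz; xy∙z≈xz∙y)
  open import Relation.Binary.Reasoning.Setoid ≈ᴹ-setoid

  infixl 6 _-ᴹ_
  _-ᴹ_ : Carrierᴹ → Carrierᴹ → Carrierᴹ
  u -ᴹ v = u +ᴹ (-ᴹ v)

  -ᴹ‿*ₗ : ∀ c u → (- c) *ₗ u ≈ᴹ -ᴹ (c *ₗ u)
  -ᴹ‿*ₗ c u = inverseˡ-unique _ _ (begin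
    (- c) *ₗ u +ᴹ c *ₗ u     ≈⟨ *ₗ-distribʳ u (- c) c ⟨
    (Ring._+_ R (- c) c) *ₗ u ≈⟨ *ₗ-cong (-‿inverseˡ c) ≈ᴹ-refl ⟩
    0# *ₗ u                  ≈⟨ *ₗ-zeroˡ u ⟩
    0ᴹ ∎)

  *ₗ‿-ᴹ : ∀ c u → c *ₗ (-ᴹ u) ≈ᴹ -ᴹ (c *ₗ u)
  *ₗ‿-ᴹ c u = inverseˡ-unique _ _ (begin
    c *ₗ (-ᴹ u) +ᴹ c *ₗ u     ≈⟨ *ₗ-distribˡ c (-ᴹ u) u ⟨
    c *ₗ (-ᴹ u +ᴹ u)          ≈⟨ *ₗ-cong ≈-refl (-ᴹ‿inverseˡ u) ⟩
    c *ₗ 0ᴹ                   ≈⟨ *ₗ-zeroʳ c ⟩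
    0ᴹ ∎)

  *ₗ-distribˡ-- : ∀ c u v → c *ₗ (u -ᴹ v) ≈ᴹ c *ₗ u -ᴹ c *ₗ v
  *ₗ-distribˡ-- c u v = ≈ᴹ-trans (*ₗ-distribˡ c u (-ᴹ v)) (+ᴹ-congˡ (*ₗ‿-ᴹ c v))

  y+[x-y]≈x : ∀ x y → y +ᴹ (x -ᴹ y) ≈ᴹ x
  y+[x-y]≈x x y = begin
    y +ᴹ (x -ᴹ y)   ≈⟨ x∙yz≈y∙xz y x (-ᴹ y) ⟩
    x +ᴹ (y -ᴹ y)   ≈⟨ +ᴹ-congˡ (-ᴹ‿inverseʳ y) ⟩
    x +ᴹ 0ᴹ         ≈⟨ +ᴹ-identityʳ x ⟩
    x ∎

  [x-y]+y≈x : ∀ x y → (x -ᴹ y) +ᴹ y ≈ᴹ x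
  [x-y]+y≈x x y = ≈ᴹ-trans (+ᴹ-comm (x -ᴹ y) y) (y+[x-y]≈x x y)

  [x+y]-y≈x : ∀ x y → (x +ᴹ y) -ᴹ y ≈ᴹ x
  [x+y]-y≈x x y = begin
    (x +ᴹ y) -ᴹ y   ≈⟨ +ᴹ-assoc x y (-ᴹ y) ⟩
    x +ᴹ (y -ᴹ y)   ≈⟨ +ᴹ-congˡ (-ᴹ‿inverseʳ y) ⟩
    x +ᴹ 0ᴹ         ≈⟨ +ᴹ-identityʳ x ⟩
    x ∎

  x+[y-[x+z]]≈y-z : ∀ x y z → x +ᴹ (y -ᴹ (x +ᴹ z)) ≈ᴹ y -ᴹ z
  x+[y-[x+z]]≈y-z x y z = begin
    x +ᴹ (y -ᴹ (x +ᴹ z))               ≈⟨ x∙yz≈y∙xz x y _ ⟩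
    y +ᴹ (x -ᴹ (x +ᴹ z))               ≈⟨ +ᴹ-congˡ (+ᴹ-congˡ (-ᴹ-+ᴹ-comm x z)) ⟨
    y +ᴹ (x +ᴹ (-ᴹ x +ᴹ (-ᴹ z)))       ≈⟨ +ᴹ-congˡ (+ᴹ-assoc x (-ᴹ x) (-ᴹ z)) ⟨
    y +ᴹ ((x -ᴹ x) +ᴹ (-ᴹ z))          ≈⟨ +ᴹ-congˡ (+ᴹ-congʳ (-ᴹ‿inverseʳ x)) ⟩
    y +ᴹ (0ᴹ +ᴹ (-ᴹ z))                ≈⟨ +ᴹ-congˡ (+ᴹ-identityˡ (-ᴹ z)) ⟩
    y -ᴹ z ∎

  -ᴹ-cong₂ : ∀ {u u′ v v′} → u ≈ᴹ u′ → v ≈ᴹ v′ → u -ᴹ v ≈ᴹ u′ -ᴹ v′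
  -ᴹ-cong₂ u≈u′ v≈v′ = +ᴹ-cong u≈u′ (-ᴹ‿cong v≈v′)

  -ᴹ-telescope : ∀ u v w → (u -ᴹ v) +ᴹ (v -ᴹ w) ≈ᴹ u -ᴹ w
  -ᴹ-telescope u v w = ≈ᴹ-trans (≈ᴹ-sym (+ᴹ-assoc (u -ᴹ v) v (-ᴹ w))) (+ᴹ-congʳ ([x-y]+y≈x u v))

  -ᴹ-interchange : ∀ u v u′ v′ → (u -ᴹ u′) +ᴹ (v -ᴹ v′) ≈ᴹ (u +ᴹ v) -ᴹ (u′ +ᴹ v′)
  -ᴹ-interchange u v u′ v′ = ≈ᴹ-trans (interchange u (-ᴹ u′) v (-ᴹ v′)) (+ᴹ-congˡ (-ᴹ-+ᴹ-comm u′ v′))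

  -ᴹ-swap : ∀ u v → -ᴹ (u -ᴹ v) ≈ᴹ v -ᴹ u
  -ᴹ-swap u v = begin
    -ᴹ (u -ᴹ v)               ≈⟨ -ᴹ-+ᴹ-comm u (-ᴹ v) ⟨
    -ᴹ u +ᴹ (-ᴹ (-ᴹ v))       ≈⟨ +ᴹ-congˡ (-ᴹ-involutive v) ⟩
    -ᴹ u +ᴹ v                 ≈⟨ +ᴹ-comm (-ᴹ u) v ⟩
    v -ᴹ u ∎

  x≈y⇒x-y≈0 : ∀ {x y} → x ≈ᴹ y → x -ᴹ y ≈ᴹ 0ᴹ
  x≈y⇒x-y≈0 {x} {y} x≈y = ≈ᴹ-trans (+ᴹ-congʳ x≈y) (-ᴹ‿inverseʳ y)

  module _ {I : Set} (x : I → Carrierᴹ) where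
    private
      Sp : Carrierᴹ → Set
      Sp = Span rawLeftModule x

      infix 4 _~_
      _~_ : Carrierᴹ → Carrierᴹ → Set
      u ~ v = Sp (u -ᴹ v)

      span-neg : ∀ {u} → Sp u → Sp (-ᴹ u)
      span-neg {u} s = span-resp (≈ᴹ-trans (-ᴹ‿*ₗ 1# u) (-ᴹ‿cong (*ₗ-identityˡ u))) (span-* (- 1#) s)

      ≈⇒~ : ∀ {u v} → u ≈ᴹ v → u ~ v
      ≈⇒~ u≈v = span-resp (≈ᴹ-sym (x≈y⇒x-y≈0 u≈v)) span-0

      ~-sym : ∀ {u v} → u ~ v → v ~ u
      ~-sym {u} {v} s = span-resp (-ᴹ-swap u v) (span-neg s)

      ~-trans : ∀ {u v w} → u ~ v → v ~ w → u ~ w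
      ~-trans {u} {v} {w} s t = span-resp (-ᴹ-telescope u v w) (span-+ s t)

      ~-+-cong : ∀ {u u′ v v′} → u ~ u′ → v ~ v′ → (u +ᴹ v) ~ (u′ +ᴹ v′)
      ~-+-cong {u} {u′} {v} {v′} s t = span-resp (-ᴹ-interchange u v u′ v′) (span-+ s t)

      ~-neg-cong : ∀ {u v} → u ~ v → (-ᴹ u) ~ (-ᴹ v)
      ~-neg-cong {u} {v} s = span-resp (≈ᴹ-sym (-ᴹ-+ᴹ-comm u (-ᴹ v))) (span-neg s)

      ~-*-cong : ∀ {c d u v} → c ≈ d → u ~ v → (c *ₗ u) ~ (d *ₗ v)
      ~-*-cong {c} {d} {u} {v} c≈d s =
        span-resp (≈ᴹ-trans (*ₗ-distribˡ-- c u v) (+ᴹ-congˡ (-ᴹ‿cong (*ₗ-cong c≈d ≈ᴹ-refl)))) (span-* c s)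

    quotientModule : LeftModule R 0ℓ 0ℓ
    quotientModule = record
      { _≈ᴹ_ = _~_ ; _+ᴹ_ = _+ᴹ_ ; _*ₗ_ = _*ₗ_ ; 0ᴹ = 0ᴹ ; -ᴹ_ = -ᴹ_
      ; isLeftModule = record
        { isLeftSemimodule = record
          { +ᴹ-isCommutativeMonoid = record
            { isMonoid = record
              { isSemigroup = record
                { isMagma = record
                  { isEquivalence = record { refl = ≈⇒~ ≈ᴹ-refl ; sym = ~-sym ; trans = ~-trans }
                  ; ∙-cong = ~-+-cong
                  }
                ; assoc = λ u v w → ≈⇒~ (+ᴹ-assoc u v w)
                }
              ; identity = (λ u → ≈⇒~ (+ᴹ-identityˡ u)) , (λ u → ≈⇒~ (+ᴹ-identityʳ u))
              }
            ; comm = λ u v → ≈⇒~ (+ᴹ-comm u v)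
            }
          ; isPreleftSemimodule = record
            { *ₗ-cong      = ~-*-cong
            ; *ₗ-zeroˡ     = λ u → ≈⇒~ (*ₗ-zeroˡ u)
            ; *ₗ-distribʳ  = λ u c d → ≈⇒~ (*ₗ-distribʳ u c d)
            ; *ₗ-identityˡ = λ u → ≈⇒~ (*ₗ-identityˡ u)
            ; *ₗ-assoc     = λ c d u → ≈⇒~ (*ₗ-assoc c d u)
            ; *ₗ-zeroʳ     = λ c → ≈⇒~ (*ₗ-zeroʳ c)
            ; *ₗ-distribˡ  = λ c u v → ≈⇒~ (*ₗ-distribˡ c u v)
            }
          }
        ; -ᴹ‿cong    = ~-neg-cong
        ; -ᴹ‿inverse = (λ u → ≈⇒~ (-ᴹ‿inverseˡ u)) , (λ u → ≈⇒~ (-ᴹ‿inverseʳ u))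
        }
      }

    quotient-≈ : ∀ {u v} → u ≈ᴹ v → LeftModule._≈ᴹ_ quotientModule u v
    quotient-≈ = ≈⇒~

  sum : List Carrierᴹ → Carrierᴹ
  sum = foldr _+ᴹ_ 0ᴹ

  partialSum : ∀ {m} → (Fin m → Carrierᴹ) → Fin (suc m) → Carrierᴹ
  partialSum         f zero    = 0ᴹ
  partialSum {suc m} f (suc k) = f zero +ᴹ partialSum (f ∘ suc) k

  -- The definition peels off the first summand, whereas a walk along the boundary appends the last
  -- one.
  partialSum-suc : ∀ {m} (f : Fin m → Carrierᴹ) k → partialSum f (suc k) ≈ᴹ partialSum f (inject₁ k) +ᴹ f k
  partialSum-suc f zero    = +ᴹ-comm (f zero) 0ᴹ
  partialSum-suc f (suc k) = ≈ᴹ-trans (+ᴹ-congˡ (partialSum-suc (f ∘ suc) k)) (≈ᴹ-sym (+ᴹ-assoc (f zero) _ _))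

  partialSum-total : ∀ {m} (f : Fin m → Carrierᴹ) → partialSum f (fromℕ m) ≡ sum (tabulate f)
  partialSum-total {zero}  f = refl
  partialSum-total {suc m} f = cong (f zero +ᴹ_) (partialSum-total (f ∘ suc))

-- The cocycle attached to the tessellation

module GroupAction (F : ExtendedFareySymbol) (N : LeftModule (GroupRingProperties.ring F) 0ℓ 0ℓ) where
  open ExtendedFareySymbol F
  open GroupRing F
  open GroupRingProperties F
  open LeftModule N
  open LeftModuleProperties N
  open import Relation.Binary.Reasoning.Setoid ≈ᴹ-setoid

  infixr 7 _▸_
  _▸_ : Γ → Carrierᴹ → Carrierᴹ
  g ▸ m = ((1ℤ , g) ∷ []) *ₗ m

  ▸-cong : ∀ g {m m′} → m ≈ᴹ m′ → g ▸ m ≈ᴹ g ▸ m′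
  ▸-cong g = *ₗ-cong {(1ℤ , g) ∷ []} (λ _ → refl)

  ▸-≈Γ : ∀ {g h} → g ≈Γ h → ∀ m → g ▸ m ≈ᴹ h ▸ m
  ▸-≈Γ {g} {h} g≈h m = *ₗ-cong {(1ℤ , g) ∷ []} {(1ℤ , h) ∷ []}
    (λ x → cong (λ b → (if b then 1ℤ else 0ℤ) ℤ.+ 0ℤ)
      (does-cong {g} {x} {h} {x} (ΓS.trans {h} {g} {x} (ΓS.sym {g} {h} g≈h)) (ΓS.trans {g} {h} {x} g≈h)))
    ≈ᴹ-refl
    where open FormalSums Γ-decSetoid using (does-cong)

  ▸-+ : ∀ g u v → g ▸ (u +ᴹ v) ≈ᴹ g ▸ u +ᴹ g ▸ v
  ▸-+ g = *ₗ-distribˡ ((1ℤ , g) ∷ [])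

  ▸-neg : ∀ g u → g ▸ (-ᴹ u) ≈ᴹ -ᴹ (g ▸ u)
  ▸-neg g = *ₗ‿-ᴹ ((1ℤ , g) ∷ [])

  ▸-- : ∀ g u v → g ▸ (u -ᴹ v) ≈ᴹ g ▸ u -ᴹ g ▸ v
  ▸-- g = *ₗ-distribˡ-- ((1ℤ , g) ∷ [])

  ▸-∙ : ∀ g h m → (g ∙Γ h) ▸ m ≈ᴹ g ▸ h ▸ m
  ▸-∙ g h = *ₗ-assoc ((1ℤ , g) ∷ []) ((1ℤ , h) ∷ [])

  ▸-ε : ∀ m → εΓ ▸ m ≈ᴹ m
  ▸-ε = *ₗ-identityˡ

  ▸-inverse : ∀ {g h} → g ∙Γ h ≈Γ εΓ → ∀ m → g ▸ h ▸ m ≈ᴹ m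
  ▸-inverse {g} {h} gh≈ε m = ≈ᴹ-trans (≈ᴹ-sym (▸-∙ g h m)) (≈ᴹ-trans (▸-≈Γ {g ∙Γ h} {εΓ} gh≈ε m) (▸-ε m))

  ▸-∷ : ∀ g c m → ((1ℤ , g) ∷ c) *ₗ m ≈ᴹ g ▸ m +ᴹ c *ₗ m
  ▸-∷ g c m = *ₗ-distribʳ m ((1ℤ , g) ∷ []) c

  ▸-^1 : ∀ g m → (g ^Γ 1) ▸ m ≈ᴹ g ▸ m
  ▸-^1 g m = ≈ᴹ-trans (▸-∙ g (g ^Γ 0) m) (▸-cong g (▸-ε m))

  ▸-^2 : ∀ g m → (g ^Γ 2) ▸ m ≈ᴹ g ▸ g ▸ m
  ▸-^2 g m = ≈ᴹ-trans (▸-∙ g (g ^Γ 1) m) (▸-cong g (▸-^1 g m))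

  -- Abstract, since conversion would otherwise unfold the determinant proofs
  -- carried by the elements of Γ.
  abstract
    1-_ : Γ → ℤ[Γ]
    1- g = 1Γ ++ negate ((1ℤ , g) ∷ [])

    1-‿≡ : ∀ g → 1Γ ++ negate ((1ℤ , g) ∷ []) ≡ 1- g
    1-‿≡ g = refl

    1-‿*ₗ : ∀ g m → (1- g) *ₗ m ≈ᴹ m -ᴹ g ▸ m
    1-‿*ₗ g m = ≈ᴹ-trans (▸-∷ εΓ _ m) (+ᴹ-cong (▸-ε m) (-ᴹ‿*ₗ ((1ℤ , g) ∷ []) m))

    powerSum : Γ → ℕ → ℤ[Γ]
    powerSum g = applyUpTo (λ s → 1ℤ , g ^Γ s)

    powerSum-≡ : ∀ g k → applyUpTo (λ s → 1ℤ , g ^Γ s) k ≡ powerSum g k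
    powerSum-≡ g k = refl

    powerSum-2 : ∀ g m → powerSum g 2 *ₗ m ≈ᴹ m +ᴹ g ▸ m
    powerSum-2 g m = ≈ᴹ-trans (▸-∷ (g ^Γ 0) _ m) (+ᴹ-cong (▸-ε m) (▸-^1 g m))

    powerSum-3 : ∀ g m → powerSum g 3 *ₗ m ≈ᴹ m +ᴹ (g ▸ m +ᴹ g ▸ g ▸ m)
    powerSum-3 g m = ≈ᴹ-trans (▸-∷ (g ^Γ 0) _ m)
      (+ᴹ-cong (▸-ε m) (≈ᴹ-trans (▸-∷ (g ^Γ 1) _ m) (+ᴹ-cong (▸-^1 g m) (▸-^2 g m))))

module _ (F : ExtendedFareySymbol) (N : LeftModule (GroupRingProperties.ring F) 0ℓ 0ℓ) where
  open ExtendedFareySymbol F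
  open Polygon sidePairing
  open Tessellation F
  open GroupRingProperties F
  open LeftModule N
  open LeftModuleProperties N
  open GroupAction F N
  open import Relation.Binary.Reasoning.Setoid ≈ᴹ-setoid

  -- The hypotheses are the relations of the presentation, restated for all sides of the polygon so
  -- that the choice of E disappears.
  module Cocycle
    (side : Fin n → Carrierᴹ)
    (side-paired  : ∀ {i} → ¬ Rotation i → side i +ᴹ γΓ i ▸ side (i *) ≈ᴹ 0ᴹ)
    (side-rotated : ∀ {i} → Rotation i → side i +ᴹ (γΓ i ▸ side i +ᴹ γΓ i ▸ γΓ i ▸ side i) ≈ᴹ 0ᴹ)
    (side-closed  : sum (tabulate side) ≈ᴹ 0ᴹ)
    where

    -- The intended value of ψ at vertex k, normalised to be 0 at vertex 0.
    ρ : Fin n → Carrierᴹ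
    ρ k = partialSum side (inject₁ k)

    ρ-next : ∀ k → ρ (next k) ≈ᴹ ρ k +ᴹ side k
    ρ-next k with view k
    ... | ‵inject₁ i rewrite next-inject₁ i = partialSum-suc side (inject₁ i)
    ... | ‵fromℕ     rewrite next-last = begin
      0ᴹ                                                           ≈⟨ side-closed ⟨
      sum (tabulate side)                                          ≡⟨ partialSum-total side ⟨
      partialSum side (fromℕ n)                                    ≈⟨ partialSum-suc side (fromℕ (2 ℕ.+ n-3)) ⟩
      ρ (fromℕ (2 ℕ.+ n-3)) +ᴹ side (fromℕ (2 ℕ.+ n-3)) ∎

    -- Forced by equivariance at one end point: `γ i` takes vertex `next (i *)` to vertex i for
    -- every kind of side.
    offset : Fin n → Carrierᴹ
    offset i = ρ i -ᴹ γΓ i ▸ ρ (next (i *))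

    -- The backward case is the translation part of the inverse of the affine map m ↦ γ i m + offset
    -- i.
    letterOffset : Letter → Carrierᴹ
    letterOffset (forward i)  = offset i
    letterOffset (backward i) = -ᴹ (γΓ i ⁻¹Γ ▸ offset i)

    shift : Letter → Carrierᴹ → Carrierᴹ
    shift ℓ m = ⟦ ℓ ⟧ ▸ m +ᴹ letterOffset ℓ

    shift-cong : ∀ ℓ {m m′} → m ≈ᴹ m′ → shift ℓ m ≈ᴹ shift ℓ m′
    shift-cong ℓ m≈m′ = +ᴹ-congʳ (▸-cong ⟦ ℓ ⟧ m≈m′)

    value : ∀ {q} → Reach q → Carrierᴹ
    value (at-vertex k _) = ρ k
    value (cross c r)     = shift (letter c) (value r)

    mutual
      value-unique : ∀ {q} (r r′ : Reach q) → value r ≈ᴹ value r′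
      value-unique (at-vertex k refl) (at-vertex k′ eq)  = ≈ᴹ-reflexive (cong ρ (vertex-injective (sym eq)))
      value-unique (at-vertex k refl) (cross c _)        = ⊥-elim (vertex-not-behind (crossing-behind c))
      value-unique (cross c _)        (at-vertex k refl) = ⊥-elim (vertex-not-behind (crossing-behind c))
      value-unique (cross c r)        (cross c′ r′)      = value-unique-cross (letter-unique c c′) r r′

      -- Generalising the two letters to variables allows matching their equality with `refl`, which
      -- makes the end points of the remaining paths agree.
      value-unique-cross : ∀ {ℓ ℓ′ q} → ℓ ≡ ℓ′ → (r : Reach (pullback ℓ q)) (r′ : Reach (pullback ℓ′ q)) →
                           shift ℓ (value r) ≈ᴹ shift ℓ′ (value r′)
      value-unique-cross {ℓ} refl r r′ = shift-cong ℓ (value-unique r r′)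

    abstract
      -- Abstract, so that conversion never runs `reach`; everything about ψ is derived from its
      -- values at vertices and the crossing rule.
      ψ : ℙ¹ → Carrierᴹ
      ψ q = value (reach q)

      ψ-vertex : ∀ {k q} → q ≡ vertex k → ψ q ≈ᴹ ρ k
      ψ-vertex {k} {q} eq = value-unique (reach q) (at-vertex k (sym eq))

      ψ-cross : ∀ {q} (c : Crossing q) → ψ q ≈ᴹ shift (letter c) (ψ (pullback (letter c) q))
      ψ-cross {q} c = value-unique (reach q) (cross c (reach (pullback (letter c) q)))

    ψ-≡ : ∀ {q q′} → q ≡ q′ → ψ q ≈ᴹ ψ q′
    ψ-≡ eq = ≈ᴹ-reflexive (cong ψ eq)

    Equivariant : Fin n → ℙ¹ → Set
    Equivariant i q = ψ (γ i • q) ≈ᴹ γΓ i ▸ ψ q +ᴹ offset i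

    -- If the descent of `γ i • q` starts by undoing `γ i`, it arrives at q, and equivariance is the
    -- crossing rule itself.
    equivariant-forward : ∀ {i q} (c : Crossing (γ i • q)) → letter c ≡ forward i → Equivariant i q
    equivariant-forward {i} {q} c eq = ≈ᴹ-trans (ψ-cross c)
      (≈ᴹ-trans (≈ᴹ-reflexive (cong (λ ℓ → shift ℓ (ψ (pullback ℓ (γ i • q)))) eq))
                (shift-cong (forward i) (ψ-≡ (⁻¹-•-• (γ i) q))))

    equivariant-end : ∀ {i} → γ i • vertex (next (i *)) ≡ vertex i → Equivariant i (vertex (next (i *)))
    equivariant-end {i} eq = begin
      ψ (γ i • vertex (next (i *)))                      ≈⟨ ψ-vertex eq ⟩
      ρ i                                                ≈⟨ y+[x-y]≈x (ρ i) _ ⟨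
      γΓ i ▸ ρ (next (i *)) +ᴹ offset i                  ≈⟨ +ᴹ-congʳ (▸-cong (γΓ i) (ψ-vertex refl)) ⟨
      γΓ i ▸ ψ (vertex (next (i *))) +ᴹ offset i ∎

    position : ∀ i q → q ≡ vertex i ⊎ q ≡ vertex (next i) ⊎
                       Counterclockwise (vertex i) (vertex (next i)) q ⊎ Behind i q
    position i q = go (q ≟ℙ vertex i) (q ≟ℙ vertex (next i))
      where
      go : Dec (q ≡ vertex i) → Dec (q ≡ vertex (next i)) → _
      go (yes eq) _        = inj₁ eq
      go (no _)   (yes eq) = inj₂ (inj₁ eq)
      go (no ≢₁)  (no ≢₂)  = inj₂ (inj₂ (CCW-connex (side-distinct i) (≢-sym ≢₂) ≢₁))

    module PairedSide {i} (¬rot : ¬ Rotation i) where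
      private
        k = i *
        g = γΓ i

      -- Equivariance at the other end point, since `γ i` takes vertex `i *` to vertex `next i`.
      -- Passing from the end where it holds by definition to this one costs exactly `side-paired`.
      ρ-glued : ρ (next i) ≈ᴹ g ▸ ρ k +ᴹ offset i
      ρ-glued = ≈ᴹ-sym (begin
        g ▸ ρ k +ᴹ (ρ i -ᴹ g ▸ ρ (next k))                  ≈⟨ +ᴹ-congˡ (-ᴹ-cong₂ ≈ᴹ-refl (≈ᴹ-trans (▸-cong g (ρ-next k)) (▸-+ g (ρ k) (side k)))) ⟩
        g ▸ ρ k +ᴹ (ρ i -ᴹ (g ▸ ρ k +ᴹ g ▸ side k))         ≈⟨ x+[y-[x+z]]≈y-z (g ▸ ρ k) (ρ i) (g ▸ side k) ⟩
        ρ i -ᴹ g ▸ side k                                   ≈⟨ +ᴹ-congˡ (inverseˡ-unique (side i) (g ▸ side k) (side-paired ¬rot)) ⟨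
        ρ i +ᴹ side i                                       ≈⟨ ρ-next i ⟨
        ρ (next i) ∎)

      -- The affine maps attached to i and `i *` are mutually inverse: their linear parts are, and
      -- the composite fixes `ρ (next i)`.
      offset-paired : g ▸ offset k +ᴹ offset i ≈ᴹ 0ᴹ
      offset-paired = begin
        g ▸ (ρ k -ᴹ γΓ k ▸ ρ (next (k *))) +ᴹ offset i      ≈⟨ +ᴹ-congʳ (▸-- g (ρ k) _) ⟩
        (g ▸ ρ k -ᴹ g ▸ γΓ k ▸ ρ (next (k *))) +ᴹ offset i  ≈⟨ +ᴹ-congʳ (-ᴹ-cong₂ ≈ᴹ-refl (▸-inverse {g} {γΓ k} (paired-inverse ¬rot) (ρ (next (k *))))) ⟩
        (g ▸ ρ k -ᴹ ρ (next (k *))) +ᴹ offset i             ≡⟨ cong (λ j → (g ▸ ρ k -ᴹ ρ (next j)) +ᴹ offset i) (*-involutive i) ⟩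
        (g ▸ ρ k -ᴹ ρ (next i)) +ᴹ offset i                 ≈⟨ xy∙z≈xz∙y (g ▸ ρ k) (-ᴹ ρ (next i)) (offset i) ⟩
        (g ▸ ρ k +ᴹ offset i) -ᴹ ρ (next i)                 ≈⟨ x≈y⇒x-y≈0 (≈ᴹ-sym ρ-glued) ⟩
        0ᴹ ∎

      γ⁻¹-paired : ∀ q → γ k ⁻¹ • q ≡ γ i • q
      γ⁻¹-paired q = trans (cong (γ k ⁻¹ •_) (sym γkγi)) (⁻¹-•-• (γ k) (γ i • q))
        where
        γkγi : γ k • γ i • q ≡ q
        γkγi = trans (sym (∙-• (γ k) (γ i) q)) (trans (•-cong {γ k ∙ γ i} {ε}
          (subst (λ j → γ k ∙ γ j ≈± ε) (*-involutive i) (paired-inverse (*-¬rotation ¬rot))) q) (ε-• q))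

      equivariant : ∀ q → Equivariant i q
      equivariant q = go (position k q)
        where
        go : q ≡ vertex k ⊎ q ≡ vertex (next k) ⊎ Counterclockwise (vertex k) (vertex (next k)) q ⊎ Behind k q → Equivariant i q
        go (inj₁ eq) = begin
          ψ (γ i • q)                 ≈⟨ ψ-vertex (trans (cong (γ i •_) eq) (Paired.start-to-end ¬rot)) ⟩
          ρ (next i)                  ≈⟨ ρ-glued ⟩
          g ▸ ρ k +ᴹ offset i         ≈⟨ +ᴹ-congʳ (▸-cong g (ψ-vertex eq)) ⟨
          g ▸ ψ q +ᴹ offset i ∎
        go (inj₂ (inj₁ eq)) = subst (Equivariant i) (sym eq) (equivariant-end (Paired.end-to-start ¬rot))
        -- Gluing exchanges the two sides of an arc: what is in front of side `i *` goes behind side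
        -- i.
        go (inj₂ (inj₂ (inj₁ front))) = equivariant-forward (across i ¬rot behind) refl
          where
          behind : Behind i (γ i • q)
          behind = CCW-rotate (subst₂ (λ s r → Counterclockwise s r (γ i • q))
            (Paired.start-to-end ¬rot) (Paired.end-to-start ¬rot) (CCW-• (γ i) front))
        -- Now q itself crosses side `i *`, and its first step leads to `γ i • q`; the crossing rule
        -- at q is solved for the value there.
        go (inj₂ (inj₂ (inj₂ b))) = ≈ᴹ-sym (begin
          g ▸ ψ q +ᴹ offset i                                         ≈⟨ +ᴹ-congʳ (▸-cong g (ψ-cross (across k (*-¬rotation ¬rot) b))) ⟩
          g ▸ (γΓ k ▸ ψ (γ k ⁻¹ • q) +ᴹ offset k) +ᴹ offset i          ≈⟨ +ᴹ-congʳ (▸-+ g _ (offset k)) ⟩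
          (g ▸ γΓ k ▸ ψ (γ k ⁻¹ • q) +ᴹ g ▸ offset k) +ᴹ offset i      ≈⟨ +ᴹ-assoc _ _ _ ⟩
          g ▸ γΓ k ▸ ψ (γ k ⁻¹ • q) +ᴹ (g ▸ offset k +ᴹ offset i)      ≈⟨ +ᴹ-cong (▸-inverse {g} {γΓ k} (paired-inverse ¬rot) _) offset-paired ⟩
          ψ (γ k ⁻¹ • q) +ᴹ 0ᴹ                                        ≈⟨ +ᴹ-identityʳ _ ⟩
          ψ (γ k ⁻¹ • q)                                              ≈⟨ ψ-≡ (γ⁻¹-paired q) ⟩
          ψ (γ i • q) ∎)

    module RotatedSide {i} (rot : Rotation i) where
      private
        g = γΓ i
        c = offset i
        i*≡i = proj₁ rot

      trace : Carrierᴹ → Carrierᴹ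
      trace m = m +ᴹ (g ▸ m +ᴹ g ▸ g ▸ m)

      ▸³ : ∀ m → g ▸ g ▸ g ▸ m ≈ᴹ m
      ▸³ m = begin
        g ▸ g ▸ g ▸ m           ≈⟨ ▸-cong g (▸-∙ g g m) ⟨
        g ▸ (g ∙Γ g) ▸ m        ≈⟨ ▸-inverse {g} {g ∙Γ g} (Rotated.rotation³ rot) m ⟩
        m ∎

      trace-cong : ∀ {u v} → u ≈ᴹ v → trace u ≈ᴹ trace v
      trace-cong u≈v = +ᴹ-cong u≈v (+ᴹ-cong (▸-cong g u≈v) (▸-cong g (▸-cong g u≈v)))

      trace-+ : ∀ u v → trace (u +ᴹ v) ≈ᴹ trace u +ᴹ trace v
      trace-+ u v = begin
        (u +ᴹ v) +ᴹ (g ▸ (u +ᴹ v) +ᴹ g ▸ g ▸ (u +ᴹ v))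
          ≈⟨ +ᴹ-congˡ (+ᴹ-cong (▸-+ g u v) (≈ᴹ-trans (▸-cong g (▸-+ g u v)) (▸-+ g (g ▸ u) (g ▸ v)))) ⟩
        (u +ᴹ v) +ᴹ ((g ▸ u +ᴹ g ▸ v) +ᴹ (g ▸ g ▸ u +ᴹ g ▸ g ▸ v))   ≈⟨ +ᴹ-congˡ (interchange (g ▸ u) (g ▸ v) _ _) ⟩
        (u +ᴹ v) +ᴹ ((g ▸ u +ᴹ g ▸ g ▸ u) +ᴹ (g ▸ v +ᴹ g ▸ g ▸ v))   ≈⟨ interchange u v _ _ ⟩
        trace u +ᴹ trace v ∎

      trace-▸ : ∀ m → trace (g ▸ m) ≈ᴹ trace m
      trace-▸ m = begin
        g ▸ m +ᴹ (g ▸ g ▸ m +ᴹ g ▸ g ▸ g ▸ m)   ≈⟨ +ᴹ-assoc _ _ _ ⟨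
        (g ▸ m +ᴹ g ▸ g ▸ m) +ᴹ g ▸ g ▸ g ▸ m   ≈⟨ +ᴹ-comm _ _ ⟩
        g ▸ g ▸ g ▸ m +ᴹ (g ▸ m +ᴹ g ▸ g ▸ m)   ≈⟨ +ᴹ-congʳ (▸³ m) ⟩
        trace m ∎

      offset-rotated : c ≈ᴹ ρ i -ᴹ g ▸ ρ (next i)
      offset-rotated = ≈ᴹ-reflexive (cong (λ j → ρ i -ᴹ g ▸ ρ (next j)) i*≡i)

      -- The operator 1 + g + g² does not distinguish m from g m, so it sends c to the difference of
      -- its values at `ρ i` and `ρ (next i)`. That difference vanishes because the operator kills
      -- `side i`.
      trace-offset : trace c ≈ᴹ 0ᴹ
      trace-offset = begin
        trace c                                         ≈⟨ +ᴹ-identityʳ _ ⟨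
        trace c +ᴹ 0ᴹ                                   ≈⟨ +ᴹ-congˡ (-ᴹ‿inverseʳ (trace (ρ (next i)))) ⟨
        trace c +ᴹ (trace (ρ (next i)) -ᴹ trace (ρ (next i)))     ≈⟨ +ᴹ-assoc _ _ _ ⟨
        (trace c +ᴹ trace (ρ (next i))) -ᴹ trace (ρ (next i))     ≈⟨ +ᴹ-congʳ (+ᴹ-congˡ (trace-▸ (ρ (next i)))) ⟨
        (trace c +ᴹ trace (g ▸ ρ (next i))) -ᴹ trace (ρ (next i)) ≈⟨ +ᴹ-congʳ (trace-+ c (g ▸ ρ (next i))) ⟨
        trace (c +ᴹ g ▸ ρ (next i)) -ᴹ trace (ρ (next i))         ≈⟨ +ᴹ-congʳ (trace-cong (≈ᴹ-trans (+ᴹ-congʳ offset-rotated) ([x-y]+y≈x (ρ i) _))) ⟩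
        trace (ρ i) -ᴹ trace (ρ (next i))                         ≈⟨ x≈y⇒x-y≈0 trace-ρ ⟩
        0ᴹ ∎
        where
        trace-ρ : trace (ρ i) ≈ᴹ trace (ρ (next i))
        trace-ρ = begin
          trace (ρ i)                          ≈⟨ +ᴹ-identityʳ _ ⟨
          trace (ρ i) +ᴹ 0ᴹ                    ≈⟨ +ᴹ-congˡ (side-rotated rot) ⟨
          trace (ρ i) +ᴹ trace (side i)        ≈⟨ trace-+ (ρ i) (side i) ⟨
          trace (ρ i +ᴹ side i)                ≈⟨ trace-cong (ρ-next i) ⟨
          trace (ρ (next i)) ∎

      -- The affine map m ↦ g m + c has order 3, like g.
      double-shift : ∀ m → g ▸ (g ▸ m +ᴹ c) +ᴹ c ≈ᴹ g ▸ g ▸ (m -ᴹ c)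
      double-shift m = begin
        g ▸ (g ▸ m +ᴹ c) +ᴹ c                      ≈⟨ +ᴹ-congʳ (▸-+ g (g ▸ m) c) ⟩
        (g ▸ g ▸ m +ᴹ g ▸ c) +ᴹ c                  ≈⟨ +ᴹ-assoc _ _ _ ⟩
        g ▸ g ▸ m +ᴹ (g ▸ c +ᴹ c)                  ≈⟨ +ᴹ-congˡ (inverseˡ-unique (g ▸ c +ᴹ c) (g ▸ g ▸ c) rotated) ⟩
        g ▸ g ▸ m -ᴹ g ▸ g ▸ c                     ≈⟨ ▸-- g (g ▸ m) (g ▸ c) ⟨
        g ▸ (g ▸ m -ᴹ g ▸ c)                       ≈⟨ ▸-cong g (▸-- g m c) ⟨
        g ▸ g ▸ (m -ᴹ c) ∎
        where
        rotated : (g ▸ c +ᴹ c) +ᴹ g ▸ g ▸ c ≈ᴹ 0ᴹ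
        rotated = begin
          (g ▸ c +ᴹ c) +ᴹ g ▸ g ▸ c    ≈⟨ +ᴹ-congʳ (+ᴹ-comm (g ▸ c) c) ⟩
          (c +ᴹ g ▸ c) +ᴹ g ▸ g ▸ c    ≈⟨ +ᴹ-assoc _ _ _ ⟩
          trace c                      ≈⟨ trace-offset ⟩
          0ᴹ ∎

      g⁻¹▸ : ∀ m → g ⁻¹Γ ▸ m ≈ᴹ g ▸ g ▸ m
      g⁻¹▸ m = begin
        g ⁻¹Γ ▸ m                    ≈⟨ ▸-cong (g ⁻¹Γ) (▸³ m) ⟨
        g ⁻¹Γ ▸ g ▸ g ▸ g ▸ m        ≈⟨ ▸-inverse {g ⁻¹Γ} {g} (∙-inverseˡ (γ i)) (g ▸ g ▸ m) ⟩
        g ▸ g ▸ m ∎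

      γ⁻¹-• : ∀ q → γ i ⁻¹ • q ≡ γ i • γ i • q
      γ⁻¹-• q = ⁻¹-•-≡ (γ i) (trans (cong (γ i •_) (sym (∙-• (γ i) (γ i) q)))
        (trans (sym (∙-• (γ i) (γ i ∙ γ i) q)) (trans (•-cong {γ i ∙ (γ i ∙ γ i)} {ε} (Rotated.rotation³ rot) q) (ε-• q))))

      ψ-turn⁻¹ : ∀ {q} → Counterclockwise (apex i) q (vertex (next i)) → ψ q ≈ᴹ g ⁻¹Γ ▸ (ψ (γ i • q) -ᴹ c)
      ψ-turn⁻¹ {q} second = begin
        ψ q                                                        ≈⟨ ψ-cross (turn⁻¹ i rot second) ⟩
        g ⁻¹Γ ▸ ψ ((γ i ⁻¹) ⁻¹ • q) -ᴹ g ⁻¹Γ ▸ c                   ≈⟨ +ᴹ-congʳ (▸-cong (g ⁻¹Γ) (ψ-≡ (•-⁻¹⁻¹ (γ i) q))) ⟩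
        g ⁻¹Γ ▸ ψ (γ i • q) -ᴹ g ⁻¹Γ ▸ c                           ≈⟨ ▸-- (g ⁻¹Γ) _ c ⟨
        g ⁻¹Γ ▸ (ψ (γ i • q) -ᴹ c) ∎

      equivariant-second : ∀ {q} → Counterclockwise (apex i) q (vertex (next i)) → Equivariant i q
      equivariant-second {q} second = ≈ᴹ-sym (begin
        g ▸ ψ q +ᴹ c                                    ≈⟨ +ᴹ-congʳ (▸-cong g (ψ-turn⁻¹ second)) ⟩
        g ▸ g ⁻¹Γ ▸ (ψ (γ i • q) -ᴹ c) +ᴹ c             ≈⟨ +ᴹ-congʳ (▸-inverse {g} {g ⁻¹Γ} (∙-inverseʳ (γ i)) _) ⟩
        (ψ (γ i • q) -ᴹ c) +ᴹ c                         ≈⟨ [x-y]+y≈x _ c ⟩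
        ψ (γ i • q) ∎)

      -- The triangle closes up: two applications of the affine map lead from vertex i through the
      -- apex to vertex `next i`. The result agrees with `ρ (next i)` because a third application
      -- would return to vertex i.
      equivariant-apex : Equivariant i (apex i)
      equivariant-apex = ≈ᴹ-sym (begin
        g ▸ ψ (apex i) +ᴹ c                             ≈⟨ +ᴹ-congʳ (▸-cong g (equivariant-forward (turn i rot (inj₁ refl)) refl)) ⟩
        g ▸ (g ▸ ψ (vertex i) +ᴹ c) +ᴹ c                ≈⟨ double-shift (ψ (vertex i)) ⟩
        g ▸ g ▸ (ψ (vertex i) -ᴹ c)                     ≈⟨ ▸-cong g (▸-cong g (-ᴹ-cong₂ (ψ-vertex refl) offset-rotated)) ⟩
        g ▸ g ▸ (ρ i -ᴹ (ρ i -ᴹ g ▸ ρ (next i)))        ≈⟨ ▸-cong g (▸-cong g (≈ᴹ-trans (+ᴹ-congˡ (-ᴹ-swap (ρ i) _)) (y+[x-y]≈x _ (ρ i)))) ⟩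
        g ▸ g ▸ g ▸ ρ (next i)                          ≈⟨ ▸³ (ρ (next i)) ⟩
        ρ (next i)                                      ≈⟨ ψ-vertex (Rotated.apex-to-end rot) ⟨
        ψ (γ i • apex i) ∎)

      -- `γ i` moves the first sector into the second, and the descents of q and `γ i • q` both
      -- continue from `γ i • γ i • q`. It remains to compare the affine map applied twice with its
      -- inverse.
      equivariant-first : ∀ {q} → Counterclockwise (vertex i) q (apex i) → Equivariant i q
      equivariant-first {q} first = ≈ᴹ-sym (begin
        g ▸ ψ q +ᴹ c                                    ≈⟨ +ᴹ-congʳ (▸-cong g (ψ-cross (turn i rot (inj₂ first)))) ⟩
        g ▸ (g ▸ ψ (γ i ⁻¹ • q) +ᴹ c) +ᴹ c              ≈⟨ double-shift (ψ (γ i ⁻¹ • q)) ⟩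
        g ▸ g ▸ (ψ (γ i ⁻¹ • q) -ᴹ c)                   ≈⟨ g⁻¹▸ _ ⟨
        g ⁻¹Γ ▸ (ψ (γ i ⁻¹ • q) -ᴹ c)                   ≈⟨ ▸-cong (g ⁻¹Γ) (+ᴹ-congʳ (ψ-≡ (γ⁻¹-• q))) ⟩
        g ⁻¹Γ ▸ (ψ (γ i • γ i • q) -ᴹ c)                ≈⟨ ψ-turn⁻¹ second ⟨
        ψ (γ i • q) ∎)
        where
        second : Counterclockwise (apex i) (γ i • q) (vertex (next i))
        second = subst (Counterclockwise (apex i) (γ i • q)) (Rotated.apex-to-end rot) (CCW-• (γ i) first)

      equivariant-behind : ∀ {q} (x : Crossing q) → crossedSide x ≡ i → Equivariant i q
      equivariant-behind (across j ¬rot _)        eq   = contradiction (subst Rotation (sym eq) rot) ¬rot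
      equivariant-behind (turn⁻¹ j _ second)      refl = equivariant-second second
      equivariant-behind (turn j _ (inj₁ q≡apex)) refl = subst (Equivariant i) (sym q≡apex) equivariant-apex
      equivariant-behind (turn j _ (inj₂ first))  refl = equivariant-first first

      equivariant : ∀ q → Equivariant i q
      equivariant q = go (position i q)
        where
        go : q ≡ vertex i ⊎ q ≡ vertex (next i) ⊎ Counterclockwise (vertex i) (vertex (next i)) q ⊎ Behind i q → Equivariant i q
        go (inj₁ eq) = equivariant-forward (turn i rot (inj₁ (cong (γ i •_) eq))) refl
        go (inj₂ (inj₁ eq)) = subst (Equivariant i) (trans (cong (λ j → vertex (next j)) i*≡i) (sym eq))
          (equivariant-end (trans (cong (λ j → γ i • vertex (next j)) i*≡i) (Rotated.end-to-start rot)))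
        -- The rotation takes side i to the edge from the apex to vertex i, and the front of the
        -- side into the sector behind that edge.
        go (inj₂ (inj₂ (inj₁ front))) = equivariant-forward (turn i rot (inj₂ first)) refl
          where
          first : Counterclockwise (vertex i) (γ i • q) (apex i)
          first = CCW-rotate (subst (λ r → Counterclockwise (apex i) r (γ i • q)) (Rotated.end-to-start rot) (CCW-• (γ i) front))
        go (inj₂ (inj₂ (inj₂ b))) = equivariant-behind (crossing b) (behind-unique (crossing-behind (crossing b)) b)

    equivariant : ∀ i q → Equivariant i q
    equivariant i q = go (rotation? i)
      where
      go : Dec (Rotation i) → Equivariant i q
      go (yes rot) = RotatedSide.equivariant rot q
      go (no ¬rot) = PairedSide.equivariant ¬rot q

    -- Recursion is on the derivation of g, so values for different derivations are never compared;
    -- the term cancels in `ψ-difference`.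
    cocycle : ∀ {g} → Generated γ g → Carrierᴹ
    cocycle (gen i)                = offset i
    cocycle one                    = 0ᴹ
    cocycle (mul {g} p p′)         = (g , p) ▸ cocycle p′ +ᴹ cocycle p
    cocycle (inv {g} p)            = -ᴹ ((g ⁻¹ , inv p) ▸ cocycle p)
    cocycle (resp _ p)             = cocycle p

    ψ-• : ∀ {g} (p : Generated γ g) q → ψ (g • q) ≈ᴹ (g , p) ▸ ψ q +ᴹ cocycle p
    ψ-• (gen i) q = equivariant i q
    ψ-• one     q = begin
      ψ (ε • q)               ≈⟨ ψ-≡ (ε-• q) ⟩
      ψ q                     ≈⟨ ▸-ε (ψ q) ⟨
      εΓ ▸ ψ q                ≈⟨ +ᴹ-identityʳ _ ⟨
      εΓ ▸ ψ q +ᴹ 0ᴹ ∎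
    ψ-• (mul {g} {h} p p′) q = begin
      ψ ((g ∙ h) • q)                                              ≈⟨ ψ-≡ (∙-• g h q) ⟩
      ψ (g • h • q)                                                ≈⟨ ψ-• p (h • q) ⟩
      (g , p) ▸ ψ (h • q) +ᴹ c                                     ≈⟨ +ᴹ-congʳ (▸-cong (g , p) (ψ-• p′ q)) ⟩
      (g , p) ▸ ((h , p′) ▸ ψ q +ᴹ c′) +ᴹ c                        ≈⟨ +ᴹ-congʳ (▸-+ (g , p) _ c′) ⟩
      ((g , p) ▸ (h , p′) ▸ ψ q +ᴹ (g , p) ▸ c′) +ᴹ c              ≈⟨ +ᴹ-assoc _ _ _ ⟩
      (g , p) ▸ (h , p′) ▸ ψ q +ᴹ ((g , p) ▸ c′ +ᴹ c)              ≈⟨ +ᴹ-congʳ (▸-∙ (g , p) (h , p′) (ψ q)) ⟨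
      (g ∙ h , mul p p′) ▸ ψ q +ᴹ ((g , p) ▸ c′ +ᴹ c) ∎
      where
      c  = cocycle p
      c′ = cocycle p′
    ψ-• (inv {g} p) q = begin
      ψ (g ⁻¹ • q)                                          ≈⟨ ▸-inverse {g ⁻¹ , inv p} {g , p} (∙-inverseˡ g) _ ⟨
      (g ⁻¹ , inv p) ▸ (g , p) ▸ ψ (g ⁻¹ • q)               ≈⟨ ▸-cong (g ⁻¹ , inv p) cancelled ⟩
      (g ⁻¹ , inv p) ▸ (ψ q -ᴹ c)                           ≈⟨ ▸-- (g ⁻¹ , inv p) (ψ q) c ⟩
      (g ⁻¹ , inv p) ▸ ψ q -ᴹ (g ⁻¹ , inv p) ▸ c ∎
      where
      c = cocycle p
      cancelled : (g , p) ▸ ψ (g ⁻¹ • q) ≈ᴹ ψ q -ᴹ c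
      cancelled = begin
        (g , p) ▸ ψ (g ⁻¹ • q)                     ≈⟨ [x+y]-y≈x _ c ⟨
        ((g , p) ▸ ψ (g ⁻¹ • q) +ᴹ c) -ᴹ c         ≈⟨ +ᴹ-congʳ (ψ-• p (g ⁻¹ • q)) ⟨
        ψ (g • g ⁻¹ • q) -ᴹ c                      ≈⟨ +ᴹ-congʳ (ψ-≡ (•-⁻¹-• g q)) ⟩
        ψ q -ᴹ c ∎
    ψ-• (resp {g} {h} g≈h p) q = begin
      ψ (h • q)                                 ≈⟨ ψ-≡ (•-cong {g} {h} g≈h q) ⟨
      ψ (g • q)                                 ≈⟨ ψ-• p q ⟩
      (g , p) ▸ ψ q +ᴹ cocycle p                ≈⟨ +ᴹ-congʳ (▸-≈Γ {g , p} {h , resp g≈h p} g≈h (ψ q)) ⟩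
      (h , resp g≈h p) ▸ ψ q +ᴹ cocycle p ∎

    ψ-difference : ∀ g r s → ψ (element g • s) -ᴹ ψ (element g • r) ≈ᴹ g ▸ (ψ s -ᴹ ψ r)
    ψ-difference (g , p) r s = begin
      ψ (g • s) -ᴹ ψ (g • r)                                  ≈⟨ -ᴹ-cong₂ (ψ-• p s) (ψ-• p r) ⟩
      ((g , p) ▸ ψ s +ᴹ c) -ᴹ ((g , p) ▸ ψ r +ᴹ c)            ≈⟨ -ᴹ-interchange _ c _ c ⟨
      ((g , p) ▸ ψ s -ᴹ (g , p) ▸ ψ r) +ᴹ (c -ᴹ c)            ≈⟨ +ᴹ-congˡ (-ᴹ‿inverseʳ c) ⟩
      ((g , p) ▸ ψ s -ᴹ (g , p) ▸ ψ r) +ᴹ 0ᴹ                  ≈⟨ +ᴹ-identityʳ _ ⟩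
      (g , p) ▸ ψ s -ᴹ (g , p) ▸ ψ r                          ≈⟨ ▸-- (g , p) (ψ s) (ψ r) ⟨
      (g , p) ▸ (ψ s -ᴹ ψ r) ∎
      where c = cocycle p

    ψ-side : ∀ i → ψ (vertex (next i)) -ᴹ ψ (vertex i) ≈ᴹ side i
    ψ-side i = begin
      ψ (vertex (next i)) -ᴹ ψ (vertex i)      ≈⟨ -ᴹ-cong₂ (≈ᴹ-trans (ψ-vertex refl) (ρ-next i)) (ψ-vertex refl) ⟩
      (ρ i +ᴹ side i) -ᴹ ρ i                   ≈⟨ +ᴹ-congʳ (+ᴹ-comm (ρ i) (side i)) ⟩
      (side i +ᴹ ρ i) -ᴹ ρ i                   ≈⟨ [x+y]-y≈x (side i) (ρ i) ⟩
      side i ∎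

    ψ-arc : ∀ g i → ψ (element g • vertex (next i)) -ᴹ ψ (element g • vertex i) ≈ᴹ g ▸ side i
    ψ-arc g i = ≈ᴹ-trans (ψ-difference g (vertex i) (vertex (next i))) (▸-cong g (ψ-side i))

-- Sums over lists and vectors

lookup-injective : ∀ {A : Set} {xs : List A} → Unique xs → ∀ i j → lookup xs i ≡ lookup xs j → i ≡ j
lookup-injective (x∉xs ∷ _) zero    zero    _  = refl
lookup-injective (x∉xs ∷ _) zero    (suc j) eq = contradiction eq (All.lookup x∉xs (∈-lookup j))
lookup-injective (x∉xs ∷ _) (suc i) zero    eq = contradiction (sym eq) (All.lookup x∉xs (∈-lookup i))
lookup-injective (_ ∷ !xs)  (suc i) (suc j) eq = cong suc (lookup-injective !xs i j eq)

module ListSums {R : Ring 0ℓ 0ℓ} (N : LeftModule R 0ℓ 0ℓ) where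
  open LeftModule N
  open LeftModuleProperties N
  open import Relation.Binary.Reasoning.Setoid ≈ᴹ-setoid

  sum-++ : ∀ us vs → sum (us ++ vs) ≈ᴹ sum us +ᴹ sum vs
  sum-++ []       vs = ≈ᴹ-sym (+ᴹ-identityˡ (sum vs))
  sum-++ (u ∷ us) vs = ≈ᴹ-trans (+ᴹ-congˡ (sum-++ us vs)) (≈ᴹ-sym (+ᴹ-assoc u (sum us) (sum vs)))

  sum-↭ : ∀ {us vs} → us ↭ vs → sum us ≈ᴹ sum vs
  sum-↭ ↭.refl         = ≈ᴹ-refl
  sum-↭ (↭.prep u p)   = +ᴹ-congˡ (sum-↭ p)
  sum-↭ (↭.swap u v p) = ≈ᴹ-trans (x∙yz≈y∙xz u v _) (+ᴹ-congˡ (+ᴹ-congˡ (sum-↭ p)))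
  sum-↭ (↭.trans p p′) = ≈ᴹ-trans (sum-↭ p) (sum-↭ p′)

  sum-map-cong : ∀ {A : Set} {f g : A → Carrierᴹ} xs → (∀ {x} → x ∈ xs → f x ≈ᴹ g x) → sum (map f xs) ≈ᴹ sum (map g xs)
  sum-map-cong []       eq = ≈ᴹ-refl
  sum-map-cong (x ∷ xs) eq = +ᴹ-cong (eq (here refl)) (sum-map-cong xs (eq ∘ there))

  sum-map-+ : ∀ {A : Set} (f g : A → Carrierᴹ) xs → sum (map (λ x → f x +ᴹ g x) xs) ≈ᴹ sum (map f xs) +ᴹ sum (map g xs)
  sum-map-+ f g []       = ≈ᴹ-sym (+ᴹ-identityˡ 0ᴹ)
  sum-map-+ f g (x ∷ xs) = ≈ᴹ-trans (+ᴹ-congˡ (sum-map-+ f g xs)) (interchange (f x) (g x) _ _)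

  sumᵥ : ∀ {m} → Vector Carrierᴹ m → Carrierᴹ
  sumᵥ = Vector.foldr _+ᴹ_ 0ᴹ

  sumᵥ-lookup : ∀ {A : Set} (f : A → Carrierᴹ) xs → sumᵥ (λ j → f (lookup xs j)) ≡ sum (map f xs)
  sumᵥ-lookup f []       = refl
  sumᵥ-lookup f (x ∷ xs) = cong (f x +ᴹ_) (sumᵥ-lookup f xs)

  sumᵥ-cong : ∀ {m} {u v : Vector Carrierᴹ m} → (∀ j → u j ≈ᴹ v j) → sumᵥ u ≈ᴹ sumᵥ v
  sumᵥ-cong {zero}  eq = ≈ᴹ-refl
  sumᵥ-cong {suc m} eq = +ᴹ-cong (eq zero) (sumᵥ-cong (eq ∘ suc))

  sumᵥ-+ : ∀ {m} (u v : Vector Carrierᴹ m) → sumᵥ (λ j → u j +ᴹ v j) ≈ᴹ sumᵥ u +ᴹ sumᵥ v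
  sumᵥ-+ {zero}  u v = ≈ᴹ-sym (+ᴹ-identityˡ 0ᴹ)
  sumᵥ-+ {suc m} u v = ≈ᴹ-trans (+ᴹ-congˡ (sumᵥ-+ (u ∘ suc) (v ∘ suc))) (interchange (u zero) (v zero) _ _)

  sumᵥ-* : ∀ {m} c (u : Vector Carrierᴹ m) → sumᵥ (λ j → c *ₗ u j) ≈ᴹ c *ₗ sumᵥ u
  sumᵥ-* {zero}  c u = ≈ᴹ-sym (*ₗ-zeroʳ c)
  sumᵥ-* {suc m} c u = ≈ᴹ-trans (+ᴹ-congˡ (sumᵥ-* c (u ∘ suc))) (≈ᴹ-sym (*ₗ-distribˡ c (u zero) _))

  sumᵥ-0 : ∀ {m} (u : Vector Carrierᴹ m) → (∀ j → u j ≈ᴹ 0ᴹ) → sumᵥ u ≈ᴹ 0ᴹ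
  sumᵥ-0 {zero}  u eq = ≈ᴹ-refl
  sumᵥ-0 {suc m} u eq = ≈ᴹ-trans (+ᴹ-cong (eq zero) (sumᵥ-0 (u ∘ suc) (eq ∘ suc))) (+ᴹ-identityˡ 0ᴹ)

  sumᵥ-single : ∀ {m} (u : Vector Carrierᴹ m) j → (∀ k → k ≢ j → u k ≈ᴹ 0ᴹ) → sumᵥ u ≈ᴹ u j
  sumᵥ-single u zero    eq = ≈ᴹ-trans (+ᴹ-congˡ (sumᵥ-0 (u ∘ suc) (λ k → eq (suc k) (λ ())))) (+ᴹ-identityʳ (u zero))
  sumᵥ-single u (suc j) eq = ≈ᴹ-trans (+ᴹ-cong (eq zero (λ ())) (sumᵥ-single (u ∘ suc) j (λ k k≢j → eq (suc k) (k≢j ∘ Fin.suc-injective))))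
                                      (+ᴹ-identityˡ (u (suc j)))

-- Additive functions of arcs, such as arcDivisor

module _ (F : ExtendedFareySymbol) (N : LeftModule (GroupRingProperties.ring F) 0ℓ 0ℓ) where
  open ExtendedFareySymbol F
  open Polygon sidePairing
  open Tessellation F
  open LeftModule N
  open LeftModuleProperties N
  open GroupAction F N
  open import Relation.Binary.Reasoning.Setoid ≈ᴹ-setoid

  module AdditiveArcs
    (arc      : ℙ¹ → ℙ¹ → Carrierᴹ)
    (arc-refl : ∀ r → arc r r ≈ᴹ 0ᴹ)
    (arc-+    : ∀ r s t → arc r s +ᴹ arc s t ≈ᴹ arc r t)
    (▸-arc    : ∀ g r s → g ▸ arc r s ≈ᴹ arc (element g • r) (element g • s))
    where

    arc-sym : ∀ r s → arc r s +ᴹ arc s r ≈ᴹ 0ᴹ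
    arc-sym r s = ≈ᴹ-trans (arc-+ r s r) (arc-refl r)

    ▸-arc-≡ : ∀ g {r s r′ s′} → element g • r ≡ r′ → element g • s ≡ s′ → g ▸ arc r s ≈ᴹ arc r′ s′
    ▸-arc-≡ g {r} {s} refl refl = ▸-arc g r s

    sideArc : Fin n → Carrierᴹ
    sideArc i = arc (vertex i) (vertex (next i))

    sideArc-paired : ∀ {i} → ¬ Rotation i → sideArc i +ᴹ γΓ i ▸ sideArc (i *) ≈ᴹ 0ᴹ
    sideArc-paired {i} ¬rot = ≈ᴹ-trans
      (+ᴹ-congˡ (▸-arc-≡ (γΓ i) (Paired.start-to-end ¬rot) (Paired.end-to-start ¬rot)))
      (arc-sym (vertex i) (vertex (next i)))

    -- The three summands are the edges of the triangle on side i, traversed once around.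
    sideArc-rotated : ∀ {i} → Rotation i → sideArc i +ᴹ (γΓ i ▸ sideArc i +ᴹ γΓ i ▸ γΓ i ▸ sideArc i) ≈ᴹ 0ᴹ
    sideArc-rotated {i} rot = begin
      arc r s +ᴹ (g ▸ arc r s +ᴹ g ▸ g ▸ arc r s)     ≈⟨ +ᴹ-congˡ (+ᴹ-cong once (≈ᴹ-trans (▸-cong g once) twice)) ⟩
      arc r s +ᴹ (arc t r +ᴹ arc s t)                 ≈⟨ +ᴹ-congˡ (+ᴹ-comm (arc t r) (arc s t)) ⟩
      arc r s +ᴹ (arc s t +ᴹ arc t r)                 ≈⟨ +ᴹ-congˡ (arc-+ s t r) ⟩
      arc r s +ᴹ arc s r                              ≈⟨ arc-sym r s ⟩
      0ᴹ ∎
      where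
      g = γΓ i
      r = vertex i
      s = vertex (next i)
      t = apex i
      once : g ▸ arc r s ≈ᴹ arc t r
      once = ▸-arc-≡ g refl (Rotated.end-to-start rot)
      twice : g ▸ arc t r ≈ᴹ arc s t
      twice = ▸-arc-≡ g (Rotated.apex-to-end rot) refl

    sideArc-closed : sum (tabulate sideArc) ≈ᴹ 0ᴹ
    sideArc-closed = begin
      sum (tabulate sideArc)                               ≡⟨ partialSum-total sideArc ⟨
      partialSum sideArc (suc last)                        ≈⟨ partialSum-suc sideArc last ⟩
      partialSum sideArc (inject₁ last) +ᴹ sideArc last    ≈⟨ +ᴹ-cong (telescope last) (≈ᴹ-reflexive (cong (λ k → arc (vertex last) (vertex k)) next-last)) ⟩
      arc o (vertex last) +ᴹ arc (vertex last) o           ≈⟨ arc-sym o (vertex last) ⟩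
      0ᴹ ∎
      where
      o = vertex zero
      last : Fin n
      last = fromℕ (2 ℕ.+ n-3)
      telescope : ∀ k → partialSum sideArc (inject₁ k) ≈ᴹ arc o (vertex k)
      telescope = Fin.<-weakInduction (λ k → partialSum sideArc (inject₁ k) ≈ᴹ arc o (vertex k)) (≈ᴹ-sym (arc-refl o)) step
        where
        step : ∀ i → partialSum sideArc (inject₁ (inject₁ i)) ≈ᴹ arc o (vertex (inject₁ i)) →
               partialSum sideArc (inject₁ (suc i)) ≈ᴹ arc o (vertex (suc i))
        step i ih = begin
          partialSum sideArc (suc (inject₁ i))                                          ≈⟨ partialSum-suc sideArc (inject₁ i) ⟩
          partialSum sideArc (inject₁ (inject₁ i)) +ᴹ sideArc (inject₁ i)               ≈⟨ +ᴹ-congʳ ih ⟩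
          arc o (vertex (inject₁ i)) +ᴹ arc (vertex (inject₁ i)) (vertex (next (inject₁ i)))  ≈⟨ arc-+ o _ _ ⟩
          arc o (vertex (next (inject₁ i)))                                             ≡⟨ cong (λ k → arc o (vertex k)) (next-inject₁ i) ⟩
          arc o (vertex (suc i)) ∎

    -- P stands for membership in a Γ-submodule containing the sides. Being joined by an arc in P is
    -- then a Γ-invariant equivalence relation on ℙ¹(ℚ), and the aim is to show that it has a single
    -- class.
    module _
      (P : Carrierᴹ → Set) (P-resp : ∀ {u v} → u ≈ᴹ v → P u → P v)
      (P-0 : P 0ᴹ) (P-+ : ∀ {u v} → P u → P v → P (u +ᴹ v)) (P-neg : ∀ {u} → P u → P (-ᴹ u))
      (P-▸ : ∀ g {u} → P u → P (g ▸ u)) (P-side : ∀ i → P (sideArc i))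
      where
      private
        o : ℙ¹
        o = vertex zero

        P-refl : ∀ r → P (arc r r)
        P-refl r = P-resp (≈ᴹ-sym (arc-refl r)) P-0

        P-trans : ∀ {r s t} → P (arc r s) → P (arc s t) → P (arc r t)
        P-trans p q = P-resp (arc-+ _ _ _) (P-+ p q)

        P-sym : ∀ {r s} → P (arc r s) → P (arc s r)
        P-sym {r} {s} p = P-resp (≈ᴹ-sym (inverseʳ-unique _ _ (arc-sym r s))) (P-neg p)

        P-• : ∀ g {r s} → P (arc r s) → P (arc (element g • r) (element g • s))
        P-• g p = P-resp (▸-arc g _ _) (P-▸ g p)

        P-vertex : ∀ k → P (arc o (vertex k))
        P-vertex = Fin.<-weakInduction (λ k → P (arc o (vertex k))) (P-refl o)
          (λ i p → P-trans p (subst (λ k → P (arc (vertex (inject₁ i)) (vertex k))) (next-inject₁ i) (P-side (inject₁ i))))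

        γ-vertex : ∀ i → ∃ λ k → γ i • vertex k ≡ vertex i
        γ-vertex i = go (rotation? i)
          where
          go : Dec (Rotation i) → ∃ λ k → γ i • vertex k ≡ vertex i
          go (yes rot) = next i , Rotated.end-to-start rot
          go (no ¬rot) = next (i *) , Paired.end-to-start ¬rot

        -- The polygon and its image under `γ i` share a vertex, which links o to `γ i • o`;
        -- chaining such links reaches the whole orbit.
        P-orbit : ∀ {g} (p : Generated γ g) → P (arc o (g • o))
        P-orbit (gen i) with γ-vertex i
        ... | k , eq = P-trans (P-vertex i) (P-sym (subst (λ s → P (arc (γ i • o) s)) eq (P-• (γΓ i) (P-vertex k))))
        P-orbit one = subst (λ s → P (arc o s)) (sym (ε-• o)) (P-refl o)
        P-orbit (mul {g} {h} p p′) = P-trans (P-orbit p)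
          (subst (λ s → P (arc (g • o) s)) (sym (∙-• g h o)) (P-• (g , p) (P-orbit p′)))
        P-orbit (inv {g} p) = P-sym (subst (λ s → P (arc (g ⁻¹ • o) s)) (⁻¹-•-• g o) (P-• (g ⁻¹ , inv p) (P-orbit p)))
        P-orbit (resp {g} {h} g≈h p) = subst (λ s → P (arc o s)) (•-cong {g} {h} g≈h o) (P-orbit p)

        orbit : ∀ {q} → Reach q → Σ[ g ∈ Γ ] ∃ λ k → element g • vertex k ≡ q
        orbit (at-vertex k eq) = εΓ , k , trans (ε-• (vertex k)) eq
        orbit {q} (cross c r) with orbit r
        ... | g , k , eq = ⟦ letter c ⟧ ∙Γ g , k , trans (∙-• (element ⟦ letter c ⟧) (element g) (vertex k))
          (trans (cong (element ⟦ letter c ⟧ •_) eq) (•-⁻¹-• (element ⟦ letter c ⟧) q))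

      P-from-origin : ∀ q → P (arc o q)
      P-from-origin q with orbit (reach q)
      ... | g , k , refl = P-trans (P-orbit (proj₂ g)) (P-• g (P-vertex k))

-- Arcs as divisors of degree 0

module ArcDivisors (F : ExtendedFareySymbol) where
  open ExtendedFareySymbol F
  open GroupRing F
  open GroupRingProperties F
  open LeftModule Δ₀-module
  open GroupAction F Δ₀-module

  indicator : ℙ¹ → ℙ¹ → ℤ
  indicator r x = if does (r ≟ℙ x) then 1ℤ else 0ℤ

  coeff-arcDivisor : ∀ r s x → Div.coeff (divisor (arcDivisor r s)) x ≡ indicator s x ℤ.+ ℤ.- indicator r x
  coeff-arcDivisor r s x with does (r ≟ℙ x) | does (s ≟ℙ x)
  ... | true  | true  = refl
  ... | true  | false = refl
  ... | false | true  = refl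
  ... | false | false = refl

  arcDivisor-+ : ∀ r s t → arcDivisor r s +ᴹ arcDivisor s t ≈ᴹ arcDivisor r t
  arcDivisor-+ r s t x = trans (FormalSums.coeff-++ (≡.decSetoid _≟ℙ_) (divisor (arcDivisor r s)) (divisor (arcDivisor s t)) x)
    (trans (cong₂ ℤ._+_ (coeff-arcDivisor r s x) (coeff-arcDivisor s t x))
      (trans (identity (indicator r x) (indicator s x) (indicator t x)) (sym (coeff-arcDivisor r t x))))
    where
    identity : ∀ a b c → (b ℤ.+ ℤ.- a) ℤ.+ (c ℤ.+ ℤ.- b) ≡ c ℤ.+ ℤ.- a
    identity = solve-∀

  arcDivisor-refl : ∀ r → arcDivisor r r ≈ᴹ 0ᴹ
  arcDivisor-refl r x = trans (coeff-arcDivisor r r x) (ℤ.+-inverseʳ (indicator r x))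

  ▸-arcDivisor : ∀ g r s → g ▸ arcDivisor r s ≈ᴹ arcDivisor (element g • r) (element g • s)
  ▸-arcDivisor g r s x = refl

  open AdditiveArcs F Δ₀-module arcDivisor arcDivisor-refl arcDivisor-+ ▸-arcDivisor public

-- Linear combinations of the generators

module Combination
  (F : ExtendedFareySymbol) (reps : Representatives F) (N : LeftModule (GroupRingProperties.ring F) 0ℓ 0ℓ)
  (e : Fin (Presentation.rank F reps) → LeftModule.Carrierᴹ N)
  where
  open ExtendedFareySymbol F
  open Representatives reps
  open Presentation F reps
  open LeftModule N
  open GroupAction F N
  open GroupRingProperties F
  open Tessellation F
  open LeftModuleProperties N
  open ListSums N
  open import Relation.Binary.Reasoning.Setoid ≈ᴹ-setoid

  eval : Vector ℤ[Γ] rank → Carrierᴹ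
  eval v = sumᵥ (λ j → v j *ₗ e j)

  eval-cong : ∀ {u v} → (∀ j → u j ≋Γ v j) → eval u ≈ᴹ eval v
  eval-cong u≋v = sumᵥ-cong (λ j → *ₗ-cong (u≋v j) ≈ᴹ-refl)

  eval-+ : ∀ u v → eval (λ j → u j ++ v j) ≈ᴹ eval u +ᴹ eval v
  eval-+ u v = ≈ᴹ-trans (sumᵥ-cong (λ j → *ₗ-distribʳ (e j) (u j) (v j))) (sumᵥ-+ (λ j → u j *ₗ e j) (λ j → v j *ₗ e j))

  eval-* : ∀ c v → eval (λ j → c *Γ v j) ≈ᴹ c *ₗ eval v
  eval-* c v = ≈ᴹ-trans (sumᵥ-cong (λ j → *ₗ-assoc c (v j) (e j))) (sumᵥ-* c (λ j → v j *ₗ e j))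

  eval-0 : eval (λ _ → []) ≈ᴹ 0ᴹ
  eval-0 = sumᵥ-0 (λ j → [] *ₗ e j) (λ j → *ₗ-zeroˡ (e j))

  eval-neg : ∀ v → eval (λ j → negate (v j)) ≈ᴹ -ᴹ eval v
  eval-neg v = inverseˡ-unique _ _ (begin
    eval (λ j → negate (v j)) +ᴹ eval v     ≈⟨ eval-+ (λ j → negate (v j)) v ⟨
    eval (λ j → negate (v j) ++ v j)        ≈⟨ eval-cong (λ j → Ring.-‿inverseˡ ring (v j)) ⟩
    eval (λ _ → [])                         ≈⟨ eval-0 ⟩
    0ᴹ ∎)

  eval-single : ∀ j c → eval (single j c) ≈ᴹ c *ₗ e j
  eval-single j c = ≈ᴹ-trans (sumᵥ-single (λ k → single j c k *ₗ e k) j off) (≈ᴹ-reflexive (cong (λ b → (if b then c else []) *ₗ e j) (dec-true (j Fin.≟ j) refl)))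
    where
    off : ∀ k → k ≢ j → single j c k *ₗ e k ≈ᴹ 0ᴹ
    off k k≢j = ≈ᴹ-trans (≈ᴹ-reflexive (cong (λ b → (if b then c else []) *ₗ e k) (dec-false (j Fin.≟ k) (k≢j ∘ sym)))) (*ₗ-zeroˡ (e k))

  μ-coeff-≡ : ∀ {i o} (ell : Elliptic i) → μ-ell i ell ≡ o → μ-coeff i ell ≡ powerSum (γΓ i) (orderℕ o)
  μ-coeff-≡ {i} ell refl = powerSum-≡ (γΓ i) (orderℕ (μ-ell i ell))

  μ-coeff-paired : ∀ {i} (ell : Elliptic i) → ¬ Rotation i → ∀ m → μ-coeff i ell *ₗ m ≈ᴹ m +ᴹ γΓ i ▸ m
  μ-coeff-paired {i} ell ¬rot m = ≈ᴹ-trans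
    (≈ᴹ-reflexive (cong (_*ₗ m) (μ-coeff-≡ ell (order-two (μ-ell i ell) refl)))) (powerSum-2 (γΓ i) m)
    where
    order-two : ∀ o → μ-ell i ell ≡ o → μ-ell i ell ≡ two
    order-two two   eq = eq
    order-two three eq = contradiction (ell , eq) ¬rot

  μ-coeff-rotated : ∀ {i} (ell : Elliptic i) → Rotation i → ∀ m →
                    μ-coeff i ell *ₗ m ≈ᴹ m +ᴹ (γΓ i ▸ m +ᴹ γΓ i ▸ γΓ i ▸ m)
  μ-coeff-rotated {i} ell (ell′ , eq) m = ≈ᴹ-trans
    (≈ᴹ-reflexive (cong (_*ₗ m) (μ-coeff-≡ ell (trans (cong (μ-ell i) (uip ell ell′)) eq)))) (powerSum-3 (γΓ i) m)

  λ-coeff-elliptic : ∀ {i} → Elliptic i → ∀ m → λ-coeff i *ₗ m ≈ᴹ m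
  λ-coeff-elliptic {i} ell m with elliptic? i
  ... | yes _   = *ₗ-identityˡ m
  ... | no ¬ell = contradiction ell ¬ell

  λ-coeff-≡ : ∀ {i} → ¬ Elliptic i → λ-coeff i ≡ 1- (γΓ i ⁻¹Γ)
  λ-coeff-≡ {i} ¬ell with elliptic? i
  ... | yes ell = contradiction ell ¬ell
  ... | no _    = 1-‿≡ (γΓ i ⁻¹Γ)

  λ-coeff-nonElliptic : ∀ {i} → ¬ Elliptic i → ∀ m → λ-coeff i *ₗ m ≈ᴹ m -ᴹ γΓ i ⁻¹Γ ▸ m
  λ-coeff-nonElliptic {i} ¬ell m = ≈ᴹ-trans (≈ᴹ-reflexive (cong (_*ₗ m) (λ-coeff-≡ ¬ell))) (1-‿*ₗ (γΓ i ⁻¹Γ) m)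

  ell : List (Fin n)
  ell = filter elliptic? (allFin n)

  ∈-ell⁺ : ∀ {i} → Elliptic i → i ∈ ell
  ∈-ell⁺ e = ∈-filter⁺ elliptic? (∈-allFin _) e

  ∈-ell⁻ : ∀ {i} → i ∈ ell → Elliptic i
  ∈-ell⁻ i∈ = proj₂ (∈-filter⁻ elliptic? {xs = allFin n} i∈)

  *-injective : ∀ {i j} → i * ≡ j * → i ≡ j
  *-injective {i} {j} eq = trans (sym (*-involutive i)) (trans (cong _* eq) (*-involutive j))

  *-nonElliptic : ∀ {i} → ¬ Elliptic i → ¬ Elliptic (i *)
  *-nonElliptic ¬e e = ¬e (*-injective e)

  -- Both lists are free of repetitions and have the same members. This splits the boundary sum in
  -- the shape of the first relation, where a side in E stands for itself and its partner.
  sides-↭ : allFin n ↭ E ++ (map _* E ++ ell)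
  sides-↭ = ∼bag⇒↭ (unique∧set⇒bag (Unique.allFin⁺ n) unique (mk⇔ (λ _ → covered _) (λ _ → ∈-allFin _)))
    where
    unique : Unique (E ++ (map _* E ++ ell))
    unique = Unique.++⁺ E-unique
      (Unique.++⁺ (Unique.map⁺ *-injective E-unique) (Unique.filter⁺ elliptic? (Unique.allFin⁺ n))
        λ (i∈E* , i∈ell) → let (j , j∈E , eq) = ∈-map⁻ _* i∈E* in
          *-nonElliptic (E-nonElliptic j∈E) (subst Elliptic eq (∈-ell⁻ i∈ell)))
      λ (i∈E , i∈rest) → [ (λ i∈E* → let (j , j∈E , eq) = ∈-map⁻ _* i∈E* in E-separates j∈E (subst (_∈ E) eq i∈E))
                         , (λ i∈ell → E-nonElliptic i∈E (∈-ell⁻ i∈ell)) ]′ (∈-++⁻ (map _* E) i∈rest)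
    covered : ∀ i → i ∈ E ++ (map _* E ++ ell)
    covered i = go (elliptic? i)
      where
      go : Dec (Elliptic i) → i ∈ E ++ (map _* E ++ ell)
      go (yes e) = ∈-++⁺ʳ E (∈-++⁺ʳ (map _* E) (∈-ell⁺ e))
      go (no ¬e) = [ ∈-++⁺ˡ , (λ i*∈E → ∈-++⁺ʳ E (∈-++⁺ˡ (subst (_∈ map _* E) (*-involutive i) (∈-map⁺ _* i*∈E)))) ]′ (E-covers i ¬e)

  nonElliptic-¬rotation : ∀ {i} → ¬ Elliptic i → ¬ Rotation i
  nonElliptic-¬rotation ¬e (e , _) = ¬e e

  module _ (f : Fin n → Carrierᴹ) (f-arc : ∀ j → e j ≈ᴹ f (arc j))
           (f-paired : ∀ {i} → ¬ Rotation i → f i +ᴹ γΓ i ▸ f (i *) ≈ᴹ 0ᴹ) where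

    -- By `f-paired`, (1 - γ⁻¹) f i equals f i + f (i *), so the first relation evaluates to the sum
    -- along the whole boundary.
    eval-λ : eval (λ j → λ-coeff (arc j)) ≈ᴹ sum (tabulate f)
    eval-λ = begin
      eval (λ j → λ-coeff (arc j))                                   ≈⟨ sumᵥ-cong (λ j → *ₗ-cong (λ _ → refl) (f-arc j)) ⟩
      sumᵥ (λ j → λ-coeff (arc j) *ₗ f (arc j))                      ≡⟨ sumᵥ-lookup h 𝒜 ⟩
      sum (map h (E ++ ell))                                         ≡⟨ cong sum (map-++ h E ell) ⟩
      sum (map h E ++ map h ell)                                     ≈⟨ sum-++ (map h E) (map h ell) ⟩
      sum (map h E) +ᴹ sum (map h ell)                               ≈⟨ +ᴹ-cong (sum-map-cong E λ-E) (sum-map-cong ell λ i∈ → λ-coeff-elliptic (∈-ell⁻ i∈) _) ⟩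
      sum (map (λ i → f i +ᴹ f (i *)) E) +ᴹ sum (map f ell)          ≈⟨ +ᴹ-congʳ (sum-map-+ f (f ∘ _*) E) ⟩
      (sum (map f E) +ᴹ sum (map (f ∘ _*) E)) +ᴹ sum (map f ell)     ≈⟨ +ᴹ-assoc _ _ _ ⟩
      sum (map f E) +ᴹ (sum (map (f ∘ _*) E) +ᴹ sum (map f ell))     ≡⟨ cong (λ us → sum (map f E) +ᴹ (sum us +ᴹ sum (map f ell))) (map-∘ E) ⟩
      sum (map f E) +ᴹ (sum (map f (map _* E)) +ᴹ sum (map f ell))   ≈⟨ +ᴹ-congˡ (sum-++ (map f (map _* E)) (map f ell)) ⟨
      sum (map f E) +ᴹ sum (map f (map _* E) ++ map f ell)           ≡⟨ cong (λ us → sum (map f E) +ᴹ sum us) (map-++ f (map _* E) ell) ⟨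
      sum (map f E) +ᴹ sum (map f (map _* E ++ ell))                 ≈⟨ sum-++ (map f E) _ ⟨
      sum (map f E ++ map f (map _* E ++ ell))                       ≡⟨ cong sum (map-++ f E (map _* E ++ ell)) ⟨
      sum (map f (E ++ (map _* E ++ ell)))                           ≈⟨ sum-↭ (↭.map⁺ f sides-↭) ⟨
      sum (map f (allFin n))                                         ≡⟨ cong sum (map-tabulate (λ i → i) f) ⟩
      sum (tabulate f) ∎
      where
      h : Fin n → Carrierᴹ
      h i = λ-coeff i *ₗ f i
      λ-E : ∀ {i} → i ∈ E → h i ≈ᴹ f i +ᴹ f (i *)
      λ-E {i} i∈E = ≈ᴹ-trans (λ-coeff-nonElliptic (E-nonElliptic i∈E) (f i)) (+ᴹ-congˡ (≈ᴹ-sym (begin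
        f (i *)                                   ≈⟨ ▸-inverse {γΓ i ⁻¹Γ} {γΓ i} (∙-inverseˡ (γ i)) (f (i *)) ⟨
        γΓ i ⁻¹Γ ▸ γΓ i ▸ f (i *)                 ≈⟨ ▸-cong (γΓ i ⁻¹Γ) (inverseʳ-unique (f i) _ (f-paired (nonElliptic-¬rotation (E-nonElliptic i∈E)))) ⟩
        γΓ i ⁻¹Γ ▸ (-ᴹ f i)                       ≈⟨ ▸-neg (γΓ i ⁻¹Γ) (f i) ⟩
        -ᴹ (γΓ i ⁻¹Γ ▸ f i) ∎)))

    relation-holds : (∀ {i} → Rotation i → f i +ᴹ (γΓ i ▸ f i +ᴹ γΓ i ▸ γΓ i ▸ f i) ≈ᴹ 0ᴹ) →
                     sum (tabulate f) ≈ᴹ 0ᴹ → ∀ x → eval (relation x) ≈ᴹ 0ᴹ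
    relation-holds f-rotated f-closed (inj₁ _)         = ≈ᴹ-trans eval-λ f-closed
    relation-holds f-rotated f-closed (inj₂ (j , ell)) = begin
      eval (single j (μ-coeff (arc j) ell))    ≈⟨ eval-single j _ ⟩
      μ-coeff (arc j) ell *ₗ e j               ≈⟨ *ₗ-cong (λ _ → refl) (f-arc j) ⟩
      μ-coeff (arc j) ell *ₗ f (arc j)         ≈⟨ go (rotation? (arc j)) ⟩
      0ᴹ ∎
      where
      go : Dec (Rotation (arc j)) → μ-coeff (arc j) ell *ₗ f (arc j) ≈ᴹ 0ᴹ
      go (yes rot) = ≈ᴹ-trans (μ-coeff-rotated ell rot _) (f-rotated rot)
      -- For order 2 the relation 1 + γ is the pairing identity, since the side is its own partner.
      go (no ¬rot) = ≈ᴹ-trans (μ-coeff-paired ell ¬rot _)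
        (≈ᴹ-trans (≈ᴹ-reflexive (cong (λ k → f (arc j) +ᴹ γΓ (arc j) ▸ f k) (sym ell))) (f-paired ¬rot))

  module _ (holds : ∀ x → eval (relation x) ≈ᴹ 0ᴹ) where

    eval-span : ∀ {u} → Span free relation u → eval u ≈ᴹ 0ᴹ
    eval-span (span-gen x)                = holds x
    eval-span span-0                      = eval-0
    eval-span (span-+ {u} {v} s t)        = ≈ᴹ-trans (eval-+ u v) (≈ᴹ-trans (+ᴹ-cong (eval-span s) (eval-span t)) (+ᴹ-identityˡ 0ᴹ))
    eval-span (span-* c {v} s)            = ≈ᴹ-trans (eval-* c v) (≈ᴹ-trans (*ₗ-cong (λ _ → refl) (eval-span s)) (*ₗ-zeroʳ c))
    eval-span (span-resp {u} {v} u≈v s)   = ≈ᴹ-trans (≈ᴹ-sym (eval-cong u≈v)) (eval-span s)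

    eval-quotient : ∀ u v → Span free relation (λ j → u j ++ negate (v j)) → eval u ≈ᴹ eval v
    eval-quotient u v s = x-y≈0⇒x≈y (eval u) (eval v) (begin
      eval u -ᴹ eval v                       ≈⟨ +ᴹ-congˡ (eval-neg v) ⟨
      eval u +ᴹ eval (λ j → negate (v j))    ≈⟨ eval-+ u (λ j → negate (v j)) ⟨
      eval (λ j → u j ++ negate (v j))       ≈⟨ eval-span s ⟩
      0ᴹ ∎)

  InImage : Carrierᴹ → Set
  InImage m = ∃ λ v → eval v ≈ᴹ m

  image-* : ∀ c {m} → InImage m → InImage (c *ₗ m)
  image-* c (v , eq) = (λ j → c *Γ v j) , ≈ᴹ-trans (eval-* c v) (*ₗ-cong (λ _ → refl) eq)

  image-+ : ∀ {m m′} → InImage m → InImage m′ → InImage (m +ᴹ m′)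
  image-+ (u , eq) (v , eq′) = (λ j → u j ++ v j) , ≈ᴹ-trans (eval-+ u v) (+ᴹ-cong eq eq′)

  image-neg : ∀ {m} → InImage m → InImage (-ᴹ m)
  image-neg (v , eq) = (λ j → negate (v j)) , ≈ᴹ-trans (eval-neg v) (-ᴹ‿cong eq)

  image-generator : ∀ j → InImage (e j)
  image-generator j = single j 1Γ , ≈ᴹ-trans (eval-single j 1Γ) (*ₗ-identityˡ (e j))

  place : ∀ i → i ∈ 𝒜 ⊎ (¬ Elliptic i × i * ∈ E)
  place i = go (elliptic? i)
    where
    go : Dec (Elliptic i) → i ∈ 𝒜 ⊎ (¬ Elliptic i × i * ∈ E)
    go (yes e) = inj₁ (∈-++⁺ʳ E (∈-ell⁺ e))
    go (no ¬e) = [ (λ i∈E → inj₁ (∈-++⁺ˡ i∈E)) , (λ i*∈E → inj₂ (¬e , i*∈E)) ]′ (E-covers i ¬e)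

  generator : ∀ {i} → i ∈ 𝒜 → Carrierᴹ
  generator p = e (index p)

  image-side : ∀ (f : Fin n → Carrierᴹ) → (∀ j → e j ≈ᴹ f (arc j)) →
    (∀ {i} → ¬ Rotation i → f i +ᴹ γΓ i ▸ f (i *) ≈ᴹ 0ᴹ) → ∀ i → InImage (f i)
  image-side f f-arc f-paired i = [ member , far ]′ (place i)
    where
    member : ∀ {i} → i ∈ 𝒜 → InImage (f i)
    member p = proj₁ image , ≈ᴹ-trans (proj₂ image) (≈ᴹ-trans (f-arc (index p)) (≈ᴹ-reflexive (cong f (sym (lookup-index p)))))
      where image = image-generator (index p)
    far : ¬ Elliptic i × i * ∈ E → InImage (f i)
    far (¬ell , i*∈E) = proj₁ image , ≈ᴹ-trans (proj₂ image)
        (≈ᴹ-sym (inverseˡ-unique _ _ (f-paired (nonElliptic-¬rotation ¬ell))))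
      where image = image-neg (image-* ((1ℤ , γΓ i) ∷ []) (member (∈-++⁺ˡ i*∈E)))

  𝒜-unique : Unique 𝒜
  𝒜-unique = Unique.++⁺ E-unique (Unique.filter⁺ elliptic? (Unique.allFin⁺ n))
    (λ (i∈E , i∈ell) → E-nonElliptic i∈E (∈-ell⁻ i∈ell))

  generator-unique : ∀ {i} (p q : i ∈ 𝒜) → generator p ≡ generator q
  generator-unique p q = cong e (lookup-injective 𝒜-unique (index p) (index q) (trans (sym (lookup-index p)) (lookup-index q)))

  ∈𝒜⇒∈E : ∀ {i} → ¬ Elliptic i → i ∈ 𝒜 → i ∈ E
  ∈𝒜⇒∈E ¬ell i∈𝒜 = [ (λ i∈E → i∈E) , (λ i∈ell → contradiction (∈-ell⁻ i∈ell) ¬ell) ]′ (∈-++⁻ E i∈𝒜)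

  -- Outside `𝒜` are only the partners of sides in E; their values are forced by `side-paired`.
  side : Fin n → Carrierᴹ
  side i = [ generator , (λ (_ , i*∈E) → -ᴹ (γΓ i ▸ generator (∈-++⁺ˡ i*∈E))) ]′ (place i)

  side-member : ∀ {i} (p : i ∈ 𝒜) → side i ≈ᴹ generator p
  side-member {i} p = go (place i)
    where
    go : ∀ x → [ generator , (λ (_ , i*∈E) → -ᴹ (γΓ i ▸ generator (∈-++⁺ˡ i*∈E))) ]′ x ≈ᴹ generator p
    go (inj₁ q)              = ≈ᴹ-reflexive (generator-unique q p)
    go (inj₂ (¬ell , i*∈E)) = contradiction (subst (_∈ E) (sym (*-involutive i)) (∈𝒜⇒∈E ¬ell p)) (E-separates i*∈E)

  side-far : ∀ {i} → ¬ Elliptic i → (p : i * ∈ E) → side i ≈ᴹ -ᴹ (γΓ i ▸ generator (∈-++⁺ˡ p))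
  side-far {i} ¬ell p = go (place i)
    where
    go : ∀ x → [ generator , (λ (_ , i*∈E) → -ᴹ (γΓ i ▸ generator (∈-++⁺ˡ i*∈E))) ]′ x ≈ᴹ -ᴹ (γΓ i ▸ generator (∈-++⁺ˡ p))
    go (inj₁ q)          = contradiction p (E-separates (∈𝒜⇒∈E ¬ell q))
    go (inj₂ (_ , i*∈E)) = -ᴹ‿cong (▸-cong (γΓ i) (≈ᴹ-reflexive (generator-unique (∈-++⁺ˡ i*∈E) (∈-++⁺ˡ p))))

  side-arc : ∀ j → e j ≈ᴹ side (arc j)
  side-arc j = ≈ᴹ-sym (≈ᴹ-trans (side-member (∈-lookup j))
    (≈ᴹ-reflexive (cong e (lookup-injective 𝒜-unique _ j (sym (lookup-index (∈-lookup {xs = 𝒜} j)))))))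

  module _ (holds : ∀ x → eval (relation x) ≈ᴹ 0ᴹ) where

    private
      -- The relations are indexed by positions in `𝒜`; this transfers their consequences to the
      -- elliptic sides themselves.
      elliptic-induction : (P : Fin n → Set) → (∀ j → Elliptic (arc j) → P (arc j)) → ∀ i → Elliptic i → P i
      elliptic-induction P step i ell = subst P (sym (lookup-index p)) (step (index p) (subst Elliptic (lookup-index p) ell))
        where
        p : i ∈ 𝒜
        p = ∈-++⁺ʳ E (∈-ell⁺ ell)

      μ-holds : ∀ j (ell : Elliptic (arc j)) → μ-coeff (arc j) ell *ₗ side (arc j) ≈ᴹ 0ᴹ
      μ-holds j ell = begin
        μ-coeff (arc j) ell *ₗ side (arc j)      ≈⟨ *ₗ-cong (λ _ → refl) (side-arc j) ⟨
        μ-coeff (arc j) ell *ₗ e j               ≈⟨ eval-single j _ ⟨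
        eval (single j (μ-coeff (arc j) ell))    ≈⟨ holds (inj₂ (j , ell)) ⟩
        0ᴹ ∎

    side-paired : ∀ {i} → ¬ Rotation i → side i +ᴹ γΓ i ▸ side (i *) ≈ᴹ 0ᴹ
    side-paired {i} ¬rot = go (elliptic? i)
      where
      go : Dec (Elliptic i) → side i +ᴹ γΓ i ▸ side (i *) ≈ᴹ 0ᴹ
      go (yes ell) = elliptic-induction (λ i → ¬ Rotation i → side i +ᴹ γΓ i ▸ side (i *) ≈ᴹ 0ᴹ)
        (λ j ell ¬rot → ≈ᴹ-trans
          (≈ᴹ-reflexive (cong (λ k → side (arc j) +ᴹ γΓ (arc j) ▸ side k) ell))
          (≈ᴹ-trans (≈ᴹ-sym (μ-coeff-paired ell ¬rot _)) (μ-holds j ell)))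
        i ell ¬rot
      go (no ¬ell) = [ near , far ]′ (E-covers i ¬ell)
        where
        far : i * ∈ E → side i +ᴹ γΓ i ▸ side (i *) ≈ᴹ 0ᴹ
        far p = ≈ᴹ-trans (+ᴹ-cong (side-far ¬ell p) (▸-cong (γΓ i) (side-member (∈-++⁺ˡ p)))) (-ᴹ‿inverseˡ _)
        near : i ∈ E → side i +ᴹ γΓ i ▸ side (i *) ≈ᴹ 0ᴹ
        near p = begin
          side i +ᴹ γΓ i ▸ side (i *)                                  ≈⟨ +ᴹ-cong (side-member (∈-++⁺ˡ p)) (▸-cong (γΓ i) (side-far (*-nonElliptic ¬ell) p′)) ⟩
          generator (∈-++⁺ˡ p) +ᴹ γΓ i ▸ (-ᴹ (γΓ (i *) ▸ generator (∈-++⁺ˡ p′)))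
            ≈⟨ +ᴹ-congˡ (≈ᴹ-trans (▸-neg (γΓ i) _) (-ᴹ‿cong (▸-inverse {γΓ i} {γΓ (i *)} (paired-inverse ¬rot) _))) ⟩
          generator (∈-++⁺ˡ p) -ᴹ generator (∈-++⁺ˡ p′)                ≈⟨ x≈y⇒x-y≈0 (≈ᴹ-reflexive same) ⟩
          0ᴹ ∎
          where
          p′ : (i *) * ∈ E
          p′ = subst (_∈ E) (sym (*-involutive i)) p
          same : generator (∈-++⁺ˡ p) ≡ generator (∈-++⁺ˡ p′)
          same = cong e (lookup-injective 𝒜-unique _ _
            (trans (sym (lookup-index (∈-++⁺ˡ p))) (trans (sym (*-involutive i)) (lookup-index (∈-++⁺ˡ p′)))))

    side-rotated : ∀ {i} → Rotation i → side i +ᴹ (γΓ i ▸ side i +ᴹ γΓ i ▸ γΓ i ▸ side i) ≈ᴹ 0ᴹ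
    side-rotated {i} rot = elliptic-induction
      (λ i → Rotation i → side i +ᴹ (γΓ i ▸ side i +ᴹ γΓ i ▸ γΓ i ▸ side i) ≈ᴹ 0ᴹ)
      (λ j ell rot → ≈ᴹ-trans (≈ᴹ-sym (μ-coeff-rotated ell rot _)) (μ-holds j ell))
      i (proj₁ rot) rot

    side-closed : sum (tabulate side) ≈ᴹ 0ᴹ
    side-closed = ≈ᴹ-trans (≈ᴹ-sym (eval-λ side side-arc side-paired)) (holds (inj₁ tt))

-- Integration of a function on ℙ¹ against divisors

module Integration
  (F : ExtendedFareySymbol) (N : LeftModule (GroupRingProperties.ring F) 0ℓ 0ℓ)
  (ψ : ℙ¹ → LeftModule.Carrierᴹ N)
  where
  open ExtendedFareySymbol F
  open GroupRing F
  open GroupRingProperties F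
  open LeftModule N
  open LeftModuleProperties N
  open GroupAction F N
  open ListSums N
  open import Relation.Binary.Reasoning.Setoid ≈ᴹ-setoid

  ψ-cong : ∀ {r s} → r ≡ s → ψ r ≈ᴹ ψ s
  ψ-cong refl = ≈ᴹ-refl

  infixr 7 _·_
  abstract
    -- ℤ acts through the multiples of `εΓ`, so that `·-▸` can merge an integer and a group element
    -- into one term of the group ring.
    _·_ : ℤ → Carrierᴹ → Carrierᴹ
    k · m = ((k , εΓ) ∷ []) *ₗ m

    ·-congˡ : ∀ k {m m′} → m ≈ᴹ m′ → k · m ≈ᴹ k · m′
    ·-congˡ k = *ₗ-cong (λ _ → refl)

    ·-distribʳ : ∀ k l m → (k ℤ.+ l) · m ≈ᴹ k · m +ᴹ l · m
    ·-distribʳ k l m = ≈ᴹ-trans (*ₗ-cong (λ x → split (does (ΓS._≟_ εΓ x))) ≈ᴹ-refl)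
      (*ₗ-distribʳ m ((k , εΓ) ∷ []) ((l , εΓ) ∷ []))
      where
      identity : ∀ k l → k ℤ.+ l ℤ.+ 0ℤ ≡ k ℤ.+ (l ℤ.+ 0ℤ)
      identity = solve-∀
      split : ∀ b → (if b then k ℤ.+ l else 0ℤ) ℤ.+ 0ℤ ≡ (if b then k else 0ℤ) ℤ.+ ((if b then l else 0ℤ) ℤ.+ 0ℤ)
      split true  = identity k l
      split false = refl

    ·-distribˡ-- : ∀ k u v → k · (u -ᴹ v) ≈ᴹ k · u -ᴹ k · v
    ·-distribˡ-- k = *ₗ-distribˡ-- ((k , εΓ) ∷ [])

    ·-▸ : ∀ k g m → k · g ▸ m ≈ᴹ ((k , g) ∷ []) *ₗ m
    ·-▸ k g m = ≈ᴹ-trans (≈ᴹ-sym (*ₗ-assoc ((k , εΓ) ∷ []) ((1ℤ , g) ∷ []) m))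
      (*ₗ-cong {((k , εΓ) ∷ []) *Γ ((1ℤ , g) ∷ [])} {(k , g) ∷ []} same ≈ᴹ-refl)
      where
      open FormalSums Γ-decSetoid using (does-cong)
      same : ((k , εΓ) ∷ []) *Γ ((1ℤ , g) ∷ []) ≋Γ (k , g) ∷ []
      same x = cong₂ (λ b l → (if b then l else 0ℤ) ℤ.+ 0ℤ)
        (does-cong {εΓ ∙Γ g} {x} {g} {x} (ΓS.trans {g} {εΓ ∙Γ g} {x} (ΓS.sym {εΓ ∙Γ g} {g} (∙-identityˡ (element g))))
                                         (ΓS.trans {εΓ ∙Γ g} {g} {x} (∙-identityˡ (element g))))
        (ℤ.*-identityʳ k)

  open LinearExtension (≡.decSetoid _≟ℙ_) +ᴹ-abelianGroup _·_ ·-congˡ ·-distribʳ ψ ψ-cong public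
    renaming (extend to ∫; extend-++ to ∫-++; extend-cong to ∫-cong)

  -- A term k g of c contributes k (ψ (g • s) - ψ (g • r)), which the hypothesis turns into k g m.
  ∫-•arc : ∀ {r s m} → (∀ g → ψ (element g • s) -ᴹ ψ (element g • r) ≈ᴹ g ▸ m) →
           ∀ c → ∫ (divisor (c •₀ arcDivisor r s)) ≈ᴹ c *ₗ m
  ∫-•arc {m = m} arc≈ []            = ≈ᴹ-sym (*ₗ-zeroˡ m)
  ∫-•arc {r} {s} {m} arc≈ ((k , g) ∷ c) = begin
    (k ℤ.* 1ℤ) · a +ᴹ ((k ℤ.* -1ℤ) · b +ᴹ rest)    ≡⟨ cong₂ (λ i j → i · a +ᴹ (j · b +ᴹ rest)) (ℤ.*-identityʳ k) (k*-1 k) ⟩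
    k · a +ᴹ ((ℤ.- k) · b +ᴹ rest)                 ≈⟨ +ᴹ-congˡ (+ᴹ-congʳ (-k·m≈-[k·m] k b)) ⟩
    k · a +ᴹ (-ᴹ (k · b) +ᴹ rest)                  ≈⟨ +ᴹ-assoc _ _ _ ⟨
    (k · a -ᴹ k · b) +ᴹ rest                       ≈⟨ +ᴹ-congʳ (·-distribˡ-- k a b) ⟨
    k · (a -ᴹ b) +ᴹ rest                           ≈⟨ +ᴹ-cong (·-congˡ k (arc≈ g)) (∫-•arc arc≈ c) ⟩
    k · g ▸ m +ᴹ c *ₗ m                            ≈⟨ +ᴹ-congʳ (·-▸ k g m) ⟩
    ((k , g) ∷ []) *ₗ m +ᴹ c *ₗ m                  ≈⟨ *ₗ-distribʳ m ((k , g) ∷ []) c ⟨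
    ((k , g) ∷ c) *ₗ m ∎
    where
    a = ψ (element g • s)
    b = ψ (element g • r)
    rest = ∫ (divisor (c •₀ arcDivisor r s))
    k*-1 : ∀ k → k ℤ.* -1ℤ ≡ ℤ.- k
    k*-1 k = trans (ℤ.*-comm k -1ℤ) (ℤ.-1*i≡-i k)

  ∫-sum : ∀ {m} (D : Vector Divisor₀ m) → ∫ (divisor (Vector.foldr _+₀_ 0₀ D)) ≈ᴹ sumᵥ (λ j → ∫ (divisor (D j)))
  ∫-sum {zero}  D = ≈ᴹ-refl
  ∫-sum {suc m} D = ≈ᴹ-trans (∫-++ (divisor (D zero)) (divisor (Vector.foldr _+₀_ 0₀ (D ∘ suc)))) (+ᴹ-congˡ (∫-sum (D ∘ suc)))

-- If the relations hold for e in N, then v ↦ Σ v j e j factors through toΔ₀.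
module UniversalProperty
  (F : ExtendedFareySymbol) (reps : Representatives F) (N : LeftModule (GroupRingProperties.ring F) 0ℓ 0ℓ)
  (e : Fin (Presentation.rank F reps) → LeftModule.Carrierᴹ N)
  (holds : ∀ x → LeftModule._≈ᴹ_ N (Combination.eval F reps N e (Presentation.relation F reps x)) (LeftModule.0ᴹ N))
  where
  open ExtendedFareySymbol F
  open Presentation F reps
  open LeftModule N
  open ListSums N
  open Combination F reps N e
  open Cocycle F N side (side-paired holds) (side-rotated holds) (side-closed holds)
  open Integration F N ψ

  ∫-toΔ₀ : ∀ v → ∫ (divisor (toΔ₀ v)) ≈ᴹ eval v
  ∫-toΔ₀ v = ≈ᴹ-trans (∫-sum (λ j → v j •₀ arcDivisor (vertex (arc j)) (vertex (next (arc j)))))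
    (sumᵥ-cong (λ j → ≈ᴹ-trans (∫-•arc (λ g → ψ-arc g (arc j)) (v j)) (*ₗ-cong (λ _ → refl) (≈ᴹ-sym (side-arc j)))))

  eval-injective : ∀ u v → divisor (toΔ₀ u) Div.≋ divisor (toΔ₀ v) → eval u ≈ᴹ eval v
  eval-injective u v eq = ≈ᴹ-trans (≈ᴹ-sym (∫-toΔ₀ u)) (≈ᴹ-trans (∫-cong {divisor (toΔ₀ u)} {divisor (toΔ₀ v)} eq) (∫-toΔ₀ v))

-- The presentation

module _ (F : ExtendedFareySymbol) (reps : Representatives F) where
  open ExtendedFareySymbol F
  open Presentation F reps
  open GroupRingProperties F
  open ArcDivisors F

  private
    module Δ = LeftModule Δ₀-module
    module Free = LeftModule (freeModule rank)

    presentedModule : LeftModule ring 0ℓ 0ℓ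
    presentedModule = LeftModuleProperties.quotientModule (freeModule rank) relation

    module Q = LeftModule presentedModule

    basis : Fin rank → Vector ℤ[Γ] rank
    basis j = single j 1Γ

    generators : Fin rank → Divisor₀
    generators j = arcDivisor (vertex (arc j)) (vertex (next (arc j)))

    module CΔ = Combination F reps Δ₀-module generators
    module CF = Combination F reps (freeModule rank) basis
    module CQ = Combination F reps presentedModule basis

  sum-coordinate : ∀ {m} (u : Vector (Vector ℤ[Γ] rank) m) k →
                   ListSums.sumᵥ (freeModule rank) u k ≡ Vector.foldr _++_ [] (λ j → u j k)
  sum-coordinate {zero}  u k = refl
  sum-coordinate {suc m} u k = cong (u zero k ++_) (sum-coordinate (u ∘ suc) k)

  eval-basis : ∀ v → CF.eval v Free.≈ᴹ v
  eval-basis v k x = trans (cong (λ c → coeffΓ c x) (sum-coordinate (λ j → v j Free.*ₗ basis j) k))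
    (trans (ListSums.sumᵥ-single (TensorUnit.leftModule {R = ring}) (λ j → v j *Γ single j 1Γ k) k off x)
      (trans (cong (λ b → coeffΓ (v k *Γ (if b then 1Γ else [])) x) (dec-true (k Fin.≟ k) refl)) (*Γ-identityʳ (v k) x)))
    where
    off : ∀ j → j ≢ k → v j *Γ single j 1Γ k ≋Γ []
    off j j≢k x = trans (cong (λ b → coeffΓ (v j *Γ (if b then 1Γ else [])) x) (dec-false (j Fin.≟ k) j≢k))
                        (Ring.zeroʳ ring (v j) x)

  eval-basis-quotient : ∀ v → CQ.eval v Q.≈ᴹ v
  eval-basis-quotient v = LeftModuleProperties.quotient-≈ (freeModule rank) relation {CF.eval v} {v} (eval-basis v)

  relations-hold-quotient : ∀ x → CQ.eval (relation x) Q.≈ᴹ Q.0ᴹ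
  relations-hold-quotient x = Q.≈ᴹ-trans {CQ.eval (relation x)} {relation x} {Q.0ᴹ} (eval-basis-quotient (relation x))
    (span-resp (Free.≈ᴹ-sym {relation x Free.+ᴹ (Free.-ᴹ Free.0ᴹ)} {relation x} (Free.+ᴹ-identityʳ (relation x))) (span-gen x))

  relations-hold-Δ₀ : ∀ x → toΔ₀ (relation x) Δ.≈ᴹ Δ.0ᴹ
  relations-hold-Δ₀ = CΔ.relation-holds sideArc (λ j x → refl) sideArc-paired sideArc-rotated sideArc-closed

  toΔ₀-cong : ∀ {u v} → Span free relation (u Free.+ᴹ (Free.-ᴹ v)) → toΔ₀ u Δ.≈ᴹ toΔ₀ v
  toΔ₀-cong {u} {v} = CΔ.eval-quotient relations-hold-Δ₀ u v

  -- The universal property is applied to the presented module itself with its own generators, where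
  -- evaluation is the identity.
  toΔ₀-injective : ∀ {u v} → toΔ₀ u Δ.≈ᴹ toΔ₀ v → u Q.≈ᴹ v
  toΔ₀-injective {u} {v} eq = Q.≈ᴹ-trans {u} {CQ.eval u} {v} (Q.≈ᴹ-sym {CQ.eval u} {u} (eval-basis-quotient u))
    (Q.≈ᴹ-trans {CQ.eval u} {CQ.eval v} {v}
      (UniversalProperty.eval-injective F reps presentedModule basis relations-hold-quotient u v eq) (eval-basis-quotient v))

  arcs-in-image : ∀ q → CΔ.InImage (arcDivisor (vertex zero) q)
  arcs-in-image = P-from-origin CΔ.InImage
    (λ {D} {D′} D≈D′ (v , eq) → v , Δ.≈ᴹ-trans {toΔ₀ v} {D} {D′} eq D≈D′)
    ((λ _ → []) , CΔ.eval-0)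
    (λ {D} {D′} → CΔ.image-+ {D} {D′}) (λ {D} → CΔ.image-neg {D}) (λ g {D} → CΔ.image-* ((1ℤ , g) ∷ []) {D})
    (CΔ.image-side sideArc (λ j x → refl) sideArc-paired)

  private
    o : ℙ¹
    o = vertex zero

  -- Tails of a list of degree 0 need not have degree 0. The induction therefore treats D minus its
  -- degree times the base point o.
  DivisorInImage : Divisor → Set
  DivisorInImage D = ∃ λ v → ∀ x → Div.coeff (divisor (toΔ₀ v)) x ℤ.+ degree D ℤ.* indicator o x ≡ Div.coeff D x

  divisorInImage-∷ : ∀ k q D → CΔ.InImage (((k , εΓ) ∷ []) •₀ arcDivisor o q) → DivisorInImage D → DivisorInImage ((k , q) ∷ D)
  divisorInImage-∷ k q D (w , eq′) (v , eq) = (λ j → w j ++ v j) , λ x → begin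
      Div.coeff (divisor (toΔ₀ (λ j → w j ++ v j))) x ℤ.+ (k ℤ.+ degree D) ℤ.* indicator o x
        ≡⟨ cong (ℤ._+ (k ℤ.+ degree D) ℤ.* indicator o x) (sum-coefficient x) ⟩
      (k ℤ.* (indicator q x ℤ.+ ℤ.- indicator o x) ℤ.+ Div.coeff (divisor (toΔ₀ v)) x) ℤ.+ (k ℤ.+ degree D) ℤ.* indicator o x
        ≡⟨ identity k (indicator q x) (indicator o x) (Div.coeff (divisor (toΔ₀ v)) x) (degree D) ⟩
      k ℤ.* indicator q x ℤ.+ (Div.coeff (divisor (toΔ₀ v)) x ℤ.+ degree D ℤ.* indicator o x)
        ≡⟨ cong₂ ℤ._+_ (head (does (q ≟ℙ x))) (eq x) ⟩
      Div.coeff ((k , q) ∷ D) x ∎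
    where
    open ≡-Reasoning
    identity : ∀ k a b c d → (k ℤ.* (a ℤ.+ ℤ.- b) ℤ.+ c) ℤ.+ (k ℤ.+ d) ℤ.* b ≡ k ℤ.* a ℤ.+ (c ℤ.+ d ℤ.* b)
    identity = solve-∀
    head : ∀ b → k ℤ.* (if b then 1ℤ else 0ℤ) ≡ (if b then k else 0ℤ)
    head true  = ℤ.*-identityʳ k
    head false = ℤ.*-zeroʳ k
    cancel : ∀ k → k ℤ.* 1ℤ ℤ.+ (k ℤ.* -1ℤ ℤ.+ 0ℤ) ≡ k ℤ.* 0ℤ
    cancel = solve-∀
    cases : ∀ b b′ → (if b then k ℤ.* 1ℤ else 0ℤ) ℤ.+ ((if b′ then k ℤ.* -1ℤ else 0ℤ) ℤ.+ 0ℤ)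
                     ≡ k ℤ.* ((if b then 1ℤ else 0ℤ) ℤ.+ ℤ.- (if b′ then 1ℤ else 0ℤ))
    cases true  true  = cancel k
    cases true  false = ℤ.+-identityʳ (k ℤ.* 1ℤ)
    cases false true  = trans (ℤ.+-identityˡ _) (ℤ.+-identityʳ (k ℤ.* -1ℤ))
    cases false false = sym (ℤ.*-zeroʳ k)
    scaled : ∀ x → Div.coeff (divisor (((k , εΓ) ∷ []) •₀ arcDivisor o q)) x ≡ k ℤ.* (indicator q x ℤ.+ ℤ.- indicator o x)
    scaled x = trans (cong₂ (λ s r → Div.coeff ((k ℤ.* 1ℤ , s) ∷ (k ℤ.* -1ℤ , r) ∷ []) x) (ε-• q) (ε-• o))
                     (cases (does (q ≟ℙ x)) (does (o ≟ℙ x)))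
    sum-coefficient : ∀ x → Div.coeff (divisor (toΔ₀ (λ j → w j ++ v j))) x
                            ≡ k ℤ.* (indicator q x ℤ.+ ℤ.- indicator o x) ℤ.+ Div.coeff (divisor (toΔ₀ v)) x
    sum-coefficient x = trans (CΔ.eval-+ w v x)
      (trans (FormalSums.coeff-++ (≡.decSetoid _≟ℙ_) (divisor (toΔ₀ w)) (divisor (toΔ₀ v)) x)
             (cong (ℤ._+ Div.coeff (divisor (toΔ₀ v)) x) (trans (eq′ x) (scaled x))))

  divisor-in-image : ∀ D → DivisorInImage D
  divisor-in-image []            = (λ _ → []) , λ x → trans (ℤ.+-identityʳ _) (CΔ.eval-0 x)
  divisor-in-image ((k , q) ∷ D) = divisorInImage-∷ k q D
    (CΔ.image-* ((k , εΓ) ∷ []) {arcDivisor o q} (arcs-in-image q)) (divisor-in-image D)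

  toΔ₀-surjective : ∀ D → ∃ λ v → toΔ₀ v Δ.≈ᴹ D
  toΔ₀-surjective (D ,₀ deg≡0) = proj₁ image , λ x →
    trans (sym (trans (cong (λ d → Div.coeff (divisor (toΔ₀ (proj₁ image))) x ℤ.+ d ℤ.* indicator o x) deg≡0) (ℤ.+-identityʳ _)))
          (proj₂ image x)
    where image = divisor-in-image D

mainTheorem4 : (F : ExtendedFareySymbol) (reps : Representatives F) →
    let open Presentation F reps in
    LeftModuleMorphisms.IsLeftModuleIsomorphism presented Δ₀ toΔ₀
mainTheorem4 F reps = record
  { isLeftModuleMonomorphism = record
    { isLeftModuleHomomorphism = record
      { +ᴹ-isGroupHomomorphism = record
        { isMonoidHomomorphism = record
          { isMagmaHomomorphism = record
            { isRelHomomorphism = record { cong = λ {u} {v} → toΔ₀-cong F reps {u} {v} }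
            ; homo = CΔ.eval-+
            }
          ; ε-homo = CΔ.eval-0
          }
        ; ⁻¹-homo = CΔ.eval-neg
        }
      ; *ₗ-homo = CΔ.eval-*
      }
    ; injective = λ {u} {v} → toΔ₀-injective F reps {u} {v}
    }
  ; surjective = λ D → let (v , eq) = toΔ₀-surjective F reps D in
      v , λ {u} u~v → Δ.≈ᴹ-trans {toΔ₀ u} {toΔ₀ v} {D} (toΔ₀-cong F reps {u} {v} u~v) eq
  }
  where
  open ExtendedFareySymbol F
  open Presentation F reps
  module Δ = LeftModule (GroupRingProperties.Δ₀-module F)
  module CΔ = Combination F reps (GroupRingProperties.Δ₀-module F)
    (λ j → arcDivisor (vertex (arc j)) (vertex (next (arc j))))
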